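{- Let $\pi:\widetilde{\Gamma}\to\Gamma$ be a (free or dilated) double cover of metric graphs, with $\Gamma$ and $\widetilde{\Gamma}$ connected. Let $m_d(\widetilde{\Gamma}/\Gamma)$, $n_d(\widetilde{\Gamma}/\Gamma)$ and $d(\widetilde{\Gamma}/\Gamma)$ denote respectively the number of edges, vertices, and connected components of the dilation subgraph $\Gamma_{\mathrm{dil}}$. Then \[ J(\widetilde{\Gamma})=2^{1-m_d(\widetilde{\Gamma}/\Gamma)+n_d(\widetilde{\Gamma}/\Gamma)-2d(\widetilde{\Gamma}/\Gamma)}\,\mathrm{Pr}(\widetilde{\Gamma}/\Gamma)\,J(\Gamma), \] where $J$ denotes the Jacobian polynomial and $\mathrm{Pr}(\widetilde{\Gamma}/\Gamma)$ the Prym polynomial, and $J(\widetilde{\Gamma})$ is viewed as a polynomial in the edge lengths of $\Gamma$.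
   Context: **Graphs.** A graph $G$ has a finite non-empty vertex set $V(G)$, a finite set $H(G)$ of half-edges with a root map $r:H(G)\to V(G)$ and a fixed-point-free involution on $H(G)$ whose orbits $e=\{h,h'\}$ are the edges; $E(G)$ is the set of edges. Loops and multiple edges are allowed. The genus of a connected graph is $g(G)=b_1(G)=\#E(G)-\#V(G)+1$ (there are no vertex weights). A metric graph $\Gamma$ is a graph together with a positive length $\ell(e)$ for each edge $e$; a choice of underlying graph (model) is always fixed, and we write $V(\Gamma),E(\Gamma)$, etc. **Double covers.** A double cover $\pi:\widetilde{\Gamma}\to\Gamma$ consists of maps $V(\widetilde{\Gamma})\to V(\Gamma)$ and $H(\widetilde{\Gamma})\to H(\Gamma)$ commuting with the root maps and the edge involutions, and a degree function $d_\pi:V(\widetilde{\Gamma})\cup E(\widetilde{\Gamma})\to\mathbb{Z}_{>0}$ (the degree of a half-edge is that of its edge) such that: (i) for every $\widetilde{v}\in V(\widetilde{\Gamma})$ and every half-edge $h$ rooted at $\pi(\widetilde{v})$, $d_\pi(\widetilde{v})$ is the sum of $d_\pi(\widetilde{h})$ over the half-edges $\widetilde{h}$ rooted at $\widetilde{v}$ with $\pi(\widetilde{h})=h$; (ii) the degrees of the preimages of each vertex and each half-edge of $\Gamma$ sum to $2$; (iii) $\ell(\pi(\widetilde{e}))=d_\pi(\widetilde{e})\,\ell(\widetilde{e})$ for all $\widetilde{e}\in E(\widetilde{\Gamma})$. A vertex or edge of $\Gamma$ is dilated if it has a single preimage (of degree $2$), and undilated if it has two preimages (each of degree $1$). The dilated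 vertices and edges form the dilation subgraph $\Gamma_{\mathrm{dil}}\subset\Gamma$. The cover is free if $\Gamma_{\mathrm{dil}}=\emptyset$ and dilated otherwise. By (iii), $\ell(\widetilde{e})=\ell(\pi(\widetilde{e}))$ if $\pi(\widetilde{e})$ is undilated and $\ell(\widetilde{e})=\ell(\pi(\widetilde{e}))/2$ if $\pi(\widetilde{e})$ is dilated; in this way $J(\widetilde{\Gamma})$ below becomes a polynomial in the edge lengths of $\Gamma$. **Jacobian polynomial.** For a connected metric graph $\Gamma$ of genus $g$, \[ J(\Gamma)=\sum_{C\subset E(\Gamma)}\prod_{e\in C}\ell(e), \] summed over all $g$-element subsets $C\subset E(\Gamma)$ such that $\Gamma\backslash C$ is a tree (the interiors of the edges in $C$ are removed, all vertices are kept). **Ogods and the Prym polynomial.** Let $h=g(\widetilde{\Gamma})-g(\Gamma)$. A set $F\subset E(\Gamma)$ of exactly $h$ edges is an ogod if no edge in $F$ is dilated and each connected component of $\Gamma\backslash F$ has connected preimage in $\widetilde{\Gamma}$. Its rank $r(F)$ is the number of connected components of $\Gamma\backslash F$. The Prym polynomial is \[ \mathrm{Pr}(\widetilde{\Gamma}/\Gamma)=\sum_{F}4^{r(F)-1}\prod_{e\in F}\ell(e), \] summed over all ogods $F\subset E(\Gamma)$. -}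

module Defs where

open import Level using (Level; suc; _⊔_)
open import Algebra.Bundles using (CommutativeRing; Semiring)
import Algebra.Definitions.RawSemiring as RawSemiringOps
open import Data.Bool.Base using (if_then_else_)
open import Data.Empty using (⊥-elim)
open import Data.Fin.Base as Fin using (Fin)
open import Data.Fin.Properties as Finₚ using (any?; all?; injective⇒≤)
open import Data.Fin.Subset using (Subset; _∈_; ⊤; ∁; ∣_∣; Nonempty; inside; outside)
open import Data.Fin.Subset.Properties using (_∈?_; ∈⊤; nonempty?)
open import Data.Integer.Base as ℤ using (ℤ; +_; -[1+_])
import Data.Integer.Properties as ℤₚ
open import Data.List.Base as List using (List; []; _∷_; _++_; length; lookup; allFin)
open import Data.List.Membership.Propositional using () renaming (_∈_ to _∈ₗ_)
open import Data.List.Membership.Propositional.Properties using (∈-allFin)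
open import Data.List.Properties using (length-map; ≡-dec)
open import Data.List.Relation.Unary.All using (All; []; _∷_)
open import Data.List.Relation.Unary.AllPairs using ([]; _∷_)
open import Data.List.Relation.Unary.Any using (here; there)
open import Data.List.Relation.Unary.Unique.Propositional using (Unique)
open import Data.List.Relation.Unary.Unique.DecPropositional using (unique?)
open import Data.Nat.Base as ℕ using (ℕ; zero; NonZero; _≤_; z≤n; s≤s)
open import Data.Product using (∃; ∃!; _×_; _,_; proj₁; proj₂)
open import Data.Sum.Base using (_⊎_; inj₁; inj₂; [_,_]′)
open import Data.Vec.Base using (tabulate; []; _∷_)
open import Data.Vec.Properties using (lookup∘tabulate; []=⇒lookup; lookup⇒[]=)
open import Function.Base using (_∘_; id)
open import Relation.Binary.PropositionalEquality
  using (_≡_; _≢_; refl; sym; trans; cong; subst)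
open import Relation.Nullary using (Dec; yes; no; ¬_; does; contradiction)
open import Relation.Nullary.Decidable
  using (map′; _×-dec_; _⊎-dec_; _→-dec_; ¬?; dec-true)
open import Relation.Unary using (Pred; Decidable)

private
  variable
    a c ℓ p q : Level
    n : ℕ

infix 10 ⟦_⟧

⟦_⟧ : {P : Pred (Fin n) p} → Decidable P → Subset n
⟦ P? ⟧ = tabulate (does ∘ P?)

∈⟦⟧⁺ : {P : Pred (Fin n) p} (P? : Decidable P) {i : Fin n} → P i → i ∈ ⟦ P? ⟧
∈⟦⟧⁺ P? {i} pi =
  lookup⇒[]= i _ (trans (lookup∘tabulate (does ∘ P?) i) (dec-true (P? i) pi))

∈⟦⟧⁻ : {P : Pred (Fin n) p} (P? : Decidable P) {i : Fin n} → i ∈ ⟦ P? ⟧ → P i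
∈⟦⟧⁻ P? {i} i∈ with P? i | trans (sym (lookup∘tabulate (does ∘ P?) i)) ([]=⇒lookup i∈)
... | yes pi | _ = pi
... | no  _  | ()

∃!? : {P : Pred (Fin n) p} → Decidable P → Dec (∃! _≡_ P)
∃!? P? = map′
  (λ (x , px , h) → x , px , λ {y} → h y)
  (λ (x , px , h) → x , px , λ y → h)
  (any? λ x → P? x ×-dec all? λ y → P? y →-dec (x Finₚ.≟ y))

Σℕ : {P : Pred (Fin n) p} → Decidable P → (Fin n → ℕ) → ℕ
Σℕ P? f = sum (λ i → if does (P? i) then f i else 0)
  where open RawSemiringOps ℕ.+-*-rawSemiring using (sum)

Σℕ>0⇒∃ : {P : Pred (Fin n) p} (P? : Decidable P) (f : Fin n → ℕ) →
         0 ℕ.< Σℕ P? f → ∃ P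
Σℕ>0⇒∃ {n = ℕ.suc n} P? f 0<Σ with P? Fin.zero
... | yes p₀ = Fin.zero , p₀
... | no _   with Σℕ>0⇒∃ (P? ∘ Fin.suc) (f ∘ Fin.suc) 0<Σ
...   | i , pi = Fin.suc i , pi

-- The set of edges is the set of orbits of ι, presented by its quotient map:
-- `edge` is surjective and its fibres are exactly the orbits.
record Graph : Set where
  field
    #V #H #E  : ℕ
    nonEmpty  : NonZero #V
    root      : Fin #H → Fin #V
    ι         : Fin #H → Fin #H
    ι-invol   : ∀ h → ι (ι h) ≡ h
    ι-free    : ∀ h → ι h ≢ h
    edge      : Fin #H → Fin #E
    edge-ι    : ∀ h → edge (ι h) ≡ edge h
    edge-orb  : ∀ h h′ → edge h ≡ edge h′ → h ≡ h′ ⊎ h ≡ ι h′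
    edge-surj : ∀ e → ∃ λ h → edge h ≡ e

  half : Fin #E → Fin #H
  half e = proj₁ (edge-surj e)

  edge-half : ∀ e → edge (half e) ≡ e
  edge-half e = proj₂ (edge-surj e)

open Graph

genus : Graph → ℤ
genus G = (+ #E G) ℤ.- (+ #V G) ℤ.+ (+ 1)

record Subgraph (G : Graph) : Set where
  field
    verts  : Subset (#V G)
    edges  : Subset (#E G)
    closed : ∀ h → edge G h ∈ edges → root G h ∈ verts

open Subgraph

-- Γ \ C : the interiors of the edges in C are removed, all vertices are kept
_∖_ : (G : Graph) → Subset (#E G) → Subgraph G
verts  (G ∖ C) = ⊤
edges  (G ∖ C) = ∁ C
closed (G ∖ C) _ _ = ∈⊤

whole : (G : Graph) → Subgraph G
verts  (whole G) = ⊤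
edges  (whole G) = ⊤
closed (whole G) _ _ = ∈⊤

module _ {G : Graph} (S : Subgraph G) where

  -- The list of half-edges along which the walk leaves its successive vertices.
  IsWalk : Fin (#V G) → List (Fin (#H G)) → Fin (#V G) → Set
  IsWalk u []       v = u ≡ v
  IsWalk u (h ∷ hs) v = root G h ≡ u × edge G h ∈ edges S × IsWalk (root G (ι G h)) hs v

  Joined : Fin (#V G) → Fin (#V G) → Set
  Joined u v = ∃ λ hs → IsWalk u hs v

  -- The empty graph does not count as connected.
  Connected : Set
  Connected = Nonempty (verts S) ×
              (∀ u v → u ∈ verts S → v ∈ verts S → Joined u v)

  IsCycle : Fin (#V G) → List (Fin (#H G)) → Set
  IsCycle v hs = hs ≢ [] × IsWalk v hs v ×
                 Unique (List.map (root G) hs) × Unique (List.map (edge G) hs)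

  Acyclic : Set
  Acyclic = ∀ v hs → ¬ IsCycle v hs

  IsTree : Set
  IsTree = Connected × Acyclic

  private
    isWalk? : ∀ u hs v → Dec (IsWalk u hs v)
    isWalk? u []       v = u Finₚ.≟ v
    isWalk? u (h ∷ hs) v =
      (root G h Finₚ.≟ u) ×-dec (edge G h ∈? edges S) ×-dec isWalk? (root G (ι G h)) hs v

    walk-++ : ∀ {u w v} hs {hs′} → IsWalk u hs w → IsWalk w hs′ v → IsWalk u (hs ++ hs′) v
    walk-++ []       refl          q = q
    walk-++ (h ∷ hs) (r , e∈ , p) q = r , e∈ , walk-++ hs p q

    -- u and v are joined by a walk all of whose intermediate vertices are in the list
    Via : List (Fin (#V G)) → Fin (#V G) → Fin (#V G) → Set
    Via []       u v = u ≡ v ⊎ ∃ λ h → IsWalk u (h ∷ []) v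
    Via (w ∷ ws) u v = Via ws u v ⊎ (Via ws u w × Via ws w v)

    via? : ∀ ws u v → Dec (Via ws u v)
    via? []       u v = (u Finₚ.≟ v) ⊎-dec any? λ h → isWalk? u (h ∷ []) v
    via? (w ∷ ws) u v = via? ws u v ⊎-dec (via? ws u w ×-dec via? ws w v)

    via-base : ∀ ws {u v} → Via [] u v → Via ws u v
    via-base []       p = p
    via-base (w ∷ ws) p = inj₁ (via-base ws p)

    via-trans : ∀ {w} ws {u v} → w ∈ₗ ws → Via ws u w → Via ws w v → Via ws u v
    via-trans (_ ∷ ws) (here refl) p q = inj₂ ([ id , proj₁ ]′ p , [ id , proj₂ ]′ q)
    via-trans (_ ∷ ws) (there w∈)  (inj₁ p)        (inj₁ q)        = inj₁ (via-trans ws w∈ p q)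
    via-trans (_ ∷ ws) (there w∈)  (inj₁ p)        (inj₂ (q , q′)) = inj₂ (via-trans ws w∈ p q , q′)
    via-trans (_ ∷ ws) (there w∈)  (inj₂ (p , p′)) (inj₁ q)        = inj₂ (p , via-trans ws w∈ p′ q)
    via-trans (_ ∷ ws) (there w∈)  (inj₂ (p , _))  (inj₂ (_ , q′)) = inj₂ (p , q′)

    via⇒joined : ∀ ws {u v} → Via ws u v → Joined u v
    via⇒joined []       (inj₁ u≡v)     = [] , u≡v
    via⇒joined []       (inj₂ (h , p)) = (h ∷ []) , p
    via⇒joined (w ∷ ws) (inj₁ p)       = via⇒joined ws p
    via⇒joined (w ∷ ws) (inj₂ (p , q)) with via⇒joined ws p | via⇒joined ws q
    ... | hs , p′ | hs′ , q′ = hs ++ hs′ , walk-++ hs p′ q′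

    walk⇒via : ∀ {u v} hs → IsWalk u hs v → Via (allFin (#V G)) u v
    walk⇒via []       p            = via-base (allFin _) (inj₁ p)
    walk⇒via (h ∷ hs) (r , e∈ , p) =
      via-trans (allFin _) (∈-allFin (root G (ι G h)))
        (via-base (allFin _) (inj₂ (h , r , e∈ , refl))) (walk⇒via hs p)

  joined? : ∀ u v → Dec (Joined u v)
  joined? u v = map′ (via⇒joined (allFin _)) (λ (hs , p) → walk⇒via hs p)
                     (via? (allFin (#V G)) u v)

  connected? : Dec Connected
  connected? = nonempty? (verts S) ×-dec
    (all? λ u → all? λ v → (u ∈? verts S) →-dec ((v ∈? verts S) →-dec joined? u v))

  private
    isCycle? : ∀ v hs → Dec (IsCycle v hs)
    isCycle? v hs =
      ¬? (≡-dec Finₚ._≟_ hs []) ×-dec isWalk? v hs v ×-dec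
      unique? Finₚ._≟_ (List.map (root G) hs) ×-dec unique? Finₚ._≟_ (List.map (edge G) hs)

    boundedList? : ∀ {k} m {P : Pred (List (Fin k)) p} → Decidable P →
                   Dec (∃ λ xs → length xs ≤ m × P xs)
    boundedList? zero P? = map′ (λ p → [] , z≤n , p) (λ { ([] , _ , p) → p }) (P? [])
    boundedList? (ℕ.suc m) P? = map′
      (λ { (inj₁ p) → [] , z≤n , p
         ; (inj₂ (x , xs , l , p)) → x ∷ xs , s≤s l , p })
      (λ { ([] , _ , p) → inj₁ p
         ; (x ∷ xs , s≤s l , p) → inj₂ (x , xs , l , p) })
      (P? [] ⊎-dec any? λ x → boundedList? m (P? ∘ (x ∷_)))

    all-lookup : {A : Set a} {P : Pred A p} {xs : List A} → All P xs → ∀ i → P (lookup xs i)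
    all-lookup (px ∷ _)   Fin.zero    = px
    all-lookup (_  ∷ pxs) (Fin.suc i) = all-lookup pxs i

    unique-lookup : {A : Set a} {xs : List A} → Unique xs →
                    ∀ {i j} → lookup xs i ≡ lookup xs j → i ≡ j
    unique-lookup (_ ∷ _)  {Fin.zero}  {Fin.zero}  _  = refl
    unique-lookup (x ∷ _)  {Fin.zero}  {Fin.suc j} eq = contradiction eq (all-lookup x j)
    unique-lookup (x ∷ _)  {Fin.suc i} {Fin.zero}  eq = contradiction (sym eq) (all-lookup x i)
    unique-lookup (_ ∷ xs) {Fin.suc i} {Fin.suc j} eq = cong Fin.suc (unique-lookup xs eq)

    cycle-length : ∀ {v hs} → IsCycle v hs → length hs ≤ #E G
    cycle-length {hs = hs} (_ , _ , _ , u) =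
      subst (_≤ #E G) (length-map (edge G) hs) (injective⇒≤ (unique-lookup u))

  acyclic? : Dec Acyclic
  acyclic? = map′
    (λ none v hs cyc → none (v , hs , cycle-length {v} cyc , cyc))
    (λ acyc (v , hs , _ , cyc) → acyc v hs cyc)
    (¬? (any? λ v → boundedList? (#E G) (isCycle? v)))

  isTree? : Dec IsTree
  isTree? = connected? ×-dec acyclic?

module _ {G : Graph} (S : Subgraph G) where

  inVerts? : ∀ v → Decidable (λ u → u ∈ verts S × Joined S v u)
  inVerts? v u = (u ∈? verts S) ×-dec joined? S v u

  inEdges? : ∀ v → Decidable (λ e → e ∈ edges S × Joined S v (root G (half G e)))
  inEdges? v e = (e ∈? edges S) ×-dec joined? S v (root G (half G e))

  private
    extend : ∀ {v h} → edge G h ∈ edges S → Joined S v (root G h) → Joined S v (root G (ι G h))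
    extend {v} {h} e∈ (hs , p) = hs ++ h ∷ [] , go hs p
      where
      go : ∀ {u} hs → IsWalk S u hs (root G h) → IsWalk S u (hs ++ h ∷ []) (root G (ι G h))
      go []       q            = sym q , e∈ , refl
      go (_ ∷ hs) (r , e , q)  = r , e , go hs q

  component : Fin (#V G) → Subgraph G
  verts  (component v) = ⟦ inVerts? v ⟧
  edges  (component v) = ⟦ inEdges? v ⟧
  closed (component v) h h∈ with ∈⟦⟧⁻ (inEdges? v) h∈
  ... | e∈ , j = ∈⟦⟧⁺ (inVerts? v) (closed S h e∈ , joined-root)
    where
    h₀ = half G (edge G h)
    eq : edge G h₀ ≡ edge G h
    eq = edge-half G (edge G h)
    joined-root : Joined S v (root G h)
    joined-root with edge-orb G h h₀ (sym eq)
    ... | inj₁ h≡  = subst (Joined S v ∘ root G) (sym h≡) j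
    ... | inj₂ h≡ι = subst (Joined S v ∘ root G) (sym h≡ι)
                       (extend (subst (_∈ edges S) (sym eq) e∈) j)

  -- Counts the vertices of least index in their components, one per component.
  #components : ℕ
  #components = ∣ ⟦ (λ v → (v ∈? verts S) ×-dec
                    all? λ u → (u ∈? verts S) →-dec (joined? S u v →-dec (v Finₚ.≤? u))) ⟧ ∣

record DoubleCover (G̃ G : Graph) : Set where
  field
    πV : Fin (#V G̃) → Fin (#V G)
    πH : Fin (#H G̃) → Fin (#H G)
    π-root : ∀ h̃ → πV (root G̃ h̃) ≡ root G (πH h̃)
    π-ι    : ∀ h̃ → πH (ι G̃ h̃) ≡ ι G (πH h̃)

    dV : Fin (#V G̃) → ℕ
    dE : Fin (#E G̃) → ℕ
    dV-pos : ∀ ṽ → 0 ℕ.< dV ṽ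
    dE-pos : ∀ ẽ → 0 ℕ.< dE ẽ

    harmonic : ∀ ṽ h → root G h ≡ πV ṽ →
      dV ṽ ≡ Σℕ (λ h̃ → (root G̃ h̃ Finₚ.≟ ṽ) ×-dec (πH h̃ Finₚ.≟ h)) (dE ∘ edge G̃)

    degree-V : ∀ v → Σℕ (λ ṽ → πV ṽ Finₚ.≟ v) dV ≡ 2
    degree-H : ∀ h → Σℕ (λ h̃ → πH h̃ Finₚ.≟ h) (dE ∘ edge G̃) ≡ 2

  πE : Fin (#E G̃) → Fin (#E G)
  πE ẽ = edge G (πH (half G̃ ẽ))

  πE-edge : ∀ h̃ → πE (edge G̃ h̃) ≡ edge G (πH h̃)
  πE-edge h̃ with edge-orb G̃ (half G̃ (edge G̃ h̃)) h̃ (edge-half G̃ (edge G̃ h̃))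
  ... | inj₁ eq = cong (edge G ∘ πH) eq
  ... | inj₂ eq = trans (cong (edge G ∘ πH) eq) (trans (cong (edge G) (π-ι h̃)) (edge-ι G (πH h̃)))

  DilatedV : Pred (Fin (#V G)) _
  DilatedV v = ∃! _≡_ λ ṽ → πV ṽ ≡ v

  DilatedE : Pred (Fin (#E G)) _
  DilatedE e = ∃! _≡_ λ ẽ → πE ẽ ≡ e

  dilatedV? : Decidable DilatedV
  dilatedV? v = ∃!? λ ṽ → πV ṽ Finₚ.≟ v

  dilatedE? : Decidable DilatedE
  dilatedE? e = ∃!? λ ẽ → πE ẽ Finₚ.≟ e

  private
    dilated-closed : ∀ h → DilatedE (edge G h) → DilatedV (root G h)
    dilated-closed h (ẽ , _ , uniq)
      with Σℕ>0⇒∃ (λ h̃ → πH h̃ Finₚ.≟ h) (dE ∘ edge G̃) (subst (0 ℕ.<_) (sym (degree-H h)) (s≤s z≤n))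
    ... | h̃ , πh̃ = root G̃ h̃ , trans (π-root h̃) (cong (root G) πh̃) , above
      where
      over : ∀ k → πH k ≡ h → edge G̃ k ≡ ẽ
      over k πk = sym (uniq (trans (πE-edge k) (cong (edge G) πk)))

      same : ∀ k → πH k ≡ h → k ≡ h̃
      same k πk with edge-orb G̃ k h̃ (trans (over k πk) (sym (over h̃ πh̃)))
      ... | inj₁ eq = eq
      ... | inj₂ eq = ⊥-elim (ι-free G h
        (trans (cong (ι G) (sym πh̃)) (trans (sym (π-ι h̃)) (trans (cong πH (sym eq)) πk))))

      above : ∀ {ṽ} → πV ṽ ≡ root G h → root G̃ h̃ ≡ ṽ
      above {ṽ} eq
        with Σℕ>0⇒∃ (λ k → (root G̃ k Finₚ.≟ ṽ) ×-dec (πH k Finₚ.≟ h)) (dE ∘ edge G̃)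
                    (subst (0 ℕ.<_) (harmonic ṽ h (sym eq)) (dV-pos ṽ))
      ... | k , rk , πk = trans (cong (root G̃) (sym (same k πk))) rk

  dilation : Subgraph G
  verts  dilation = ⟦ dilatedV? ⟧
  edges  dilation = ⟦ dilatedE? ⟧
  closed dilation h h∈ = ∈⟦⟧⁺ dilatedV? (dilated-closed h (∈⟦⟧⁻ dilatedE? h∈))

  preimage : Subgraph G → Subgraph G̃
  verts  (preimage S) = ⟦ (λ ṽ → πV ṽ ∈? verts S) ⟧
  edges  (preimage S) = ⟦ (λ ẽ → πE ẽ ∈? edges S) ⟧
  closed (preimage S) h̃ h̃∈ = ∈⟦⟧⁺ (λ ṽ → πV ṽ ∈? verts S)
    (subst (_∈ verts S) (sym (π-root h̃))
      (closed S (πH h̃) (subst (_∈ edges S) (πE-edge h̃) (∈⟦⟧⁻ (λ ẽ → πE ẽ ∈? edges S) h̃∈))))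

  m-dil n-dil d-dil : ℕ
  m-dil = ∣ edges dilation ∣
  n-dil = ∣ verts dilation ∣
  d-dil = #components dilation

  rank : Subset (#E G) → ℕ
  rank F = #components (G ∖ F)

  IsOgod : Subset (#E G) → Set
  IsOgod F = (+ ∣ F ∣ ≡ genus G̃ ℤ.- genus G) ×
             (∀ e → e ∈ F → ¬ DilatedE e) ×
             (∀ v → Connected (preimage (component (G ∖ F) v)))

  isOgod? : Decidable IsOgod
  isOgod? F = (+ ∣ F ∣ ℤₚ.≟ genus G̃ ℤ.- genus G) ×-dec
              (all? λ e → (e ∈? F) →-dec ¬? (dilatedE? e)) ×-dec
              (all? λ v → connected? (preimage (component (G ∖ F) v)))

-- Edge lengths are positive elements of a commutative ring containing ½ and
-- equipped with a positive cone.  The real numbers with their usual order are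
-- an instance.  So is ℚ[x₁,…,xₘ] with the nonzero polynomials having
-- nonnegative coefficients as positive elements; there the indeterminates
-- are admissible edge lengths, and an identity between sums of products of
-- lengths is an identity of polynomials.
record LengthRing c ℓ p : Set (suc (c ⊔ ℓ ⊔ p)) where
  field
    commutativeRing : CommutativeRing c ℓ
  open CommutativeRing commutativeRing
    using (Carrier; _≈_; 0#; 1#; semiring) renaming (_+_ to _+ᴿ_; _*_ to _*ᴿ_) public
  open RawSemiringOps (Semiring.rawSemiring semiring)
    using (sum; product; _^_) renaming (_×_ to _·_) public
  field
    ½          : Carrier
    ½+½≈1      : ½ +ᴿ ½ ≈ 1#
    Positive   : Pred Carrier p
    pos-resp-≈ : ∀ {x y} → x ≈ y → Positive x → Positive y
    pos-+      : ∀ {x y} → Positive x → Positive y → Positive (x +ᴿ y)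
    pos-*      : ∀ {x y} → Positive x → Positive y → Positive (x *ᴿ y)
    pos-1      : Positive 1#
    pos-½      : Positive ½
    ¬pos-0     : ¬ Positive 0#

  2^_ : ℤ → Carrier
  2^ (+ k)    = (1# +ᴿ 1#) ^ k
  2^ -[1+ k ] = ½ ^ ℕ.suc k

  Σ⊆ : (Subset n → Carrier) → Carrier
  Σ⊆ {n = zero}    f = f []
  Σ⊆ {n = ℕ.suc n} f = Σ⊆ (f ∘ (outside ∷_)) +ᴿ Σ⊆ (f ∘ (inside ∷_))

  Σ⊆[_] : {P : Pred (Subset n) q} → Decidable P → (Subset n → Carrier) → Carrier
  Σ⊆[ P? ] f = Σ⊆ (λ C → if does (P? C) then f C else 0#)

  ∏∈ : Subset n → (Fin n → Carrier) → Carrier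
  ∏∈ C f = product (λ i → if does (i ∈? C) then f i else 1#)

module _ (K : LengthRing c ℓ p) where
  open LengthRing K

  record MetricGraph : Set (c ⊔ ℓ ⊔ p) where
    field
      graph   : Graph
      len     : Fin (#E graph) → Carrier
      len-pos : ∀ e → Positive (len e)

module _ {K : LengthRing c ℓ p} where
  open LengthRing K
  open MetricGraph

  record MetricDoubleCover (Γ̃ Γ : MetricGraph K) : Set (c ⊔ ℓ ⊔ p) where
    field
      cover : DoubleCover (graph Γ̃) (graph Γ)
    open DoubleCover cover public
    field
      dilates : ∀ ẽ → len Γ (πE ẽ) ≈ dE ẽ · len Γ̃ ẽ

  JacobianPolynomial : MetricGraph K → Carrier
  JacobianPolynomial Γ = Σ⊆[ index? ] (λ C → ∏∈ C (len Γ))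
    where
    G = graph Γ
    index? : Decidable (λ C → (+ ∣ C ∣ ≡ genus G) × IsTree (G ∖ C))
    index? C = (+ ∣ C ∣ ℤₚ.≟ genus G) ×-dec isTree? (G ∖ C)

  -- The rank is positive because graphs are non-empty, so ∸ is the true difference.
  PrymPolynomial : {Γ̃ Γ : MetricGraph K} → MetricDoubleCover Γ̃ Γ → Carrier
  PrymPolynomial {Γ = Γ} π =
    Σ⊆[ isOgod? ] (λ F → (4 · 1#) ^ (rank F ℕ.∸ 1) *ᴿ ∏∈ F (len Γ))
    where open MetricDoubleCover π

{-# OPTIONS --safe #-}
-- Kirchhoff's theorem in the form J(Γ) = Σ_C ∏_{e ∈ C} ℓ(e) · det(a_e : e ∉ C)², where a_e are
-- incidence vectors, exhibits J(Γ) as the top ⊗ top coefficient of ∏_e (ℓ(e) + a_e ⊗ a_e) in the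
-- tensor square of an exterior algebra.  In coordinates diagonalising the deck involution, the two
-- lifts of an undilated edge have vectors s + t and s − t with s symmetric and t antisymmetric, and
--   (ℓ + (s + t) ⊗ (s + t)) (ℓ + (s − t) ⊗ (s − t)) = (ℓ + 2 s ⊗ s) (ℓ + 2 t ⊗ t),
-- while a dilated edge contributes ½ (ℓ + 2 s ⊗ s).  Hence J(Γ̃) is, up to a power of 2, the product
-- of J(Γ) and of Σ_F ∏_{e ∈ F} ℓ(e) · det(t_e : e ∉ F)².  The determinant in the latter sum is zero
-- unless F is an ogod.  For an ogod, each component of Γ∖F without dilated vertices contributes a
-- lattice of index 2, and each remaining component contains exactly one component of the dilation
-- subgraph, so that the square of the determinant is 4^(r(F) − d).
--
-- Determinants are computed up to sign by comparing lattices: if two families of n vectors in ℤⁿ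
-- span each other, then their determinants agree up to sign.
module Submission where

open import Defs
open import Algebra.Bundles using (CommutativeRing)
open import Data.Bool.Base using (if_then_else_; true; false)
open import Data.Empty using (⊥; ⊥-elim)
open import Data.Fin.Base as Fin using (Fin; zero; suc)
import Data.Fin.Properties as Finₚ
open import Data.Fin.Subset.Properties
  using (x∈∁p⇒x∉p; x∉p⇒x∈∁p; x∈p∪q⁻; x∈p∪q⁺; x∈⁅y⁆⇒x≡y; x∈⁅x⁆; p⊂q⇒∣p∣<∣q∣; p⊆p∪q; ∈⊤; _∈?_;
         x∈p⇒∣p-x∣<∣p∣; ∣∁p∣≡n∸∣p∣; ∣p∣≤n)
import Data.Integer.Properties as ℤₚ
import Data.Integer.Tactic.RingSolver as ℤSolver
open import Data.List.Base as List
  using (List; []; _∷_; length; foldr; _++_; map; tabulate; concatMap; allFin; _ʳ++_; reverse)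
import Data.List.Properties as Listₚ
import Data.List.Relation.Binary.Permutation.Propositional as Perm
import Data.List.Relation.Binary.Permutation.Propositional.Properties as Permₚ
open import Data.List.Relation.Unary.All as All using (All; []; _∷_)
import Data.List.Relation.Unary.All.Properties as Allₚ
open import Data.List.Relation.Unary.AllPairs as AllPairs using ([]; _∷_; AllPairs)
import Data.List.Relation.Unary.AllPairs.Properties as AllPairsₚ
import Data.List.Relation.Unary.Unique.Propositional.Properties as Uniqueₚ
open import Data.Maybe.Base as Maybe using (Maybe; nothing; just; maybe)
open import Data.Nat.Base as ℕ using (ℕ; zero; suc; s≤s; z≤n)
import Data.Nat.Properties as ℕₚ
import Data.Nat.Tactic.RingSolver as ℕSolver
open import Data.Sum.Base as Sum using (_⊎_; inj₁; inj₂; [_,_]′)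
open import Function.Base using (_∘_; id; const)
open import Function.Bundles using (mk⇔)
open import Level using (Level; _⊔_)
open import Relation.Nullary using (contradiction; yes; no; does; ¬_; Dec)
open import Relation.Nullary.Decidable using (_×-dec_; ¬?; _→-dec_; dec-true; dec-false)
open import Relation.Unary using (Pred; Decidable)

-- Over a dilated vertex there is no antisymmetric coordinate. The lattice is not shrunk for this:
-- each vertex of Γ keeps one antisymmetric and one symmetric coordinate, and the idle ones are
-- filled by the unit vectors `dilatedUnits`. One symmetric unit at `origin G` removes the kernel of
-- the Laplacian. Origin of the exponent, for m dilated edges, n dilated and u undilated vertices,
-- and d dilation components: the two lifts of an undilated vertex differ by twice a unit, so the
-- split coordinates compute 4^u J(Γ̃). Dilated edges contribute 2^(-m). The n + u - 1 edges of a
-- spanning tree of Γ carry a 2 each, giving 2^(n+u-1) J(Γ). Outside an ogod exactly u undilated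
-- edges remain, also with a 2 each, giving 2^u 4^(1-d) Pr. The powers of 2^u cancel. The delicate
-- point is that a component of the complement of an ogod holds at most one dilation component. It
-- is not obtained by counting edges in graphs: the determinant of the ogod is non-zero, and a
-- second dilation component would make 2 invertible in the integers.

-- Exterior algebra of a lattice: wedge, contraction, determinants and spans.

module ExteriorAlgebra where

  open import Data.Integer.Base using (ℤ; _+_; _*_; 0ℤ; 1ℤ; -1ℤ)
  open import Data.Integer.Tactic.RingSolver using (solve-∀)
  open import Data.List.Relation.Unary.Any using (here; there)
  open import Data.List.Membership.Propositional using (_∈_)
  open import Data.Product using (∃; _×_; _,_)
  open import Data.Unit.Base using (⊤; tt)
  open import Relation.Binary.PropositionalEquality
    using (_≡_; _≢_; _≗_; refl; sym; trans; cong; cong₂; subst; module ≡-Reasoning)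
  open ≡-Reasoning

  private
    variable
      m n k d : ℕ

  Vect : ℕ → Set
  Vect n = Fin n → ℤ

  -- The exterior algebra of ℤⁿ⁺¹ splits as Λ(ℤⁿ) ⊕ e₀ ∧ Λ(ℤⁿ).
  data Λ : ℕ → Set where
    leaf : ℤ → Λ zero
    node : Λ n → Λ n → Λ (suc n)

  infixl 6 _⊹_
  infixr 7 _·_
  infixr 7 _∧_

  _⊹_ : Λ n → Λ n → Λ n
  leaf i   ⊹ leaf j     = leaf (i + j)
  node x y ⊹ node x′ y′ = node (x ⊹ x′) (y ⊹ y′)

  _·_ : ℤ → Λ n → Λ n
  k · leaf i   = leaf (k * i)
  k · node x y = node (k · x) (k · y)

  𝟘 : Λ n
  𝟘 {zero}  = leaf 0ℤ
  𝟘 {suc n} = node 𝟘 𝟘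

  𝟙 : Λ n
  𝟙 {zero}  = leaf 1ℤ
  𝟙 {suc n} = node 𝟙 𝟘

  -- Left multiplication by a vector. The tree `node x y` is x + e₀ ∧ y, and the sign comes from
  -- moving the remaining part of `a` past e₀.
  _∧_ : Vect n → Λ n → Λ n
  a ∧ leaf i   = leaf 0ℤ
  a ∧ node x y = node (a ∘ suc ∧ x) (a zero · x ⊹ -1ℤ · (a ∘ suc ∧ y))

  top : Λ n → ℤ
  top (leaf i)   = i
  top (node x y) = top y

  ⋀ : List (Vect n) → Λ n
  ⋀ = foldr _∧_ 𝟙

  -- Accepts lists of every length and vanishes off length n (`det-length`), so that a wrong number
  -- of edges is handled like a singular matrix.
  det : List (Vect n) → ℤ
  det = top ∘ ⋀

  zero·_ : (x : Λ n) → 0ℤ · x ≡ 𝟘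
  zero· leaf i   = refl
  zero· node x y = cong₂ node (zero· x) (zero· y)

  one·_ : (x : Λ n) → 1ℤ · x ≡ x
  one· leaf i   = cong leaf (ℤₚ.*-identityˡ i)
  one· node x y = cong₂ node (one· x) (one· y)

  ·-𝟘 : ∀ k → k · 𝟘 {n} ≡ 𝟘
  ·-𝟘 {n = zero}  k = cong leaf (ℤₚ.*-zeroʳ k)
  ·-𝟘 {n = suc _} k = cong₂ node (·-𝟘 k) (·-𝟘 k)

  ⊹-identityˡ : (x : Λ n) → 𝟘 ⊹ x ≡ x
  ⊹-identityˡ (leaf i)   = cong leaf (ℤₚ.+-identityˡ i)
  ⊹-identityˡ (node x y) = cong₂ node (⊹-identityˡ x) (⊹-identityˡ y)

  ⊹-identityʳ : (x : Λ n) → x ⊹ 𝟘 ≡ x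
  ⊹-identityʳ (leaf i)   = cong leaf (ℤₚ.+-identityʳ i)
  ⊹-identityʳ (node x y) = cong₂ node (⊹-identityʳ x) (⊹-identityʳ y)

  ⊹-inverseʳ : (x : Λ n) → x ⊹ -1ℤ · x ≡ 𝟘
  ⊹-inverseʳ (leaf i)   = cong leaf (lemma i)
    where
    lemma : ∀ i → i + -1ℤ * i ≡ 0ℤ
    lemma = solve-∀
  ⊹-inverseʳ (node x y) = cong₂ node (⊹-inverseʳ x) (⊹-inverseʳ y)

  ·-· : ∀ k l (x : Λ n) → k · l · x ≡ (k * l) · x
  ·-· k l (leaf i)   = cong leaf (sym (ℤₚ.*-assoc k l i))
  ·-· k l (node x y) = cong₂ node (·-· k l x) (·-· k l y)

  ·-distribʳ : ∀ k l (x : Λ n) → (k + l) · x ≡ k · x ⊹ l · x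
  ·-distribʳ k l (leaf i)   = cong leaf (ℤₚ.*-distribʳ-+ i k l)
  ·-distribʳ k l (node x y) = cong₂ node (·-distribʳ k l x) (·-distribʳ k l y)

  ·-distribˡ : ∀ k (x y : Λ n) → k · (x ⊹ y) ≡ k · x ⊹ k · y
  ·-distribˡ k (leaf i)   (leaf j)     = cong leaf (ℤₚ.*-distribˡ-+ k i j)
  ·-distribˡ k (node x y) (node x′ y′) = cong₂ node (·-distribˡ k x x′) (·-distribˡ k y y′)

  interchange : (x y z w : Λ n) → (x ⊹ y) ⊹ (z ⊹ w) ≡ (x ⊹ z) ⊹ (y ⊹ w)
  interchange (leaf i) (leaf j) (leaf k) (leaf l) = cong leaf (lemma i j k l)
    where
    lemma : ∀ i j k l → (i + j) + (k + l) ≡ (i + k) + (j + l)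
    lemma = solve-∀
  interchange (node x x′) (node y y′) (node z z′) (node w w′) =
    cong₂ node (interchange x y z w) (interchange x′ y′ z′ w′)

  ∧-cong : {a b : Vect n} → a ≗ b → (x : Λ n) → a ∧ x ≡ b ∧ x
  ∧-cong a≗b (leaf i)   = refl
  ∧-cong a≗b (node x y) = cong₂ node (∧-cong (a≗b ∘ suc) x)
    (cong₂ (λ k z → k · x ⊹ -1ℤ · z) (a≗b zero) (∧-cong (a≗b ∘ suc) y))

  ∧-· : ∀ (a : Vect n) k x → a ∧ k · x ≡ k · (a ∧ x)
  ∧-· a k (leaf i)   = cong leaf (sym (ℤₚ.*-zeroʳ k))
  ∧-· a k (node x y) = cong₂ node (∧-· (a ∘ suc) k x)
    (trans (cong (λ z → a zero · k · x ⊹ -1ℤ · z) (∧-· (a ∘ suc) k y)) (move k (a zero) x (a ∘ suc ∧ y)))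
    where
    lemma : ∀ k l i j → l * (k * i) + -1ℤ * (k * j) ≡ k * (l * i + -1ℤ * j)
    lemma = solve-∀
    move : ∀ k l (x y : Λ n) → l · k · x ⊹ -1ℤ · k · y ≡ k · (l · x ⊹ -1ℤ · y)
    move k l (leaf i) (leaf j) = cong leaf (lemma k l i j)
    move k l (node x y) (node x′ y′) = cong₂ node (move k l x x′) (move k l y y′)

  ∧-⊹ : ∀ (a : Vect n) x y → a ∧ (x ⊹ y) ≡ a ∧ x ⊹ a ∧ y
  ∧-⊹ a (leaf i)   (leaf j)     = refl
  ∧-⊹ a (node x y) (node x′ y′) = cong₂ node (∧-⊹ (a ∘ suc) x x′)
    (trans (cong (λ z → a zero · (x ⊹ x′) ⊹ -1ℤ · z) (∧-⊹ (a ∘ suc) y y′))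
    (trans (cong₂ _⊹_ (·-distribˡ (a zero) x x′) (·-distribˡ -1ℤ (a ∘ suc ∧ y) (a ∘ suc ∧ y′)))
           (interchange (a zero · x) (a zero · x′) (-1ℤ · (a ∘ suc ∧ y)) (-1ℤ · (a ∘ suc ∧ y′)))))

  ∧-𝟘 : (a : Vect n) → a ∧ 𝟘 ≡ 𝟘
  ∧-𝟘 {n = zero}  a = refl
  ∧-𝟘 {n = suc n} a = cong₂ node (∧-𝟘 (a ∘ suc))
    (trans (cong₂ _⊹_ (·-𝟘 (a zero)) (trans (cong (-1ℤ ·_) (∧-𝟘 (a ∘ suc))) (·-𝟘 -1ℤ)))
           (⊹-identityˡ 𝟘))

  zero∧ : {a : Vect n} → (∀ i → a i ≡ 0ℤ) → (x : Λ n) → a ∧ x ≡ 𝟘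
  zero∧ a≗0 (leaf i)   = refl
  zero∧ a≗0 (node x y) = cong₂ node (zero∧ (a≗0 ∘ suc) x)
    (trans (cong₂ _⊹_ (trans (cong (_· x) (a≗0 zero)) (zero· x))
                      (trans (cong (-1ℤ ·_) (zero∧ (a≗0 ∘ suc) y)) (·-𝟘 -1ℤ)))
           (⊹-identityˡ 𝟘))

  +∧ : ∀ (a b : Vect n) x → (λ i → a i + b i) ∧ x ≡ a ∧ x ⊹ b ∧ x
  +∧ a b (leaf i)   = refl
  +∧ a b (node x y) = cong₂ node (+∧ (a ∘ suc) (b ∘ suc) x)
    (trans (cong₂ _⊹_ (·-distribʳ (a zero) (b zero) x)
              (trans (cong (-1ℤ ·_) (+∧ (a ∘ suc) (b ∘ suc) y)) (·-distribˡ -1ℤ (a ∘ suc ∧ y) (b ∘ suc ∧ y))))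
           (interchange (a zero · x) (b zero · x) (-1ℤ · (a ∘ suc ∧ y)) (-1ℤ · (b ∘ suc ∧ y))))

  *∧ : ∀ k (a : Vect n) x → (λ i → k * a i) ∧ x ≡ k · (a ∧ x)
  *∧ k a (leaf i)   = cong leaf (sym (ℤₚ.*-zeroʳ k))
  *∧ k a (node x y) = cong₂ node (*∧ k (a ∘ suc) x)
    (trans (cong₂ _⊹_ (sym (·-· k (a zero) x))
              (trans (cong (-1ℤ ·_) (*∧ k (a ∘ suc) y))
              (trans (·-· -1ℤ k (a ∘ suc ∧ y))
              (trans (cong (_· (a ∘ suc ∧ y)) (ℤₚ.*-comm -1ℤ k)) (sym (·-· k -1ℤ (a ∘ suc ∧ y)))))))
           (sym (·-distribˡ k (a zero · x) (-1ℤ · (a ∘ suc ∧ y)))))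

  ∧-anticomm : ∀ (a b : Vect n) x → a ∧ b ∧ x ≡ -1ℤ · (b ∧ a ∧ x)
  ∧-anticomm a b (leaf i)   = refl
  ∧-anticomm a b (node x y) = cong₂ node (∧-anticomm a′ b′ x) (begin
      a₀ · (b′ ∧ x) ⊹ -1ℤ · (a′ ∧ (b₀ · x ⊹ -1ℤ · (b′ ∧ y)))
        ≡⟨ cong (λ z → a₀ · (b′ ∧ x) ⊹ -1ℤ · z) (expand a′ b₀ x (b′ ∧ y)) ⟩
      a₀ · (b′ ∧ x) ⊹ -1ℤ · (b₀ · (a′ ∧ x) ⊹ -1ℤ · (a′ ∧ b′ ∧ y))
        ≡⟨ cong (λ z → a₀ · (b′ ∧ x) ⊹ -1ℤ · (b₀ · (a′ ∧ x) ⊹ -1ℤ · z)) (∧-anticomm a′ b′ y) ⟩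
      a₀ · (b′ ∧ x) ⊹ -1ℤ · (b₀ · (a′ ∧ x) ⊹ -1ℤ · -1ℤ · (b′ ∧ a′ ∧ y))
        ≡⟨ move a₀ b₀ (b′ ∧ x) (a′ ∧ x) (b′ ∧ a′ ∧ y) ⟩
      -1ℤ · (b₀ · (a′ ∧ x) ⊹ -1ℤ · (a₀ · (b′ ∧ x) ⊹ -1ℤ · (b′ ∧ a′ ∧ y)))
        ≡⟨ cong (λ z → -1ℤ · (b₀ · (a′ ∧ x) ⊹ -1ℤ · z)) (expand b′ a₀ x (a′ ∧ y)) ⟨
      -1ℤ · (b₀ · (a′ ∧ x) ⊹ -1ℤ · (b′ ∧ (a₀ · x ⊹ -1ℤ · (a′ ∧ y)))) ∎)
    where
    a₀ = a zero
    b₀ = b zero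
    a′ = a ∘ suc
    b′ = b ∘ suc
    expand : ∀ (c : Vect n) k x y → c ∧ (k · x ⊹ -1ℤ · y) ≡ k · (c ∧ x) ⊹ -1ℤ · (c ∧ y)
    expand c k x y = trans (∧-⊹ c (k · x) (-1ℤ · y)) (cong₂ _⊹_ (∧-· c k x) (∧-· c -1ℤ y))
    lemma : ∀ k l i j p → k * i + -1ℤ * (l * j + -1ℤ * (-1ℤ * p)) ≡
                          -1ℤ * (l * j + -1ℤ * (k * i + -1ℤ * p))
    lemma = solve-∀
    move : ∀ k l (x y z : Λ n) → k · x ⊹ -1ℤ · (l · y ⊹ -1ℤ · -1ℤ · z) ≡
                                 -1ℤ · (l · y ⊹ -1ℤ · (k · x ⊹ -1ℤ · z))
    move k l (leaf i) (leaf j) (leaf p) = cong leaf (lemma k l i j p)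
    move k l (node x x′) (node y y′) (node z z′) = cong₂ node (move k l x y z) (move k l x′ y′ z′)

  ∧-nilpotent : ∀ (a : Vect n) x → a ∧ a ∧ x ≡ 𝟘
  ∧-nilpotent a (leaf i)   = refl
  ∧-nilpotent a (node x y) = cong₂ node (∧-nilpotent (a ∘ suc) x) (begin
    a₀ · (a′ ∧ x) ⊹ -1ℤ · (a′ ∧ (a₀ · x ⊹ -1ℤ · (a′ ∧ y)))
      ≡⟨ cong (λ z → a₀ · (a′ ∧ x) ⊹ -1ℤ · z)
           (trans (∧-⊹ a′ (a₀ · x) (-1ℤ · (a′ ∧ y)))
                  (cong₂ _⊹_ (∧-· a′ a₀ x) (trans (∧-· a′ -1ℤ (a′ ∧ y))
                    (trans (cong (-1ℤ ·_) (∧-nilpotent a′ y)) (·-𝟘 -1ℤ))))) ⟩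
    a₀ · (a′ ∧ x) ⊹ -1ℤ · (a₀ · (a′ ∧ x) ⊹ 𝟘)
      ≡⟨ cong (λ z → a₀ · (a′ ∧ x) ⊹ -1ℤ · z) (⊹-identityʳ (a₀ · (a′ ∧ x))) ⟩
    a₀ · (a′ ∧ x) ⊹ -1ℤ · a₀ · (a′ ∧ x)
      ≡⟨ ⊹-inverseʳ (a₀ · (a′ ∧ x)) ⟩
    𝟘 ∎)
    where
    a₀ = a zero
    a′ = a ∘ suc

  top-⊹ : (x y : Λ n) → top (x ⊹ y) ≡ top x + top y
  top-⊹ (leaf i)   (leaf j)     = refl
  top-⊹ (node x y) (node x′ y′) = top-⊹ y y′

  top-· : ∀ k (x : Λ n) → top (k · x) ≡ k * top x
  top-· k (leaf i)   = refl
  top-· k (node x y) = top-· k y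

  top-𝟘 : ∀ n → top (𝟘 {n}) ≡ 0ℤ
  top-𝟘 zero    = refl
  top-𝟘 (suc n) = top-𝟘 n

  ⟨_,_⟩ : Vect n → Vect n → ℤ
  ⟨_,_⟩ {n = zero}  f a = 0ℤ
  ⟨_,_⟩ {n = suc n} f a = f zero * a zero + ⟨ f ∘ suc , a ∘ suc ⟩

  -- The interior product with the functional `f`, written out on x + e₀ ∧ y.
  contract : Vect n → Λ n → Λ n
  contract f (leaf i)   = leaf 0ℤ
  contract f (node x y) =
    node (contract (f ∘ suc) x ⊹ f zero · y) (-1ℤ · contract (f ∘ suc) y)

  contract-𝟘 : (f : Vect n) → contract f 𝟘 ≡ 𝟘
  contract-𝟘 {n = zero}  f = refl
  contract-𝟘 {n = suc n} f = cong₂ node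
    (trans (cong₂ _⊹_ (contract-𝟘 (f ∘ suc)) (·-𝟘 (f zero))) (⊹-identityˡ 𝟘))
    (trans (cong (-1ℤ ·_) (contract-𝟘 (f ∘ suc))) (·-𝟘 -1ℤ))

  contract-𝟙 : (f : Vect n) → contract f 𝟙 ≡ 𝟘
  contract-𝟙 {n = zero}  f = refl
  contract-𝟙 {n = suc n} f = cong₂ node
    (trans (cong₂ _⊹_ (contract-𝟙 (f ∘ suc)) (·-𝟘 (f zero))) (⊹-identityˡ 𝟘))
    (trans (cong (-1ℤ ·_) (contract-𝟘 (f ∘ suc))) (·-𝟘 -1ℤ))

  contract-⊹ : ∀ (f : Vect n) x y → contract f (x ⊹ y) ≡ contract f x ⊹ contract f y
  contract-⊹ f (leaf i) (leaf j) = refl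
  contract-⊹ f (node x y) (node x′ y′) = cong₂ node
    (trans (cong₂ _⊹_ (contract-⊹ (f ∘ suc) x x′) (·-distribˡ (f zero) y y′))
           (interchange (contract (f ∘ suc) x) (contract (f ∘ suc) x′) (f zero · y) (f zero · y′)))
    (trans (cong (-1ℤ ·_) (contract-⊹ (f ∘ suc) y y′)) (·-distribˡ -1ℤ _ _))

  contract-· : ∀ (f : Vect n) k x → contract f (k · x) ≡ k · contract f x
  contract-· f k (leaf i) = cong leaf (sym (ℤₚ.*-zeroʳ k))
  contract-· f k (node x y) = cong₂ node
    (trans (cong₂ _⊹_ (contract-· (f ∘ suc) k x) (commute (f zero) y)) (sym (·-distribˡ k _ _)))
    (trans (cong (-1ℤ ·_) (contract-· (f ∘ suc) k y)) (commute -1ℤ _))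
    where
    commute : ∀ l (x : Λ n) → l · k · x ≡ k · l · x
    commute l x = trans (·-· l k x) (trans (cong (_· x) (ℤₚ.*-comm l k)) (sym (·-· k l x)))

  top-contract : ∀ (f : Vect n) x → top (contract f x) ≡ 0ℤ
  top-contract f (leaf i)   = refl
  top-contract f (node x y) =
    trans (top-· -1ℤ (contract (f ∘ suc) y)) (cong (-1ℤ *_) (top-contract (f ∘ suc) y))

  -- The interior product is an antiderivation of degree -1.
  contract-∧ : ∀ (f a : Vect n) x → contract f (a ∧ x) ⊹ a ∧ contract f x ≡ ⟨ f , a ⟩ · x
  contract-∧ f a (leaf i)   = refl
  contract-∧ f a (node x y) = cong₂ node
    (begin
      (contract f′ (a′ ∧ x) ⊹ f₀ · (a₀ · x ⊹ -1ℤ · (a′ ∧ y))) ⊹ a′ ∧ (contract f′ x ⊹ f₀ · y)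
        ≡⟨ cong ((contract f′ (a′ ∧ x) ⊹ f₀ · (a₀ · x ⊹ -1ℤ · (a′ ∧ y))) ⊹_)
             (trans (∧-⊹ a′ (contract f′ x) (f₀ · y)) (cong (a′ ∧ contract f′ x ⊹_) (∧-· a′ f₀ y))) ⟩
      (contract f′ (a′ ∧ x) ⊹ f₀ · (a₀ · x ⊹ -1ℤ · (a′ ∧ y))) ⊹ (a′ ∧ contract f′ x ⊹ f₀ · (a′ ∧ y))
        ≡⟨ move₁ f₀ a₀ (contract f′ (a′ ∧ x)) x (a′ ∧ y) (a′ ∧ contract f′ x) ⟩
      (contract f′ (a′ ∧ x) ⊹ a′ ∧ contract f′ x) ⊹ (f₀ * a₀) · x
        ≡⟨ cong (_⊹ (f₀ * a₀) · x) (contract-∧ f′ a′ x) ⟩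
      ⟨ f′ , a′ ⟩ · x ⊹ (f₀ * a₀) · x
        ≡⟨ ·-distribʳ ⟨ f′ , a′ ⟩ (f₀ * a₀) x ⟨
      (⟨ f′ , a′ ⟩ + f₀ * a₀) · x
        ≡⟨ cong (_· x) (ℤₚ.+-comm ⟨ f′ , a′ ⟩ (f₀ * a₀)) ⟩
      (f₀ * a₀ + ⟨ f′ , a′ ⟩) · x ∎)
    (begin
      -1ℤ · contract f′ (a₀ · x ⊹ -1ℤ · (a′ ∧ y)) ⊹
        (a₀ · (contract f′ x ⊹ f₀ · y) ⊹ -1ℤ · (a′ ∧ -1ℤ · contract f′ y))
        ≡⟨ cong₂ (λ z w → -1ℤ · z ⊹ (a₀ · (contract f′ x ⊹ f₀ · y) ⊹ -1ℤ · w))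
             (trans (contract-⊹ f′ (a₀ · x) (-1ℤ · (a′ ∧ y)))
                    (cong₂ _⊹_ (contract-· f′ a₀ x) (contract-· f′ -1ℤ (a′ ∧ y))))
             (∧-· a′ -1ℤ (contract f′ y)) ⟩
      -1ℤ · (a₀ · contract f′ x ⊹ -1ℤ · contract f′ (a′ ∧ y)) ⊹
        (a₀ · (contract f′ x ⊹ f₀ · y) ⊹ -1ℤ · -1ℤ · (a′ ∧ contract f′ y))
        ≡⟨ move₂ f₀ a₀ (contract f′ x) (contract f′ (a′ ∧ y)) y (a′ ∧ contract f′ y) ⟩
      (contract f′ (a′ ∧ y) ⊹ a′ ∧ contract f′ y) ⊹ (f₀ * a₀) · y
        ≡⟨ cong (_⊹ (f₀ * a₀) · y) (contract-∧ f′ a′ y) ⟩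
      ⟨ f′ , a′ ⟩ · y ⊹ (f₀ * a₀) · y
        ≡⟨ ·-distribʳ ⟨ f′ , a′ ⟩ (f₀ * a₀) y ⟨
      (⟨ f′ , a′ ⟩ + f₀ * a₀) · y
        ≡⟨ cong (_· y) (ℤₚ.+-comm ⟨ f′ , a′ ⟩ (f₀ * a₀)) ⟩
      (f₀ * a₀ + ⟨ f′ , a′ ⟩) · y ∎)
    where
    f₀ = f zero
    a₀ = a zero
    f′ = f ∘ suc
    a′ = a ∘ suc
    lemma₁ : ∀ f a p x q r → (p + f * (a * x + -1ℤ * q)) + (r + f * q) ≡ (p + r) + (f * a) * x
    lemma₁ = solve-∀
    move₁ : ∀ f a (p x q r : Λ n) →
            (p ⊹ f · (a · x ⊹ -1ℤ · q)) ⊹ (r ⊹ f · q) ≡ (p ⊹ r) ⊹ (f * a) · x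
    move₁ f a (leaf p) (leaf x) (leaf q) (leaf r) = cong leaf (lemma₁ f a p x q r)
    move₁ f a (node p p′) (node x x′) (node q q′) (node r r′) =
      cong₂ node (move₁ f a p x q r) (move₁ f a p′ x′ q′ r′)
    lemma₂ : ∀ f a p q y r → -1ℤ * (a * p + -1ℤ * q) + (a * (p + f * y) + -1ℤ * (-1ℤ * r)) ≡
                             (q + r) + (f * a) * y
    lemma₂ = solve-∀
    move₂ : ∀ f a (p q y r : Λ n) →
            -1ℤ · (a · p ⊹ -1ℤ · q) ⊹ (a · (p ⊹ f · y) ⊹ -1ℤ · -1ℤ · r) ≡ (q ⊹ r) ⊹ (f * a) · y
    move₂ f a (leaf p) (leaf q) (leaf y) (leaf r) = cong leaf (lemma₂ f a p q y r)
    move₂ f a (node p p′) (node q q′) (node y y′) (node r r′) =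
      cong₂ node (move₂ f a p q y r) (move₂ f a p′ q′ y′ r′)

  -- Contraction with `f` kills `⋀ as` factor by factor. By the antiderivation rule
  -- `⟨ f , e ⟩ · ⋀ as` is then a contraction, and contractions have no top part since they lower
  -- the degree. The test vector `e` is chosen with `⟨ f , e ⟩` non-zero, which yields singularity
  -- without division.
  det-annihilated : ∀ (f e : Vect n) {as} → All (λ a → ⟨ f , a ⟩ ≡ 0ℤ) as → ⟨ f , e ⟩ * det as ≡ 0ℤ
  det-annihilated {n = n} f e {as} fas = begin
    ⟨ f , e ⟩ * top (⋀ as)                                ≡⟨ top-· ⟨ f , e ⟩ (⋀ as) ⟨
    top (⟨ f , e ⟩ · ⋀ as)                                ≡⟨ cong top (contract-∧ f e (⋀ as)) ⟨
    top (contract f (e ∧ ⋀ as) ⊹ e ∧ contract f (⋀ as))   ≡⟨ top-⊹ (contract f (e ∧ ⋀ as)) (e ∧ contract f (⋀ as)) ⟩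
    top (contract f (e ∧ ⋀ as)) + top (e ∧ contract f (⋀ as))
      ≡⟨ cong₂ _+_ (top-contract f (e ∧ ⋀ as)) (cong (λ z → top (e ∧ z)) (kill fas)) ⟩
    0ℤ + top (e ∧ 𝟘)                                      ≡⟨ cong (0ℤ +_) (trans (cong top (∧-𝟘 e)) (top-𝟘 n)) ⟩
    0ℤ                                                    ∎
    where
    kill : ∀ {as} → All (λ a → ⟨ f , a ⟩ ≡ 0ℤ) as → contract f (⋀ as) ≡ 𝟘
    kill [] = contract-𝟙 f
    kill {a ∷ as} (fa ∷ fas) = begin
      contract f (a ∧ ⋀ as)                             ≡⟨ ⊹-identityʳ _ ⟨
      contract f (a ∧ ⋀ as) ⊹ 𝟘                         ≡⟨ cong (contract f (a ∧ ⋀ as) ⊹_) (trans (cong (a ∧_) (kill fas)) (∧-𝟘 a)) ⟨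
      contract f (a ∧ ⋀ as) ⊹ a ∧ contract f (⋀ as)     ≡⟨ contract-∧ f a (⋀ as) ⟩
      ⟨ f , a ⟩ · ⋀ as                                  ≡⟨ cong (_· ⋀ as) fa ⟩
      0ℤ · ⋀ as                                         ≡⟨ zero· ⋀ as ⟩
      𝟘                                                 ∎

  Homogeneous : ℕ → Λ n → Set
  Homogeneous zero    (leaf i)   = ⊤
  Homogeneous (suc d) (leaf i)   = i ≡ 0ℤ
  Homogeneous zero    (node x y) = Homogeneous zero x × y ≡ 𝟘
  Homogeneous (suc d) (node x y) = Homogeneous (suc d) x × Homogeneous d y

  homogeneous-𝟘 : ∀ d → Homogeneous d (𝟘 {n})
  homogeneous-𝟘 {n = zero}  zero    = tt
  homogeneous-𝟘 {n = zero}  (suc d) = refl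
  homogeneous-𝟘 {n = suc n} zero    = homogeneous-𝟘 zero , refl
  homogeneous-𝟘 {n = suc n} (suc d) = homogeneous-𝟘 (suc d) , homogeneous-𝟘 d

  homogeneous-𝟙 : Homogeneous zero (𝟙 {n})
  homogeneous-𝟙 {n = zero}  = tt
  homogeneous-𝟙 {n = suc n} = homogeneous-𝟙 , refl

  homogeneous-⊹ : ∀ d {x y : Λ n} → Homogeneous d x → Homogeneous d y → Homogeneous d (x ⊹ y)
  homogeneous-⊹ zero    {leaf i}   {leaf j}   _         _         = tt
  homogeneous-⊹ (suc d) {leaf _}   {leaf _}   refl      refl      = refl
  homogeneous-⊹ zero    {node _ _} {node _ _} (p , refl) (q , refl) = homogeneous-⊹ zero p q , ⊹-identityˡ 𝟘
  homogeneous-⊹ (suc d) {node _ _} {node _ _} (p , p′)  (q , q′)  =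
    homogeneous-⊹ (suc d) p q , homogeneous-⊹ d p′ q′

  homogeneous-· : ∀ d k {x : Λ n} → Homogeneous d x → Homogeneous d (k · x)
  homogeneous-· zero    k {leaf i}   _          = tt
  homogeneous-· (suc d) k {leaf _}   refl       = ℤₚ.*-zeroʳ k
  homogeneous-· zero    k {node _ _} (p , refl) = homogeneous-· zero k p , ·-𝟘 k
  homogeneous-· (suc d) k {node _ _} (p , p′)   = homogeneous-· (suc d) k p , homogeneous-· d k p′

  homogeneous-∧ : ∀ d (a : Vect n) {x} → Homogeneous d x → Homogeneous (suc d) (a ∧ x)
  homogeneous-∧ d       a {leaf i}   _          = refl
  homogeneous-∧ zero    a {node x _} (p , refl) = homogeneous-∧ zero (a ∘ suc) p ,
    homogeneous-⊹ zero (homogeneous-· zero (a zero) p)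
      (subst (Homogeneous zero) (sym (trans (cong (-1ℤ ·_) (∧-𝟘 (a ∘ suc))) (·-𝟘 -1ℤ))) (homogeneous-𝟘 zero))
  homogeneous-∧ (suc d) a {node x y} (p , p′)   = homogeneous-∧ (suc d) (a ∘ suc) p ,
    homogeneous-⊹ (suc d) (homogeneous-· (suc d) (a zero) p)
      (homogeneous-· (suc d) -1ℤ (homogeneous-∧ d (a ∘ suc) p′))

  homogeneous-⋀ : (as : List (Vect n)) → Homogeneous (length as) (⋀ as)
  homogeneous-⋀ []       = homogeneous-𝟙
  homogeneous-⋀ (a ∷ as) = homogeneous-∧ (length as) a (homogeneous-⋀ as)

  homogeneous->⇒𝟘 : ∀ d {x : Λ n} → n ℕ.< d → Homogeneous d x → x ≡ 𝟘
  homogeneous->⇒𝟘 (suc d) {leaf _}   _         refl     = refl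
  homogeneous->⇒𝟘 (suc d) {node _ _} (s≤s n<d) (p , p′) =
    cong₂ node (homogeneous->⇒𝟘 (suc d) (ℕₚ.m<n⇒m<1+n n<d) p) (homogeneous->⇒𝟘 d n<d p′)

  top-homogeneous : ∀ d {x : Λ n} → Homogeneous d x → d ≢ n → top x ≡ 0ℤ
  top-homogeneous zero    {leaf _}   p          d≢n = contradiction refl d≢n
  top-homogeneous (suc d) {leaf _}   p          d≢n = p
  top-homogeneous {n = suc n} zero {node _ _} (_ , refl) d≢n = top-𝟘 n
  top-homogeneous (suc d) {node _ _} (_ , p)    d≢n = top-homogeneous d p (d≢n ∘ cong suc)

  det-length : (as : List (Vect n)) → length as ≢ n → det as ≡ 0ℤ
  det-length as = top-homogeneous (length as) (homogeneous-⋀ as)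

  vol : Λ n
  vol {zero}  = leaf 1ℤ
  vol {suc n} = node 𝟘 vol

  homogeneous-top : {x : Λ n} → Homogeneous n x → x ≡ top x · vol
  homogeneous-top {x = leaf i}   p = cong leaf (sym (ℤₚ.*-identityʳ i))
  homogeneous-top {n = suc n} {x = node x y} (p , p′) =
    cong₂ node (trans (homogeneous->⇒𝟘 (suc n) ℕₚ.≤-refl p) (sym (·-𝟘 (top y)))) (homogeneous-top p′)

  lincomb : (as : List (Vect n)) → Vect (length as) → Vect n
  lincomb []       β i = 0ℤ
  lincomb (a ∷ as) β i = β zero * a i + lincomb as (β ∘ suc) i

  record Span (as : List (Vect n)) (b : Vect n) : Set where
    constructor _,_
    field
      coefficients : Vect (length as)
      combination  : b ≗ lincomb as coefficients

  -- The homomorphism of exterior algebras induced by the linear map that sends the standard basis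
  -- to the vectors of `as`.
  push : (as : List (Vect n)) → Λ (length as) → Λ n
  push []       (leaf i)   = i · 𝟙
  push (a ∷ as) (node x y) = push as x ⊹ a ∧ push as y

  push-𝟘 : (as : List (Vect n)) → push as 𝟘 ≡ 𝟘
  push-𝟘 []       = zero· 𝟙
  push-𝟘 (a ∷ as) = trans (cong₂ _⊹_ (push-𝟘 as) (trans (cong (a ∧_) (push-𝟘 as)) (∧-𝟘 a))) (⊹-identityˡ 𝟘)

  push-𝟙 : (as : List (Vect n)) → push as 𝟙 ≡ 𝟙
  push-𝟙 []       = one· 𝟙
  push-𝟙 (a ∷ as) =
    trans (cong₂ _⊹_ (push-𝟙 as) (trans (cong (a ∧_) (push-𝟘 as)) (∧-𝟘 a))) (⊹-identityʳ 𝟙)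

  push-⊹ : ∀ (as : List (Vect n)) x y → push as (x ⊹ y) ≡ push as x ⊹ push as y
  push-⊹ []       (leaf i)   (leaf j)     = ·-distribʳ i j 𝟙
  push-⊹ (a ∷ as) (node x y) (node x′ y′) =
    trans (cong₂ _⊹_ (push-⊹ as x x′) (trans (cong (a ∧_) (push-⊹ as y y′)) (∧-⊹ a _ _)))
          (interchange (push as x) (push as x′) (a ∧ push as y) (a ∧ push as y′))

  push-· : ∀ (as : List (Vect n)) k x → push as (k · x) ≡ k · push as x
  push-· []       k (leaf i)   = sym (·-· k i 𝟙)
  push-· (a ∷ as) k (node x y) =
    trans (cong₂ _⊹_ (push-· as k x) (trans (cong (a ∧_) (push-· as k y)) (∧-· a k _)))
          (sym (·-distribˡ k _ _))

  push-vol : (as : List (Vect n)) → push as vol ≡ ⋀ as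
  push-vol []       = one· 𝟙
  push-vol (a ∷ as) =
    trans (cong₂ _⊹_ (push-𝟘 as) (cong (a ∧_) (push-vol as))) (⊹-identityˡ _)

  push-∧ : ∀ (as : List (Vect n)) β x → push as (β ∧ x) ≡ lincomb as β ∧ push as x
  push-∧ []       β (leaf i)   = trans (zero· 𝟙) (sym (zero∧ (λ _ → refl) (i · 𝟙)))
  push-∧ (a ∷ as) β (node x y) = begin
    push as (β′ ∧ x) ⊹ a ∧ push as (β₀ · x ⊹ -1ℤ · (β′ ∧ y))
      ≡⟨ cong₂ _⊹_ (push-∧ as β′ x)
           (trans (cong (a ∧_) (trans (push-⊹ as (β₀ · x) (-1ℤ · (β′ ∧ y)))
                                      (cong₂ _⊹_ (push-· as β₀ x)
                                        (trans (push-· as -1ℤ (β′ ∧ y)) (cong (-1ℤ ·_) (push-∧ as β′ y))))))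
                  (trans (∧-⊹ a (β₀ · X) (-1ℤ · (L ∧ Y))) (cong₂ _⊹_ (∧-· a β₀ X) (∧-· a -1ℤ (L ∧ Y))))) ⟩
    L ∧ X ⊹ (β₀ · (a ∧ X) ⊹ -1ℤ · (a ∧ L ∧ Y))
      ≡⟨ cong (λ z → L ∧ X ⊹ (β₀ · (a ∧ X) ⊹ -1ℤ · z)) (∧-anticomm a L Y) ⟩
    L ∧ X ⊹ (β₀ · (a ∧ X) ⊹ -1ℤ · -1ℤ · (L ∧ a ∧ Y))
      -- The added summand `β₀ · 𝟘` becomes `β₀ · (a ∧ a ∧ Y)` by nilpotency, the one term of the
      -- right-hand side without counterpart on the left.
      ≡⟨ move β₀ (L ∧ X) (a ∧ X) (L ∧ a ∧ Y) ⟩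
    (β₀ · (a ∧ X) ⊹ L ∧ X) ⊹ (β₀ · 𝟘 ⊹ L ∧ a ∧ Y)
      ≡⟨ cong (λ z → (β₀ · (a ∧ X) ⊹ L ∧ X) ⊹ (β₀ · z ⊹ L ∧ a ∧ Y)) (∧-nilpotent a Y) ⟨
    (β₀ · (a ∧ X) ⊹ L ∧ X) ⊹ (β₀ · (a ∧ a ∧ Y) ⊹ L ∧ a ∧ Y)
      ≡⟨ cong₂ _⊹_ (expand X) (expand (a ∧ Y)) ⟨
    lincomb (a ∷ as) β ∧ X ⊹ lincomb (a ∷ as) β ∧ a ∧ Y
      ≡⟨ ∧-⊹ (lincomb (a ∷ as) β) X (a ∧ Y) ⟨
    lincomb (a ∷ as) β ∧ (X ⊹ a ∧ Y) ∎
    where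
    β₀ = β zero
    β′ = β ∘ suc
    L = lincomb as β′
    X = push as x
    Y = push as y
    expand : ∀ z → lincomb (a ∷ as) β ∧ z ≡ β₀ · (a ∧ z) ⊹ L ∧ z
    expand z = trans (+∧ (λ i → β₀ * a i) L z) (cong (_⊹ L ∧ z) (*∧ β₀ a z))
    lemma : ∀ k p q r → p + (k * q + -1ℤ * (-1ℤ * r)) ≡ (k * q + p) + (k * 0ℤ + r)
    lemma = solve-∀
    move : ∀ k (p q r : Λ n) → p ⊹ (k · q ⊹ -1ℤ · -1ℤ · r) ≡ (k · q ⊹ p) ⊹ (k · 𝟘 ⊹ r)
    move k (leaf p) (leaf q) (leaf r) = cong leaf (lemma k p q r)
    move k (node p p′) (node q q′) (node r r′) = cong₂ node (move k p q r) (move k p′ q′ r′)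

  private
    coordinates : ∀ {as bs : List (Vect n)} → All (Span as) bs →
                  ∃ λ βs → length βs ≡ length bs × ⋀ bs ≡ push as (⋀ βs)
    coordinates {as = as} [] = [] , refl , sym (push-𝟙 as)
    coordinates {as = as} {b ∷ bs} ((β , b≗) ∷ ps) with coordinates ps
    ... | βs , len , eq = β ∷ βs , cong suc len ,
      trans (∧-cong b≗ _) (trans (cong (lincomb as β ∧_) eq) (sym (push-∧ as β (⋀ βs))))

  -- Functoriality of the top exterior power: `⋀ bs` is the image of the wedge of the coordinate
  -- vectors, and `c` is the determinant of the coordinate matrix.
  det-span : {as bs : List (Vect n)} → All (Span as) bs → length bs ≡ length as →
             ∃ λ c → det bs ≡ c * det as
  det-span {as = as} {bs} ps eq with coordinates ps
  ... | βs , len , ⋀bs = det βs , (begin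
    top (⋀ bs)                       ≡⟨ cong top ⋀bs ⟩
    top (push as (⋀ βs))             ≡⟨ cong (top ∘ push as) (homogeneous-top
                                          (subst (λ d → Homogeneous d (⋀ βs)) (trans len eq) (homogeneous-⋀ βs))) ⟩
    top (push as (det βs · vol))     ≡⟨ cong top (push-· as (det βs) vol) ⟩
    top (det βs · push as vol)       ≡⟨ cong (λ z → top (det βs · z)) (push-vol as) ⟩
    top (det βs · ⋀ as)              ≡⟨ top-· (det βs) (⋀ as) ⟩
    det βs * det as                  ∎)

  -- There are more coordinate vectors than coordinates, so their wedge vanishes by degree, and so
  -- does its image.
  det-span-short : {as bs : List (Vect n)} → All (Span as) bs → length as ℕ.< length bs → det bs ≡ 0ℤ
  det-span-short {n = n} {as = as} ps lt with coordinates ps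
  ... | βs , len , ⋀bs = trans (cong top (trans ⋀bs (trans (cong (push as)
          (homogeneous->⇒𝟘 (length βs) (subst (length as ℕ.<_) (sym len) lt) (homogeneous-⋀ βs)))
          (push-𝟘 as)))) (top-𝟘 n)

  span-cong : ∀ {as : List (Vect n)} {a b} → a ≗ b → Span as a → Span as b
  span-cong a≗b (β , a≗) = β , λ i → trans (sym (a≗b i)) (a≗ i)

  span-0 : {as : List (Vect n)} → Span as (λ _ → 0ℤ)
  span-0 {as = as} = (λ _ → 0ℤ) , go as
    where
    go : ∀ as → (λ _ → 0ℤ) ≗ lincomb as (λ _ → 0ℤ)
    go []       i = refl
    go (a ∷ as) i = trans (go as i) (sym (ℤₚ.+-identityˡ _))

  span-+ : ∀ {as : List (Vect n)} {a b} → Span as a → Span as b → Span as (λ i → a i + b i)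
  span-+ {as = as} (β , a≗) (γ , b≗) = (λ j → β j + γ j) ,
    λ i → trans (cong₂ _+_ (a≗ i) (b≗ i)) (go as β γ i)
    where
    lemma : ∀ β γ a x y → (β * a + x) + (γ * a + y) ≡ (β + γ) * a + (x + y)
    lemma = solve-∀
    go : ∀ as β γ i → lincomb as β i + lincomb as γ i ≡ lincomb as (λ j → β j + γ j) i
    go []       β γ i = refl
    go (a ∷ as) β γ i = trans (lemma (β zero) (γ zero) (a i) _ _)
      (cong ((β zero + γ zero) * a i +_) (go as (β ∘ suc) (γ ∘ suc) i))

  span-* : ∀ {as : List (Vect n)} {a} k → Span as a → Span as (λ i → k * a i)
  span-* {as = as} k (β , a≗) = (λ j → k * β j) , λ i → trans (cong (k *_) (a≗ i)) (go as β i)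
    where
    lemma : ∀ k β a x → k * (β * a + x) ≡ (k * β) * a + k * x
    lemma = solve-∀
    go : ∀ as β i → k * lincomb as β i ≡ lincomb as (λ j → k * β j) i
    go []       β i = ℤₚ.*-zeroʳ k
    go (a ∷ as) β i = trans (lemma k (β zero) (a i) _) (cong ((k * β zero) * a i +_) (go as (β ∘ suc) i))

  span-∈ : ∀ {as : List (Vect n)} {a} → a ∈ as → Span as a
  span-∈ {as = a ∷ as} (here refl) = β , λ i → trans (sym (ℤₚ.+-identityʳ (a i)))
      (cong₂ _+_ (sym (ℤₚ.*-identityˡ (a i))) (Span.combination (span-0 {as = as}) i))
    where
    β : Vect (suc (length as))
    β zero    = 1ℤ
    β (suc j) = 0ℤ
  span-∈ {as = a ∷ as} (there p) with span-∈ p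
  ... | β , eq = γ , λ i → trans (eq i) (sym (ℤₚ.+-identityˡ _))
    where
    γ : Vect (suc (length as))
    γ zero    = 0ℤ
    γ (suc j) = β j

-- Triangular determinants, and the tensor splitting of the exterior algebra of a direct sum.

module Triangular where

  open import Data.Integer.Base using (ℤ; _+_; _*_; 0ℤ; 1ℤ; -1ℤ)
  open import Data.List.Properties using (map-++; map-tabulate)
  open import Relation.Binary.PropositionalEquality
    using (_≡_; _≗_; refl; sym; trans; cong; cong₂; module ≡-Reasoning)
  open ≡-Reasoning
  open ExteriorAlgebra

  private
    variable
      m n k : ℕ

  -- Expansion along a row supported in coordinate 0: it meets only the e₀-free part of the
  -- remaining wedge, which is the wedge of the truncated vectors.
  det-peel : ∀ (a : Vect (suc n)) bs → (∀ j → a (suc j) ≡ 0ℤ) →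
             det (a ∷ bs) ≡ a zero * det (map (_∘ suc) bs)
  det-peel a bs a≗0 = begin
    top (a ∧ ⋀ bs)                          ≡⟨ cong (λ z → top (a ∧ z)) (split-⋀ bs) ⟩
    top (a zero · X ⊹ -1ℤ · (a ∘ suc ∧ Y))  ≡⟨ cong (λ z → top (a zero · X ⊹ -1ℤ · z)) (zero∧ a≗0 Y) ⟩
    top (a zero · X ⊹ -1ℤ · 𝟘)              ≡⟨ cong (λ z → top (a zero · X ⊹ z)) (·-𝟘 -1ℤ) ⟩
    top (a zero · X ⊹ 𝟘)                    ≡⟨ cong top (⊹-identityʳ (a zero · X)) ⟩
    top (a zero · X)                        ≡⟨ top-· (a zero) X ⟩
    a zero * top X                          ∎
    where
    second : Λ (suc n) → Λ n
    second (node x y) = y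
    split-⋀ : ∀ bs → ⋀ bs ≡ node (⋀ (map (_∘ suc) bs)) (second (⋀ bs))
    split-⋀ []       = refl
    split-⋀ (b ∷ bs) rewrite split-⋀ bs = refl
    X = ⋀ (map (_∘ suc) bs)
    Y = second (⋀ bs)

  ∏ : (Fin n → ℤ) → ℤ
  ∏ {zero}  f = 1ℤ
  ∏ {suc n} f = f zero * ∏ (f ∘ suc)

  LowerTriangular : (Fin n → Vect n) → Set
  LowerTriangular a = ∀ {i j} → i Fin.< j → a i j ≡ 0ℤ

  det-lower : (a : Fin n → Vect n) → LowerTriangular a → det (tabulate a) ≡ ∏ (λ i → a i i)
  det-lower {zero}  a lower = refl
  det-lower {suc n} a lower = begin
    det (tabulate a)
      ≡⟨ det-peel (a zero) (tabulate (a ∘ suc)) (λ j → lower (s≤s z≤n)) ⟩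
    a zero zero * det (map (_∘ suc) (tabulate (a ∘ suc)))
      ≡⟨ cong (λ us → a zero zero * det us) (map-tabulate (a ∘ suc) (_∘ suc)) ⟩
    a zero zero * det (tabulate (λ i → a (suc i) ∘ suc))
      ≡⟨ cong (a zero zero *_) (det-lower (λ i → a (suc i) ∘ suc) (lower ∘ s≤s)) ⟩
    a zero zero * ∏ (λ i → a (suc i) (suc i)) ∎

  infixr 5 _⊕_

  _⊕_ : Vect k → Vect m → Vect (k ℕ.+ m)
  _⊕_ {zero}  a b i       = b i
  _⊕_ {suc k} a b zero    = a zero
  _⊕_ {suc k} a b (suc i) = (a ∘ suc ⊕ b) i

  0⃗ : Vect n
  0⃗ _ = 0ℤ

  0⊕0 : ∀ k → _⊕_ {k} {m} 0⃗ 0⃗ ≗ 0⃗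
  0⊕0 zero    i       = refl
  0⊕0 (suc k) zero    = refl
  0⊕0 (suc k) (suc i) = 0⊕0 k i

  ⊕-cong : {a a′ : Vect k} {b b′ : Vect m} → a ≗ a′ → b ≗ b′ → a ⊕ b ≗ a′ ⊕ b′
  ⊕-cong {zero}  a≗ b≗ i       = b≗ i
  ⊕-cong {suc k} a≗ b≗ zero    = a≗ zero
  ⊕-cong {suc k} a≗ b≗ (suc i) = ⊕-cong (a≗ ∘ suc) b≗ i

  ⊕-+ : ∀ (a a′ : Vect k) (b b′ : Vect m) i →
        (a ⊕ b) i + (a′ ⊕ b′) i ≡ ((λ j → a j + a′ j) ⊕ (λ j → b j + b′ j)) i
  ⊕-+ {zero}  a a′ b b′ i       = refl
  ⊕-+ {suc k} a a′ b b′ zero    = refl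
  ⊕-+ {suc k} a a′ b b′ (suc i) = ⊕-+ (a ∘ suc) (a′ ∘ suc) b b′ i

  ⊕-* : ∀ l (a : Vect k) (b : Vect m) i → l * (a ⊕ b) i ≡ ((λ j → l * a j) ⊕ (λ j → l * b j)) i
  ⊕-* {zero}  l a b i       = refl
  ⊕-* {suc k} l a b zero    = refl
  ⊕-* {suc k} l a b (suc i) = ⊕-* l (a ∘ suc) b i

  ⟨⊕,⊕⟩ : ∀ (f a : Vect k) (g b : Vect m) → ⟨ f ⊕ g , a ⊕ b ⟩ ≡ ⟨ f , a ⟩ + ⟨ g , b ⟩
  ⟨⊕,⊕⟩ {zero}  f a g b = sym (ℤₚ.+-identityˡ ⟨ g , b ⟩)
  ⟨⊕,⊕⟩ {suc k} f a g b = trans (cong (f zero * a zero +_) (⟨⊕,⊕⟩ (f ∘ suc) (a ∘ suc) g b))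
    (sym (ℤₚ.+-assoc (f zero * a zero) ⟨ f ∘ suc , a ∘ suc ⟩ ⟨ g , b ⟩))

  det-lower-block : ∀ (a : Fin k → Vect k) (c : Fin n → Vect k) (b : Fin n → Vect m) →
    LowerTriangular a →
    det (tabulate (λ i → a i ⊕ 0⃗) ++ tabulate (λ j → c j ⊕ b j)) ≡ ∏ (λ i → a i i) * det (tabulate b)
  det-lower-block {zero}  a c b lower = sym (ℤₚ.*-identityˡ (det (tabulate b)))
  det-lower-block {suc k} a c b lower = begin
    det (tabulate (λ i → a i ⊕ 0⃗) ++ tabulate (λ j → c j ⊕ b j))
      ≡⟨ det-peel (a zero ⊕ 0⃗) (tabulate (λ i → a (suc i) ⊕ 0⃗) ++ tabulate (λ j → c j ⊕ b j))
           (λ j → trans (⊕-cong {b = 0⃗} {b′ = 0⃗} (λ i → lower {zero} {suc i} (s≤s z≤n)) (λ _ → refl) j) (0⊕0 k j)) ⟩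
    a zero zero * det (map (_∘ suc) (tabulate (λ i → a (suc i) ⊕ 0⃗) ++ tabulate (λ j → c j ⊕ b j)))
      ≡⟨ cong (λ us → a zero zero * det us)
           (trans (map-++ (_∘ suc) (tabulate (λ i → a (suc i) ⊕ 0⃗)) _)
                  (cong₂ _++_ (map-tabulate (λ i → a (suc i) ⊕ 0⃗) (_∘ suc))
                              (map-tabulate (λ j → c j ⊕ b j) (_∘ suc)))) ⟩
    a zero zero * det (tabulate (λ i → a (suc i) ∘ suc ⊕ 0⃗) ++ tabulate (λ j → c j ∘ suc ⊕ b j))
      ≡⟨ cong (a zero zero *_) (det-lower-block (λ i → a (suc i) ∘ suc) (λ j → c j ∘ suc) b (lower ∘ s≤s)) ⟩
    a zero zero * (∏ (λ i → a (suc i) (suc i)) * det (tabulate b))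
      ≡⟨ ℤₚ.*-assoc (a zero zero) _ (det (tabulate b)) ⟨
    a zero zero * ∏ (λ i → a (suc i) (suc i)) * det (tabulate b) ∎

  infixr 7 _⊗_

  -- The isomorphism Λ(ℤᵏ) ⊗ Λ(ℤᵐ) → Λ(ℤᵏ⁺ᵐ) on pure tensors.
  _⊗_ : Λ k → Λ m → Λ (k ℕ.+ m)
  leaf i   ⊗ x = i · x
  node y z ⊗ x = node (y ⊗ x) (z ⊗ x)

  𝟘⊗ : (x : Λ m) → 𝟘 {k} ⊗ x ≡ 𝟘
  𝟘⊗ {k = zero}  x = zero· x
  𝟘⊗ {k = suc _} x = cong₂ node (𝟘⊗ x) (𝟘⊗ x)

  𝟙⊗𝟙 : ∀ k → 𝟙 {k} ⊗ 𝟙 {m} ≡ 𝟙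
  𝟙⊗𝟙 zero    = one· 𝟙
  𝟙⊗𝟙 (suc k) = cong₂ node (𝟙⊗𝟙 k) (𝟘⊗ {k = k} 𝟙)

  ⊹⊗ : ∀ (y z : Λ k) (x : Λ m) → (y ⊹ z) ⊗ x ≡ y ⊗ x ⊹ z ⊗ x
  ⊹⊗ (leaf i)   (leaf j)     x = ·-distribʳ i j x
  ⊹⊗ (node y z) (node y′ z′) x = cong₂ node (⊹⊗ y y′ x) (⊹⊗ z z′ x)

  ·⊗ : ∀ l (y : Λ k) (x : Λ m) → (l · y) ⊗ x ≡ l · (y ⊗ x)
  ·⊗ l (leaf i)   x = sym (·-· l i x)
  ·⊗ l (node y z) x = cong₂ node (·⊗ l y x) (·⊗ l z x)

  top-⊗ : (y : Λ k) (x : Λ m) → top (y ⊗ x) ≡ top y * top x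
  top-⊗ (leaf i)   x = top-· i x
  top-⊗ (node y z) x = top-⊗ z x

  ⊕0∧ : ∀ (a : Vect k) (y : Λ k) (x : Λ m) → (a ⊕ 0⃗) ∧ (y ⊗ x) ≡ (a ∧ y) ⊗ x
  ⊕0∧ a (leaf i)   x = trans (zero∧ (λ _ → refl) (i · x)) (sym (zero· x))
  ⊕0∧ a (node y z) x = cong₂ node (⊕0∧ (a ∘ suc) y x) (begin
    a zero · (y ⊗ x) ⊹ -1ℤ · ((a ∘ suc ⊕ 0⃗) ∧ (z ⊗ x))
      ≡⟨ cong (λ w → a zero · (y ⊗ x) ⊹ -1ℤ · w) (⊕0∧ (a ∘ suc) z x) ⟩
    a zero · (y ⊗ x) ⊹ -1ℤ · ((a ∘ suc ∧ z) ⊗ x)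
      ≡⟨ cong₂ _⊹_ (·⊗ (a zero) y x) (·⊗ -1ℤ (a ∘ suc ∧ z) x) ⟨
    (a zero · y) ⊗ x ⊹ (-1ℤ · (a ∘ suc ∧ z)) ⊗ x
      ≡⟨ ⊹⊗ (a zero · y) (-1ℤ · (a ∘ suc ∧ z)) x ⟨
    (a zero · y ⊹ -1ℤ · (a ∘ suc ∧ z)) ⊗ x ∎)

  -- A left tensor factor y in place of `𝟙` would introduce the sign (-1)^deg y. Vectors of the
  -- right block are therefore always applied while the left factor is still `𝟙`.
  0⊕∧ : ∀ k (b : Vect m) (x : Λ m) → (0⃗ ⊕ b) ∧ (𝟙 {k} ⊗ x) ≡ 𝟙 {k} ⊗ (b ∧ x)
  0⊕∧ zero    b x = trans (cong ((0⃗ ⊕ b) ∧_) (one· x)) (sym (one· (b ∧ x)))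
  0⊕∧ (suc k) b x = cong₂ node (0⊕∧ k b x) (begin
    0ℤ · (𝟙 {k} ⊗ x) ⊹ -1ℤ · ((0⃗ ⊕ b) ∧ (𝟘 {k} ⊗ x))
      ≡⟨ cong₂ (λ z w → z ⊹ -1ℤ · ((0⃗ ⊕ b) ∧ w)) (zero· (𝟙 {k} ⊗ x)) (𝟘⊗ {k = k} x) ⟩
    𝟘 ⊹ -1ℤ · ((0⃗ ⊕ b) ∧ 𝟘)
      ≡⟨ trans (⊹-identityˡ _) (cong (-1ℤ ·_) (∧-𝟘 (0⃗ {k} ⊕ b))) ⟩
    -1ℤ · 𝟘
      ≡⟨ ·-𝟘 -1ℤ ⟩
    𝟘
      ≡⟨ 𝟘⊗ {k = k} (b ∧ x) ⟨
    𝟘 {k} ⊗ (b ∧ x) ∎)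

-- Unit vectors and their pairing with functionals.

module Units where

  open import Data.Integer.Base using (_+_; _*_; 0ℤ; 1ℤ)
  open import Relation.Binary.PropositionalEquality using (_≡_; _≢_; refl; cong; cong₂; sym; trans)
  open ExteriorAlgebra
  open Triangular

  private
    variable
      n : ℕ

  δ : Fin n → Vect n
  δ v i = if does (v Finₚ.≟ i) then 1ℤ else 0ℤ

  δ-same : (v : Fin n) → δ v v ≡ 1ℤ
  δ-same v with v Finₚ.≟ v
  ... | yes _  = refl
  ... | no v≢v = contradiction refl v≢v

  δ-distinct : {v i : Fin n} → v ≢ i → δ v i ≡ 0ℤ
  δ-distinct {v = v} {i} v≢i with v Finₚ.≟ i
  ... | yes v≡i = contradiction v≡i v≢i
  ... | no _    = refl

  ⟨⟩-zero : (f : Vect n) → ⟨ f , 0⃗ ⟩ ≡ 0ℤ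
  ⟨⟩-zero {zero}  f = refl
  ⟨⟩-zero {suc n} f = trans (cong₂ _+_ (ℤₚ.*-zeroʳ (f zero)) (⟨⟩-zero (f ∘ suc))) refl

  ⟨⟩-δ : ∀ (f : Vect n) v → ⟨ f , δ v ⟩ ≡ f v
  ⟨⟩-δ {suc n} f zero    = trans (cong₂ _+_ (ℤₚ.*-identityʳ (f zero)) (⟨⟩-zero (f ∘ suc))) (ℤₚ.+-identityʳ (f zero))
  ⟨⟩-δ {suc n} f (suc v) = trans (cong₂ _+_ (ℤₚ.*-zeroʳ (f zero)) (⟨⟩-δ (f ∘ suc) v)) (ℤₚ.+-identityˡ (f (suc v)))

  ⟨⟩-* : ∀ (f : Vect n) k a → ⟨ f , (λ i → k * a i) ⟩ ≡ k * ⟨ f , a ⟩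
  ⟨⟩-* {zero}  f k a = sym (ℤₚ.*-zeroʳ k)
  ⟨⟩-* {suc n} f k a = trans (cong (λ z → f zero * (k * a zero) + z) (⟨⟩-* (f ∘ suc) k (a ∘ suc)))
    (lemma (f zero) k (a zero) ⟨ f ∘ suc , a ∘ suc ⟩)
    where
    open import Data.Integer.Tactic.RingSolver using (solve-∀)
    lemma : ∀ f k a x → f * (k * a) + k * x ≡ k * (f * a + x)
    lemma = solve-∀

-- Vectors indexed by the complement of an edge set.

module Complements where

  open import Data.Fin.Subset using (Subset; _∈_; _∉_; inside; outside; ∣_∣)
  open import Data.Vec.Base using (here; there; []; _∷_)
  open import Data.List.Membership.Propositional using () renaming (_∈_ to _∈ₗ_)
  open import Data.List.Relation.Unary.Any as Any using ()
  open import Data.Nat.Base using (_+_)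
  open import Data.Nat.Tactic.RingSolver using (solve-∀)
  open import Relation.Binary.PropositionalEquality using (_≡_; refl; cong; trans)

  private
    variable
      a p : Level
      A : Set a
      n : ℕ
    
  cons? : Maybe A → List A → List A
  cons? nothing  xs = xs
  cons? (just x) xs = x ∷ xs

  -- The order of pushing is the order in which the factors of `Z` act, so `⋀ (outs C v acc)` is on
  -- the nose the element reached in the term of `C`. An index with value `nothing`, such as a
  -- dilated edge in antisymmetric coordinates, adds no vector.
  outs : Subset n → (Fin n → Maybe A) → List A → List A
  outs []            v acc = acc
  outs (outside ∷ C) v acc = outs C (v ∘ suc) (cons? (v zero) acc)
  outs (inside  ∷ C) v acc = outs C (v ∘ suc) acc

  acc⊆outs : ∀ (C : Subset n) {v : Fin n → Maybe A} {acc x} → x ∈ₗ acc → x ∈ₗ outs C v acc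
  acc⊆outs []            x∈ = x∈
  acc⊆outs (outside ∷ C) {v = v} x∈ with v zero
  ... | nothing = acc⊆outs C x∈
  ... | just _  = acc⊆outs C (Any.there x∈)
  acc⊆outs (inside  ∷ C) x∈ = acc⊆outs C x∈

  ∈-outs : ∀ (C : Subset n) {v : Fin n → Maybe A} {acc i x} → i ∉ C → v i ≡ just x → x ∈ₗ outs C v acc
  ∈-outs (inside  ∷ C) {i = zero} i∉ eq with () ← i∉ here
  ∈-outs (outside ∷ C) {i = zero} i∉ eq rewrite eq = acc⊆outs C (Any.here refl)
  ∈-outs (inside  ∷ C) {i = suc i} i∉ eq = ∈-outs C (i∉ ∘ there) eq
  ∈-outs (outside ∷ C) {i = suc i} i∉ eq = ∈-outs C (i∉ ∘ there) eq

  All-outs : ∀ {P : A → Set p} (C : Subset n) {v : Fin n → Maybe A} {acc} →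
             All P acc → (∀ {i x} → i ∉ C → v i ≡ just x → P x) → All P (outs C v acc)
  All-outs []            Pacc Pv = Pacc
  All-outs (inside  ∷ C) Pacc Pv = All-outs C Pacc (λ i∉ → Pv (λ { (there i∈) → i∉ i∈ }))
  All-outs {P = P} (outside ∷ C) {v} {acc} Pacc Pv = All-outs C (head (v zero) refl)
    (λ i∉ → Pv (λ { (there i∈) → i∉ i∈ }))
    where
    head : ∀ m → v zero ≡ m → All P (cons? m acc)
    head nothing  _  = Pacc
    head (just _) eq = Pv (λ ()) eq ∷ Pacc

  size : Maybe A → ℕ
  size nothing  = 0
  size (just _) = 1

  sizes : (Fin n → Maybe A) → ℕ
  sizes {n = zero}  v = 0
  sizes {n = suc n} v = size (v zero) + sizes (v ∘ suc)

  -- The members of `C` are counted by `∣ C ∣` on the left, so each of them must be counted by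
  -- `sizes v` on the right as well.
  length-outs : ∀ (C : Subset n) (v : Fin n → Maybe A) acc → (∀ {i} → i ∈ C → size (v i) ≡ 1) →
                length (outs C v acc) + ∣ C ∣ ≡ sizes v + length acc
  length-outs []            v acc C⊆ = ℕₚ.+-identityʳ (length acc)
  length-outs (inside  ∷ C) v acc C⊆ rewrite C⊆ here =
    trans (ℕₚ.+-suc _ ∣ C ∣) (cong suc (length-outs C (v ∘ suc) acc (C⊆ ∘ there)))
  length-outs (outside ∷ C) v acc C⊆ =
    trans (length-outs C (v ∘ suc) (cons? (v zero) acc) (C⊆ ∘ there))
          (trans (cong (sizes (v ∘ suc) +_) (length-cons? (v zero) acc))
                 (rearrange (sizes (v ∘ suc)) (size (v zero)) (length acc)))
    where
    length-cons? : ∀ (m : Maybe A) acc → length (cons? m acc) ≡ size m + length acc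
    length-cons? nothing  acc = refl
    length-cons? (just _) acc = refl
    rearrange : ∀ a b c → a + (b + c) ≡ b + a + c
    rearrange = solve-∀

  sizes-just : (v : Fin n → A) → sizes (just ∘ v) ≡ n
  sizes-just {n = zero}  v = refl
  sizes-just {n = suc n} v = cong suc (sizes-just (v ∘ suc))

  map-outs : ∀ {b} {B : Set b} (f : A → B) (C : Subset n) (v : Fin n → Maybe A) acc →
             List.map f (outs C v acc) ≡ outs C (Maybe.map f ∘ v) (List.map f acc)
  map-outs f []            v acc = refl
  map-outs f (inside  ∷ C) v acc = map-outs f C (v ∘ suc) acc
  map-outs f (outside ∷ C) v acc with v zero
  ... | nothing = map-outs f C (v ∘ suc) acc
  ... | just a  = map-outs f C (v ∘ suc) (a ∷ acc)

  outs-cong : ∀ (C : Subset n) {v w : Fin n → Maybe A} {acc} → (∀ i → v i ≡ w i) → outs C v acc ≡ outs C w acc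
  outs-cong []            v≗w = refl
  outs-cong (inside  ∷ C) v≗w = outs-cong C (v≗w ∘ suc)
  outs-cong (outside ∷ C) {v} {w} {acc} v≗w =
    trans (cong (λ m → outs C (v ∘ suc) (cons? m acc)) (v≗w zero)) (outs-cong C (v≗w ∘ suc))

-- The canonical homomorphism from the integers to a commutative ring.

module FromInteger {c ℓ} (R : CommutativeRing c ℓ) where

  open import Data.Integer.Base as ℤ using (ℤ; +_; -[1+_]; _⊖_)
  open import Relation.Binary.PropositionalEquality as ≡ using (_≡_)
  open CommutativeRing R
  open import Algebra.Properties.Semiring.Mult semiring
  open import Algebra.Properties.Ring ring
    using (-‿distribˡ-*; -‿distribʳ-*; -‿involutive; -0#≈0#; -‿+-comm)
  open import Relation.Binary.Reasoning.Setoid setoid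

  fromℤ : ℤ → Carrier
  fromℤ (+ n)    = n × 1#
  fromℤ -[1+ n ] = - (suc n × 1#)

  fromℤ-⊖ : ∀ m n → fromℤ (m ⊖ n) ≈ m × 1# + - (n × 1#)
  fromℤ-⊖ zero    zero    = sym (trans (+-identityˡ (- 0#)) -0#≈0#)
  fromℤ-⊖ zero    (suc n) = sym (+-identityˡ _)
  fromℤ-⊖ (suc m) zero    = sym (trans (+-congˡ -0#≈0#) (+-identityʳ _))
  fromℤ-⊖ (suc m) (suc n) = begin
    fromℤ (suc m ⊖ suc n)                           ≡⟨ ≡.cong fromℤ (ℤₚ.[1+m]⊖[1+n]≡m⊖n m n) ⟩
    fromℤ (m ⊖ n)                                   ≈⟨ fromℤ-⊖ m n ⟩
    m × 1# + - (n × 1#)                         ≈⟨ +-congʳ (+-identityˡ _) ⟨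
    0# + m × 1# + - (n × 1#)                    ≈⟨ +-congʳ (+-congʳ (-‿inverseʳ 1#)) ⟨
    1# + - 1# + m × 1# + - (n × 1#)             ≈⟨ +-congʳ (+-assoc 1# (- 1#) _) ⟩
    1# + (- 1# + m × 1#) + - (n × 1#)           ≈⟨ +-congʳ (+-congˡ (+-comm (- 1#) _)) ⟩
    1# + (m × 1# + - 1#) + - (n × 1#)           ≈⟨ +-congʳ (+-assoc 1# _ _) ⟨
    suc m × 1# + - 1# + - (n × 1#)              ≈⟨ +-assoc _ _ _ ⟩
    suc m × 1# + (- 1# + - (n × 1#))            ≈⟨ +-congˡ (-‿+-comm 1# _) ⟩
    suc m × 1# + - (suc n × 1#)                 ∎

  fromℤ-+ : ∀ i j → fromℤ (i ℤ.+ j) ≈ fromℤ i + fromℤ j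
  fromℤ-+ (+ m)    (+ n)    = ×-homo-+ 1# m n
  fromℤ-+ (+ m)    -[1+ n ] = fromℤ-⊖ m (suc n)
  fromℤ-+ -[1+ m ] (+ n)    = trans (fromℤ-⊖ n (suc m)) (+-comm _ _)
  fromℤ-+ -[1+ m ] -[1+ n ] = begin
    - (suc (suc (m ℕ.+ n)) × 1#)            ≡⟨ ≡.cong (λ k → - (k × 1#)) (≡.cong suc (Data.Nat.Properties.+-suc m n)) ⟨
    - ((suc m ℕ.+ suc n) × 1#)              ≈⟨ -‿cong (×-homo-+ 1# (suc m) (suc n)) ⟩
    - (suc m × 1# + suc n × 1#)             ≈⟨ -‿+-comm _ _ ⟨
    - (suc m × 1#) + - (suc n × 1#)         ∎
    where import Data.Nat.Properties

  fromℤ-neg : ∀ i → fromℤ (ℤ.- i) ≈ - fromℤ i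
  fromℤ-neg (+ zero)  = sym -0#≈0#
  fromℤ-neg (+ suc n) = refl
  fromℤ-neg -[1+ n ]  = sym (-‿involutive _)

  fromℤ-* : ∀ i j → fromℤ (i ℤ.* j) ≈ fromℤ i * fromℤ j
  fromℤ-*+ : ∀ m j → fromℤ (+ m ℤ.* j) ≈ m × 1# * fromℤ j
  fromℤ-*+ m (+ n) = begin
    fromℤ (+ m ℤ.* + n)      ≡⟨ ≡.cong fromℤ (ℤₚ.pos-* m n) ⟨
    (m ℕ.* n) × 1#       ≈⟨ ×1-homo-* m n ⟩
    m × 1# * n × 1#      ∎
  fromℤ-*+ m -[1+ n ] = begin
    fromℤ (+ m ℤ.* -[1+ n ])               ≡⟨ ≡.cong fromℤ (ℤₚ.neg-distribʳ-* (+ m) (+ suc n)) ⟨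
    fromℤ (ℤ.- (+ m ℤ.* + suc n))          ≈⟨ fromℤ-neg (+ m ℤ.* + suc n) ⟩
    - fromℤ (+ m ℤ.* + suc n)              ≈⟨ -‿cong (fromℤ-*+ m (+ suc n)) ⟩
    - (m × 1# * suc n × 1#)            ≈⟨ -‿distribʳ-* _ _ ⟩
    m × 1# * - (suc n × 1#)            ∎
  fromℤ-* (+ m)    j = fromℤ-*+ m j
  fromℤ-* -[1+ m ] j = begin
    fromℤ (-[1+ m ] ℤ.* j)                 ≡⟨ ≡.cong fromℤ (ℤₚ.neg-distribˡ-* (+ suc m) j) ⟨
    fromℤ (ℤ.- (+ suc m ℤ.* j))            ≈⟨ fromℤ-neg (+ suc m ℤ.* j) ⟩
    - fromℤ (+ suc m ℤ.* j)                ≈⟨ -‿cong (fromℤ-*+ (suc m) j) ⟩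
    - (suc m × 1# * fromℤ j)               ≈⟨ -‿distribˡ-* _ _ ⟩
    - (suc m × 1#) * fromℤ j               ∎

-- Products of commuting operators on the tensor square of the exterior algebra.

module GeneratingFunction {c ℓ} (R : CommutativeRing c ℓ) where

  open import Data.Integer.Base as ℤ using (ℤ; +_; -[1+_]; 1ℤ; -1ℤ)
  open import Data.List.Relation.Binary.Permutation.Propositional as Perm
    using (_↭_; ↭-sym; ↭-trans)
  open import Relation.Binary.PropositionalEquality as ≡ using (_≡_)
  open CommutativeRing R hiding (zero)
  open import Algebra.Solver.Ring.NaturalCoefficients.Default commutativeSemiring
    using (solve; _:=_; _:+_; _:*_; con)
  open import Relation.Binary.Reasoning.Setoid setoid
  open ExteriorAlgebra
  open Triangular
  open FromInteger R

  private
    variable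
      n k m : ℕ

  -- The two terms of an operator: `weight-in` belongs to an edge in the removed set, `weight-out`
  -- with `vector` to an edge that is kept.
  record Factor (n : ℕ) : Set c where
    constructor factor
    field
      weight-in weight-out : Carrier
      vector               : Maybe (Vect n)

  open Factor public

  act : Maybe (Vect n) → Λ n → Λ n
  act nothing  x = x
  act (just a) x = a ∧ x

  -- The product of the operators α + β a ∧ ⊗ a ∧ on Λ ⊗ Λ, followed by top ⊗ top.
  Z : List (Factor n) → Λ n → Λ n → Carrier
  Z []       x y = fromℤ (top x ℤ.* top y)
  Z (f ∷ fs) x y = weight-in f * Z fs x y + weight-out f * Z fs (act (vector f) x) (act (vector f) y)

  act-⊹ : ∀ (a : Maybe (Vect n)) x y → act a (x ⊹ y) ≡ act a x ⊹ act a y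
  act-⊹ nothing  x y = ≡.refl
  act-⊹ (just a) x y = ∧-⊹ a x y

  act-· : ∀ (a : Maybe (Vect n)) k x → act a (k · x) ≡ k · act a x
  act-· nothing  k x = ≡.refl
  act-· (just a) k x = ∧-· a k x

  Z-⊹ˡ : ∀ (fs : List (Factor n)) x x′ y → Z fs (x ⊹ x′) y ≈ Z fs x y + Z fs x′ y
  Z-⊹ˡ [] x x′ y = begin
    fromℤ (top (x ⊹ x′) ℤ.* top y)                     ≡⟨ ≡.cong (λ t → fromℤ (t ℤ.* top y)) (top-⊹ x x′) ⟩
    fromℤ ((top x ℤ.+ top x′) ℤ.* top y)               ≡⟨ ≡.cong fromℤ (ℤₚ.*-distribʳ-+ (top y) (top x) (top x′)) ⟩
    fromℤ (top x ℤ.* top y ℤ.+ top x′ ℤ.* top y)       ≈⟨ fromℤ-+ (top x ℤ.* top y) (top x′ ℤ.* top y) ⟩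
    fromℤ (top x ℤ.* top y) + fromℤ (top x′ ℤ.* top y)     ∎
  Z-⊹ˡ (factor α β a ∷ fs) x x′ y = begin
    α * Z fs (x ⊹ x′) y + β * Z fs (act a (x ⊹ x′)) (act a y)
      ≡⟨ ≡.cong (λ z → α * Z fs (x ⊹ x′) y + β * Z fs z (act a y)) (act-⊹ a x x′) ⟩
    α * Z fs (x ⊹ x′) y + β * Z fs (act a x ⊹ act a x′) (act a y)
      ≈⟨ +-cong (*-congˡ (Z-⊹ˡ fs x x′ y)) (*-congˡ (Z-⊹ˡ fs (act a x) (act a x′) (act a y))) ⟩
    α * (Z fs x y + Z fs x′ y) + β * (Z fs (act a x) (act a y) + Z fs (act a x′) (act a y))
      ≈⟨ solve 6 (λ α β p q r s → α :* (p :+ q) :+ β :* (r :+ s) := (α :* p :+ β :* r) :+ (α :* q :+ β :* s))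
           refl α β _ _ _ _ ⟩
    (α * Z fs x y + β * Z fs (act a x) (act a y)) + (α * Z fs x′ y + β * Z fs (act a x′) (act a y)) ∎

  Z-·ˡ : ∀ (fs : List (Factor n)) k x y → Z fs (k · x) y ≈ fromℤ k * Z fs x y
  Z-·ˡ [] k x y = begin
    fromℤ (top (k · x) ℤ.* top y)       ≡⟨ ≡.cong (λ t → fromℤ (t ℤ.* top y)) (top-· k x) ⟩
    fromℤ (k ℤ.* top x ℤ.* top y)       ≡⟨ ≡.cong fromℤ (ℤₚ.*-assoc k (top x) (top y)) ⟩
    fromℤ (k ℤ.* (top x ℤ.* top y))     ≈⟨ fromℤ-* k (top x ℤ.* top y) ⟩
    fromℤ k * fromℤ (top x ℤ.* top y)       ∎
  Z-·ˡ (factor α β a ∷ fs) k x y = begin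
    α * Z fs (k · x) y + β * Z fs (act a (k · x)) (act a y)
      ≡⟨ ≡.cong (λ z → α * Z fs (k · x) y + β * Z fs z (act a y)) (act-· a k x) ⟩
    α * Z fs (k · x) y + β * Z fs (k · act a x) (act a y)
      ≈⟨ +-cong (*-congˡ (Z-·ˡ fs k x y)) (*-congˡ (Z-·ˡ fs k (act a x) (act a y))) ⟩
    α * (fromℤ k * Z fs x y) + β * (fromℤ k * Z fs (act a x) (act a y))
      ≈⟨ solve 5 (λ α β k p q → α :* (k :* p) :+ β :* (k :* q) := k :* (α :* p :+ β :* q)) refl α β (fromℤ k) _ _ ⟩
    fromℤ k * (α * Z fs x y + β * Z fs (act a x) (act a y)) ∎

  Z-sym : ∀ (fs : List (Factor n)) x y → Z fs x y ≈ Z fs y x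
  Z-sym []       x y = reflexive (≡.cong fromℤ (ℤₚ.*-comm (top x) (top y)))
  Z-sym (f ∷ fs) x y = +-cong (*-congˡ (Z-sym fs x y)) (*-congˡ (Z-sym fs _ _))

  Z-⊹ʳ : ∀ (fs : List (Factor n)) x y y′ → Z fs x (y ⊹ y′) ≈ Z fs x y + Z fs x y′
  Z-⊹ʳ fs x y y′ = trans (Z-sym fs x (y ⊹ y′)) (trans (Z-⊹ˡ fs y y′ x)
    (+-cong (Z-sym fs y x) (Z-sym fs y′ x)))

  Z-·ʳ : ∀ (fs : List (Factor n)) k x y → Z fs x (k · y) ≈ fromℤ k * Z fs x y
  Z-·ʳ fs k x y = trans (Z-sym fs x (k · y)) (trans (Z-·ˡ fs k y x) (*-congˡ (Z-sym fs y x)))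

  Z-·² : ∀ (fs : List (Factor n)) k x y → Z fs (k · x) (k · y) ≈ fromℤ (k ℤ.* k) * Z fs x y
  Z-·² fs k x y = begin
    Z fs (k · x) (k · y)          ≈⟨ Z-·ˡ fs k x (k · y) ⟩
    fromℤ k * Z fs x (k · y)          ≈⟨ *-congˡ (Z-·ʳ fs k x y) ⟩
    fromℤ k * (fromℤ k * Z fs x y)        ≈⟨ *-assoc _ _ _ ⟨
    fromℤ k * fromℤ k * Z fs x y          ≈⟨ *-congʳ (fromℤ-* k k) ⟨
    fromℤ (k ℤ.* k) * Z fs x y        ∎

  fromℤ1*_ : ∀ x → fromℤ 1ℤ * x ≈ x
  fromℤ1* x = trans (*-congʳ (+-identityʳ 1#)) (*-identityˡ x)

  infix 4 _≋_

  -- Equality as functionals on pure tensors. The record wrapper lets both lists be inferred from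
  -- the type.
  record _≋_ (fs gs : List (Factor n)) : Set (c ⊔ ℓ) where
    constructor equal
    field
      apply : ∀ x y → Z fs x y ≈ Z gs x y

  open _≋_ public

  ≋-refl : {fs : List (Factor n)} → fs ≋ fs
  ≋-refl = equal λ x y → refl

  ≋-trans : {fs gs hs : List (Factor n)} → fs ≋ gs → gs ≋ hs → fs ≋ hs
  ≋-trans p q = equal λ x y → trans (apply p x y) (apply q x y)

  ≋-prep : ∀ {fs gs : List (Factor n)} f → fs ≋ gs → f ∷ fs ≋ f ∷ gs
  ≋-prep f p = equal λ x y → +-cong (*-congˡ (apply p x y)) (*-congˡ (apply p _ _))

  -- Vectors anticommute, but the exchange happens in both tensor factors at once and the two signs
  -- cancel.
  Z-act-comm : ∀ (fs : List (Factor n)) a b x y →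
               Z fs (act a (act b x)) (act a (act b y)) ≈ Z fs (act b (act a x)) (act b (act a y))
  Z-act-comm fs nothing  b        x y = refl
  Z-act-comm fs (just a) nothing  x y = refl
  Z-act-comm fs (just a) (just b) x y = begin
    Z fs (a ∧ b ∧ x) (a ∧ b ∧ y)                    ≡⟨ ≡.cong₂ (Z fs) (∧-anticomm a b x) (∧-anticomm a b y) ⟩
    Z fs (-1ℤ · (b ∧ a ∧ x)) (-1ℤ · (b ∧ a ∧ y))    ≈⟨ Z-·² fs -1ℤ _ _ ⟩
    fromℤ 1ℤ * Z fs (b ∧ a ∧ x) (b ∧ a ∧ y)             ≈⟨ fromℤ1* _ ⟩
    Z fs (b ∧ a ∧ x) (b ∧ a ∧ y)                    ∎

  ≋-swap : ∀ (f g : Factor n) {fs} → f ∷ g ∷ fs ≋ g ∷ f ∷ fs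
  ≋-swap (factor α β a) (factor γ δ b) {fs} = equal λ x y → begin
    α * (γ * Z fs x y + δ * Z fs (act b x) (act b y)) +
      β * (γ * Z fs (act a x) (act a y) + δ * Z fs (act b (act a x)) (act b (act a y)))
      ≈⟨ +-congˡ (*-congˡ (+-congˡ (*-congˡ (Z-act-comm fs b a x y)))) ⟩
    α * (γ * Z fs x y + δ * Z fs (act b x) (act b y)) +
      β * (γ * Z fs (act a x) (act a y) + δ * Z fs (act a (act b x)) (act a (act b y)))
      ≈⟨ solve 8 (λ α β γ δ p q r s → α :* (γ :* p :+ δ :* q) :+ β :* (γ :* r :+ δ :* s) :=
                                      γ :* (α :* p :+ β :* r) :+ δ :* (α :* q :+ β :* s))
           refl α β γ δ _ _ _ _ ⟩
    γ * (α * Z fs x y + β * Z fs (act a x) (act a y)) +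
      δ * (α * Z fs (act b x) (act b y) + β * Z fs (act a (act b x)) (act a (act b y))) ∎

  ↭⇒≋ : {fs gs : List (Factor n)} → fs ↭ gs → fs ≋ gs
  ↭⇒≋ Perm.refl          = ≋-refl
  ↭⇒≋ (Perm.prep f p)    = ≋-prep f (↭⇒≋ p)
  ↭⇒≋ (Perm.swap f g p)  = ≋-trans (≋-swap f g) (≋-prep g (≋-prep f (↭⇒≋ p)))
  ↭⇒≋ (Perm.trans p q)   = ≋-trans (↭⇒≋ p) (↭⇒≋ q)

  ≋-++ˡ : ∀ (hs : List (Factor n)) {fs gs} → fs ≋ gs → hs ++ fs ≋ hs ++ gs
  ≋-++ˡ []       p = p
  ≋-++ˡ (h ∷ hs) p = ≋-prep h (≋-++ˡ hs p)

  -- The hypothesis compares `fs` and `gs` only when followed by `top ⊗ top`, not by further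
  -- operators. Commutativity moves `hs` to the front, where `≋-++ˡ` applies.
  ≋-++ʳ : ∀ {fs gs : List (Factor n)} hs → fs ≋ gs → fs ++ hs ≋ gs ++ hs
  ≋-++ʳ {fs = fs} {gs} hs p = ≋-trans (↭⇒≋ (Permₚ.++-comm fs hs))
    (≋-trans (≋-++ˡ hs p) (↭⇒≋ (Permₚ.++-comm hs gs)))

  ≋-concatMap : ∀ {a} {A : Set a} {F G : A → List (Factor n)} (xs : List A) →
                (∀ x → F x ≋ G x) → concatMap F xs ≋ concatMap G xs
  ≋-concatMap []       p = ≋-refl
  ≋-concatMap {F = F} {G} (x ∷ xs) p =
    ≋-trans (≋-++ʳ (concatMap F xs) (p x)) (≋-++ˡ (G x) (≋-concatMap xs p))

  concatMap-triple : ∀ {a b} {A : Set a} {B : Set b} (f g h : A → B) xs →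
    concatMap (λ x → f x ∷ g x ∷ h x ∷ []) xs ↭ List.map f xs ++ List.map g xs ++ List.map h xs
  concatMap-triple f g h []       = Perm.refl
  concatMap-triple f g h (x ∷ xs) = Perm.prep (f x) (↭-trans
    (Perm.prep (g x) (Perm.prep (h x) (concatMap-triple f g h xs)))
    (↭-trans (Perm.prep (g x) (↭-trans (↭-sym (Permₚ.shift (h x) F (G ++ H)))
                (Permₚ.++⁺ˡ F (↭-sym (Permₚ.shift (h x) G H)))))
             (↭-sym (Permₚ.shift (g x) F (G ++ h x ∷ H)))))
    where
    F = List.map f xs
    G = List.map g xs
    H = List.map h xs

  forced : Vect n → Factor n
  forced a = factor 0# 1# (just a)

  scalar : Carrier → Factor n
  scalar r = factor r 0# nothing

  -- A factor without constant term always contributes its vector. Initial vectors can thus be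
  -- traded for factors, which may be permuted freely; the accumulator reverses their order.
  Z-forced : ∀ (as : List (Vect n)) fs bs →
             Z (List.map forced as ++ fs) (⋀ bs) (⋀ bs) ≈ Z fs (⋀ (as List.ʳ++ bs)) (⋀ (as List.ʳ++ bs))
  Z-forced []       fs bs = refl
  Z-forced (a ∷ as) fs bs = begin
    0# * Z gs (⋀ bs) (⋀ bs) + 1# * Z gs (⋀ (a ∷ bs)) (⋀ (a ∷ bs))
      ≈⟨ +-cong (zeroˡ _) (*-identityˡ _) ⟩
    0# + Z gs (⋀ (a ∷ bs)) (⋀ (a ∷ bs))
      ≈⟨ +-identityˡ _ ⟩
    Z gs (⋀ (a ∷ bs)) (⋀ (a ∷ bs))
      ≈⟨ Z-forced as fs (a ∷ bs) ⟩
    Z fs (⋀ (as List.ʳ++ (a ∷ bs))) (⋀ (as List.ʳ++ (a ∷ bs))) ∎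
    where gs = List.map forced as ++ fs

  ∏ˡ : List Carrier → Carrier
  ∏ˡ = List.foldr _*_ 1#

  Z-scalar : ∀ rs (fs : List (Factor n)) x y → Z (List.map scalar rs ++ fs) x y ≈ ∏ˡ rs * Z fs x y
  Z-scalar []       fs x y = sym (*-identityˡ _)
  Z-scalar (r ∷ rs) fs x y = begin
    r * Z (List.map scalar rs ++ fs) x y + 0# * _
      ≈⟨ +-cong (*-congˡ (Z-scalar rs fs x y)) (zeroˡ _) ⟩
    r * (∏ˡ rs * Z fs x y) + 0#
      ≈⟨ trans (+-identityʳ _) (sym (*-assoc _ _ _)) ⟩
    r * ∏ˡ rs * Z fs x y ∎

  -- The vector enters quadratically, so the orientation of an edge does not matter.
  ε²≡1⇒≋ : ∀ ε → ε ℤ.* ε ≡ 1ℤ → ∀ {α α′ β} {a b : Vect n} → α ≈ α′ → (∀ i → a i ≡ ε ℤ.* b i) →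
           factor α β (just a) ∷ [] ≋ factor α′ β (just b) ∷ []
  ε²≡1⇒≋ ε ε² {β = β} {a} {b} α≈ a≗ = equal λ x y → +-cong (*-congʳ α≈) (*-congˡ (begin
    Z [] (a ∧ x) (a ∧ y)                 ≡⟨ ≡.cong₂ (Z []) (scale x) (scale y) ⟩
    Z [] (ε · (b ∧ x)) (ε · (b ∧ y))     ≈⟨ Z-·² [] ε (b ∧ x) (b ∧ y) ⟩
    fromℤ (ε ℤ.* ε) * Z [] (b ∧ x) (b ∧ y)   ≡⟨ ≡.cong (λ k → fromℤ k * Z [] (b ∧ x) (b ∧ y)) ε² ⟩
    fromℤ 1ℤ * Z [] (b ∧ x) (b ∧ y)          ≈⟨ fromℤ1* _ ⟩
    Z [] (b ∧ x) (b ∧ y)                 ∎))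
    where
    scale : ∀ x → a ∧ x ≡ ε · (b ∧ x)
    scale x = ≡.trans (∧-cong a≗ x) (*∧ ε b x)

  2# : Carrier
  2# = 1# + 1#

  -- With a± = s ± t, one has a₊a₊ + a₋a₋ = 2ss + 2tt and a₊ ∧ a₋ = −2 s ∧ t,
  -- whence (α + a₊a₊)(α + a₋a₋) = (α + 2ss)(α + 2tt).
  ≋-conjugate : ∀ α (s t : Vect n) →
    factor α 1# (just (λ i → s i ℤ.+ t i)) ∷ factor α 1# (just (λ i → s i ℤ.+ -1ℤ ℤ.* t i)) ∷ [] ≋
    factor α 2# (just s) ∷ factor α 2# (just t) ∷ []
  ≋-conjugate {n = n} α s t = equal λ x y → begin
    α * (α * L x y + 1# * L (b ∧ x) (b ∧ y)) + 1# * (α * L (a ∧ x) (a ∧ y) + 1# * L (b ∧ a ∧ x) (b ∧ a ∧ y))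
      ≈⟨ solve 5 (λ α p q r s → α :* (α :* p :+ con 1 :* q) :+ con 1 :* (α :* r :+ con 1 :* s) :=
                                α :* (α :* p) :+ α :* (r :+ q) :+ s) refl α _ _ _ _ ⟩
    α * (α * L x y) + α * (L (a ∧ x) (a ∧ y) + L (b ∧ x) (b ∧ y)) + L (b ∧ a ∧ x) (b ∧ a ∧ y)
      ≈⟨ +-cong (+-congˡ (*-congˡ (diagonal x y))) (product x y) ⟩
    α * (α * L x y) + α * (2# * L (s ∧ x) (s ∧ y) + 2# * L (t ∧ x) (t ∧ y)) + 2# * 2# * L (t ∧ s ∧ x) (t ∧ s ∧ y)
      ≈⟨ solve 5 (λ α p q r s → let two = con 1 :+ con 1 in
             α :* (α :* p) :+ α :* (two :* r :+ two :* q) :+ two :* two :* s :=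
             α :* (α :* p :+ two :* q) :+ two :* (α :* r :+ two :* s)) refl α _ _ _ _ ⟩
    α * (α * L x y + 2# * L (t ∧ x) (t ∧ y)) + 2# * (α * L (s ∧ x) (s ∧ y) + 2# * L (t ∧ s ∧ x) (t ∧ s ∧ y)) ∎
    where
    L = Z {n} []
    a b : Vect n
    a i = s i ℤ.+ t i
    b i = s i ℤ.+ -1ℤ ℤ.* t i
    a∧ : ∀ x → a ∧ x ≡ s ∧ x ⊹ t ∧ x
    a∧ x = +∧ s t x
    b∧ : ∀ x → b ∧ x ≡ s ∧ x ⊹ -1ℤ · (t ∧ x)
    b∧ x = ≡.trans (+∧ s _ x) (≡.cong (s ∧ x ⊹_) (*∧ -1ℤ t x))
    bilinear : ∀ k (p q p′ q′ : Λ n) → L (p ⊹ k · q) (p′ ⊹ k · q′) ≈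
               (L p p′ + fromℤ k * L p q′) + (fromℤ k * L q p′ + fromℤ (k ℤ.* k) * L q q′)
    bilinear k p q p′ q′ = begin
      L (p ⊹ k · q) (p′ ⊹ k · q′)
        ≈⟨ Z-⊹ˡ [] p (k · q) (p′ ⊹ k · q′) ⟩
      L p (p′ ⊹ k · q′) + L (k · q) (p′ ⊹ k · q′)
        ≈⟨ +-cong (Z-⊹ʳ [] p p′ (k · q′)) (Z-⊹ʳ [] (k · q) p′ (k · q′)) ⟩
      (L p p′ + L p (k · q′)) + (L (k · q) p′ + L (k · q) (k · q′))
        ≈⟨ +-cong (+-congˡ (Z-·ʳ [] k p q′)) (+-cong (Z-·ˡ [] k q p′) (Z-·² [] k q q′)) ⟩
      (L p p′ + fromℤ k * L p q′) + (fromℤ k * L q p′ + fromℤ (k ℤ.* k) * L q q′) ∎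
    diagonal : ∀ x y → L (a ∧ x) (a ∧ y) + L (b ∧ x) (b ∧ y) ≈ 2# * L (s ∧ x) (s ∧ y) + 2# * L (t ∧ x) (t ∧ y)
    diagonal x y = begin
      L (a ∧ x) (a ∧ y) + L (b ∧ x) (b ∧ y)
        ≡⟨ ≡.cong₂ _+_ (≡.cong₂ L (≡.trans (a∧ x) (≡.cong (s ∧ x ⊹_) (≡.sym (one· (t ∧ x)))))
                                  (≡.trans (a∧ y) (≡.cong (s ∧ y ⊹_) (≡.sym (one· (t ∧ y))))))
                       (≡.cong₂ L (b∧ x) (b∧ y)) ⟩
      L (s ∧ x ⊹ 1ℤ · (t ∧ x)) (s ∧ y ⊹ 1ℤ · (t ∧ y)) + L (s ∧ x ⊹ -1ℤ · (t ∧ x)) (s ∧ y ⊹ -1ℤ · (t ∧ y))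
        ≈⟨ +-cong (bilinear 1ℤ (s ∧ x) (t ∧ x) (s ∧ y) (t ∧ y)) (bilinear -1ℤ (s ∧ x) (t ∧ x) (s ∧ y) (t ∧ y)) ⟩
      ((p + fromℤ 1ℤ * q) + (fromℤ 1ℤ * r + fromℤ 1ℤ * v)) + ((p + fromℤ -1ℤ * q) + (fromℤ -1ℤ * r + fromℤ 1ℤ * v))
        ≈⟨ solve 6 (λ p q r v i j → ((p :+ i :* q) :+ (i :* r :+ i :* v)) :+ ((p :+ j :* q) :+ (j :* r :+ i :* v)) :=
                                    (p :+ p :+ (i :+ j) :* (q :+ r)) :+ i :* (v :+ v)) refl p q r v (fromℤ 1ℤ) (fromℤ -1ℤ) ⟩
      (p + p + (fromℤ 1ℤ + fromℤ -1ℤ) * (q + r)) + fromℤ 1ℤ * (v + v)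
        ≈⟨ +-cong (+-congˡ (trans (*-congʳ (sym (fromℤ-+ 1ℤ -1ℤ))) (zeroˡ _))) (fromℤ1* _) ⟩
      (p + p + 0#) + (v + v)
        ≈⟨ solve 2 (λ p v → (p :+ p :+ con 0) :+ (v :+ v) := (con 1 :+ con 1) :* p :+ (con 1 :+ con 1) :* v) refl p v ⟩
      2# * p + 2# * v ∎
      where
      p = L (s ∧ x) (s ∧ y)
      q = L (s ∧ x) (t ∧ y)
      r = L (t ∧ x) (s ∧ y)
      v = L (t ∧ x) (t ∧ y)
    -2ℤ = -[1+ 1 ]
    b∧a∧ : ∀ x → b ∧ a ∧ x ≡ -2ℤ · (t ∧ s ∧ x)
    b∧a∧ x = E.begin
      b ∧ a ∧ x                                   E.≡⟨ ≡.cong (b ∧_) (a∧ x) ⟩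
      b ∧ (s ∧ x ⊹ t ∧ x)                         E.≡⟨ b∧ _ ⟩
      s ∧ (s ∧ x ⊹ t ∧ x) ⊹ -1ℤ · (t ∧ (s ∧ x ⊹ t ∧ x))
        E.≡⟨ ≡.cong₂ (λ z w → z ⊹ -1ℤ · w) (∧-⊹ s (s ∧ x) (t ∧ x)) (∧-⊹ t (s ∧ x) (t ∧ x)) ⟩
      (s ∧ s ∧ x ⊹ s ∧ t ∧ x) ⊹ -1ℤ · (t ∧ s ∧ x ⊹ t ∧ t ∧ x)
        E.≡⟨ ≡.cong₂ (λ z w → (z ⊹ s ∧ t ∧ x) ⊹ -1ℤ · (t ∧ s ∧ x ⊹ w)) (∧-nilpotent s x) (∧-nilpotent t x) ⟩
      (𝟘 ⊹ s ∧ t ∧ x) ⊹ -1ℤ · (t ∧ s ∧ x ⊹ 𝟘)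
        E.≡⟨ ≡.cong₂ (λ z w → z ⊹ -1ℤ · w) (≡.trans (⊹-identityˡ _) (∧-anticomm s t x)) (⊹-identityʳ _) ⟩
      -1ℤ · (t ∧ s ∧ x) ⊹ -1ℤ · (t ∧ s ∧ x)       E.≡⟨ ·-distribʳ -1ℤ -1ℤ (t ∧ s ∧ x) ⟨
      -2ℤ · (t ∧ s ∧ x)                           E.∎
      where module E = ≡.≡-Reasoning
    product : ∀ x y → L (b ∧ a ∧ x) (b ∧ a ∧ y) ≈ 2# * 2# * L (t ∧ s ∧ x) (t ∧ s ∧ y)
    product x y = begin
      L (b ∧ a ∧ x) (b ∧ a ∧ y)
        ≡⟨ ≡.cong₂ L (b∧a∧ x) (b∧a∧ y) ⟩
      L (-2ℤ · (t ∧ s ∧ x)) (-2ℤ · (t ∧ s ∧ y))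
        ≈⟨ Z-·² [] -2ℤ (t ∧ s ∧ x) (t ∧ s ∧ y) ⟩
      fromℤ (+ 4) * L (t ∧ s ∧ x) (t ∧ s ∧ y)
        ≈⟨ *-congʳ (solve 0 (con 1 :+ (con 1 :+ (con 1 :+ (con 1 :+ con 0))) := (con 1 :+ con 1) :* (con 1 :+ con 1)) refl) ⟩
      2# * 2# * L (t ∧ s ∧ x) (t ∧ s ∧ y) ∎

  -- The case of a dilated edge, whose length doubles under the projection. The last factor is the
  -- identity operator: it stands for the missing antisymmetric vector, so that every edge of the
  -- base yields exactly three factors.
  ≋-halve : ∀ {h} → h + h ≈ 1# → ∀ {α α′} → α + α ≈ α′ → (s : Vect n) →
    factor α 1# (just s) ∷ [] ≋ scalar h ∷ factor α′ 2# (just s) ∷ factor 0# 1# nothing ∷ []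
  ≋-halve {n = n} {h} h+h≈1 {α} {α′} α+α≈ s = equal λ x y → let p = Z {n} [] x y ; q = Z {n} [] (s ∧ x) (s ∧ y) in begin
    α * p + 1# * q
      ≈⟨ *-identityˡ _ ⟨
    1# * (α * p + 1# * q)
      ≈⟨ *-congʳ h+h≈1 ⟨
    (h + h) * (α * p + 1# * q)
      ≈⟨ solve 4 (λ h α p q → (h :+ h) :* (α :* p :+ con 1 :* q) :=
           h :* ((α :+ α) :* (con 0 :* p :+ con 1 :* p) :+ (con 1 :+ con 1) :* (con 0 :* q :+ con 1 :* q)))
           refl h α p q ⟩
    h * ((α + α) * (0# * p + 1# * p) + 2# * (0# * q + 1# * q))
      ≈⟨ *-congˡ (+-congʳ (*-congʳ α+α≈)) ⟩
    h * (α′ * (0# * p + 1# * p) + 2# * (0# * q + 1# * q))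
      ≈⟨ trans (+-congˡ (zeroˡ _)) (+-identityʳ _) ⟨
    h * (α′ * (0# * p + 1# * p) + 2# * (0# * q + 1# * q)) + 0# * _ ∎

  ≋-scalar1 : (fs : List (Factor n)) → fs ≋ scalar 1# ∷ fs
  ≋-scalar1 fs = equal λ x y → sym (trans (+-cong (*-identityˡ _) (zeroˡ _)) (+-identityʳ _))

  inˡ : ∀ m → Factor k → Factor (k ℕ.+ m)
  inˡ m (factor α β a) = factor α β (Maybe.map (_⊕ 0⃗) a)

  inʳ : ∀ k → Factor m → Factor (k ℕ.+ m)
  inʳ k (factor α β b) = factor α β (Maybe.map (0⃗ ⊕_) b)

  act-inˡ : ∀ (a : Maybe (Vect k)) y (x : Λ m) → act (Maybe.map (_⊕ 0⃗) a) (y ⊗ x) ≡ act a y ⊗ x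
  act-inˡ nothing  y x = ≡.refl
  act-inˡ (just a) y x = ⊕0∧ a y x

  act-inʳ : ∀ k (b : Maybe (Vect m)) x → act (Maybe.map (0⃗ ⊕_) b) (𝟙 {k} ⊗ x) ≡ 𝟙 {k} ⊗ act b x
  act-inʳ k nothing  x = ≡.refl
  act-inʳ k (just b) x = 0⊕∧ k b x

  Z-inˡ : ∀ (fs : List (Factor k)) y y′ (x x′ : Λ m) →
          Z (List.map (inˡ m) fs) (y ⊗ x) (y′ ⊗ x′) ≈ Z fs y y′ * fromℤ (top x ℤ.* top x′)
  Z-inˡ [] y y′ x x′ = begin
    fromℤ (top (y ⊗ x) ℤ.* top (y′ ⊗ x′))              ≡⟨ ≡.cong fromℤ (≡.cong₂ ℤ._*_ (top-⊗ y x) (top-⊗ y′ x′)) ⟩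
    fromℤ (top y ℤ.* top x ℤ.* (top y′ ℤ.* top x′))    ≡⟨ ≡.cong fromℤ (exchange (top y) (top x) (top y′) (top x′)) ⟩
    fromℤ (top y ℤ.* top y′ ℤ.* (top x ℤ.* top x′))    ≈⟨ fromℤ-* (top y ℤ.* top y′) _ ⟩
    fromℤ (top y ℤ.* top y′) * fromℤ (top x ℤ.* top x′)    ∎
    where
    open import Data.Integer.Tactic.RingSolver using (solve-∀)
    exchange : ∀ a b c d → a ℤ.* b ℤ.* (c ℤ.* d) ≡ a ℤ.* c ℤ.* (b ℤ.* d)
    exchange = solve-∀
  Z-inˡ {k} {m} (factor α β a ∷ fs) y y′ x x′ = begin
    α * Z gs (y ⊗ x) (y′ ⊗ x′) + β * Z gs (act a′ (y ⊗ x)) (act a′ (y′ ⊗ x′))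
      ≡⟨ ≡.cong (λ z → α * Z gs (y ⊗ x) (y′ ⊗ x′) + β * z) (≡.cong₂ (Z gs) (act-inˡ a y x) (act-inˡ a y′ x′)) ⟩
    α * Z gs (y ⊗ x) (y′ ⊗ x′) + β * Z gs (act a y ⊗ x) (act a y′ ⊗ x′)
      ≈⟨ +-cong (*-congˡ (Z-inˡ fs y y′ x x′)) (*-congˡ (Z-inˡ fs (act a y) (act a y′) x x′)) ⟩
    α * (Z fs y y′ * t) + β * (Z fs (act a y) (act a y′) * t)
      ≈⟨ solve 5 (λ α β p q t → α :* (p :* t) :+ β :* (q :* t) := (α :* p :+ β :* q) :* t) refl α β _ _ t ⟩
    (α * Z fs y y′ + β * Z fs (act a y) (act a y′)) * t ∎
    where
    gs = List.map (inˡ m) fs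
    a′ = Maybe.map (_⊕ 0⃗ {m}) a
    t = fromℤ (top x ℤ.* top x′)

  -- The right-block factors come first, as `0⊕∧` requires. The left-block factors then leave the
  -- right tensor component untouched, and only its top coefficient survives.
  Z-block : ∀ (fs : List (Factor k)) (gs : List (Factor m)) x x′ →
            Z (List.map (inʳ k) gs ++ List.map (inˡ m) fs) (𝟙 {k} ⊗ x) (𝟙 {k} ⊗ x′) ≈ Z fs 𝟙 𝟙 * Z gs x x′
  Z-block fs [] x x′ = Z-inˡ fs 𝟙 𝟙 x x′
  Z-block {k} {m} fs (factor α β b ∷ gs) x x′ = begin
    α * Z hs (𝟙 {k} ⊗ x) (𝟙 {k} ⊗ x′) + β * Z hs (act b′ (𝟙 {k} ⊗ x)) (act b′ (𝟙 {k} ⊗ x′))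
      ≡⟨ ≡.cong (λ z → α * Z hs (𝟙 {k} ⊗ x) (𝟙 {k} ⊗ x′) + β * z)
           (≡.cong₂ (Z hs) (act-inʳ k b x) (act-inʳ k b x′)) ⟩
    α * Z hs (𝟙 {k} ⊗ x) (𝟙 {k} ⊗ x′) + β * Z hs (𝟙 {k} ⊗ act b x) (𝟙 {k} ⊗ act b x′)
      ≈⟨ +-cong (*-congˡ (Z-block fs gs x x′)) (*-congˡ (Z-block fs gs (act b x) (act b x′))) ⟩
    α * (Z fs 𝟙 𝟙 * Z gs x x′) + β * (Z fs 𝟙 𝟙 * Z gs (act b x) (act b x′))
      ≈⟨ solve 5 (λ α β p q t → α :* (t :* p) :+ β :* (t :* q) := t :* (α :* p :+ β :* q)) refl α β _ _ _ ⟩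
    Z fs 𝟙 𝟙 * (α * Z gs x x′ + β * Z gs (act b x) (act b x′)) ∎
    where
    hs = List.map (inʳ k) gs ++ List.map (inˡ m) fs
    b′ = Maybe.map (0⃗ {k} ⊕_) b

-- Expansion of the operator product over edge sets.

module CauchyBinet {c ℓ p} (K : LengthRing c ℓ p) where

  open import Data.Fin.Subset using (Subset; _∈_; ∁; inside; outside)
  open import Data.Vec.Base using (here; there; []; _∷_)
  open import Data.Integer.Base as ℤ using (ℤ)
  open import Relation.Binary.PropositionalEquality as ≡ using (_≡_)
  open LengthRing K using (commutativeRing; Σ⊆; ∏∈)
  open CommutativeRing commutativeRing hiding (zero)
  open import Algebra.Solver.Ring.NaturalCoefficients.Default commutativeSemiring
    using (solve; _:=_; _:*_; con)
  open import Relation.Binary.Reasoning.Setoid setoid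
  open ExteriorAlgebra
  open Triangular
  open FromInteger commutativeRing
  open GeneratingFunction commutativeRing
  open Complements

  private
    variable
      n N : ℕ

  Σ⊆-cong : {f g : Subset n → Carrier} → (∀ C → f C ≈ g C) → Σ⊆ f ≈ Σ⊆ g
  Σ⊆-cong {zero}  f≈g = f≈g []
  Σ⊆-cong {suc n} f≈g = +-cong (Σ⊆-cong (f≈g ∘ (outside ∷_))) (Σ⊆-cong (f≈g ∘ (inside ∷_)))

  Σ⊆-* : ∀ r (f : Subset n → Carrier) → r * Σ⊆ f ≈ Σ⊆ (λ C → r * f C)
  Σ⊆-* {zero}  r f = refl
  Σ⊆-* {suc n} r f = trans (distribˡ r _ _) (+-cong (Σ⊆-* r (f ∘ (outside ∷_))) (Σ⊆-* r (f ∘ (inside ∷_))))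

  ∏∈-cong : ∀ (C : Subset n) {f g} → (∀ i → i ∈ C → f i ≈ g i) → ∏∈ C f ≈ ∏∈ C g
  ∏∈-cong []            f≈g = refl
  ∏∈-cong (outside ∷ C) f≈g = *-congˡ (∏∈-cong C (λ i → f≈g (suc i) ∘ there))
  ∏∈-cong (inside  ∷ C) f≈g = *-cong (f≈g zero here) (∏∈-cong C (λ i → f≈g (suc i) ∘ there))

  ∏∈-zero : ∀ {C : Subset n} {f i} → i ∈ C → f i ≈ 0# → ∏∈ C f ≈ 0#
  ∏∈-zero here              f₀≈0 = trans (*-congʳ f₀≈0) (zeroˡ _)
  ∏∈-zero (there {y = y} i∈C) fi≈0 = trans (*-congˡ (∏∈-zero i∈C fi≈0)) (zeroʳ _)

  -- Each edge is either removed or kept, and a kept edge acts by the same vector on both tensor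
  -- factors, which therefore stay equal; their top coefficients multiply to a square.
  Z-Σ : ∀ (α β : Fin n → Carrier) (v : Fin n → Maybe (Vect N)) acc →
    Z (tabulate (λ i → factor (α i) (β i) (v i))) (⋀ acc) (⋀ acc) ≈
    Σ⊆ (λ C → ∏∈ C α * ∏∈ (∁ C) β * fromℤ (det (outs C v acc) ℤ.* det (outs C v acc)))
  Z-Σ {zero}  α β v acc = sym (trans (*-congʳ (*-identityˡ 1#)) (*-identityˡ _))
  Z-Σ {suc n} α β v acc = begin
    α zero * Z fs (⋀ acc) (⋀ acc) + β zero * Z fs (act (v zero) (⋀ acc)) (act (v zero) (⋀ acc))
      ≡⟨ ≡.cong (λ x → α zero * Z fs (⋀ acc) (⋀ acc) + β zero * Z fs x x) (act-⋀ (v zero)) ⟩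
    α zero * Z fs (⋀ acc) (⋀ acc) + β zero * Z fs (⋀ (cons? (v zero) acc)) (⋀ (cons? (v zero) acc))
      ≈⟨ +-cong (*-congˡ (Z-Σ (α ∘ suc) (β ∘ suc) (v ∘ suc) acc))
                (*-congˡ (Z-Σ (α ∘ suc) (β ∘ suc) (v ∘ suc) (cons? (v zero) acc))) ⟩
    α zero * Σ⊆ (term acc) + β zero * Σ⊆ (term (cons? (v zero) acc))
      ≈⟨ +-cong (Σ⊆-* (α zero) (term acc)) (Σ⊆-* (β zero) (term (cons? (v zero) acc))) ⟩
    Σ⊆ (λ C → α zero * term acc C) + Σ⊆ (λ C → β zero * term (cons? (v zero) acc) C)
      -- `Σ⊆` sums over the subsets omitting the first index before those containing it, while `Z`
      -- produces the containing ones first.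
      ≈⟨ +-comm _ _ ⟩
    Σ⊆ (λ C → β zero * term (cons? (v zero) acc) C) + Σ⊆ (λ C → α zero * term acc C)
      ≈⟨ +-cong (Σ⊆-cong {n} λ C → solve 4 (λ b p q t → b :* (p :* q :* t) := (con 1 :* p) :* (b :* q) :* t)
                                    refl (β zero) _ _ _)
                (Σ⊆-cong {n} λ C → solve 4 (λ a p q t → a :* (p :* q :* t) := (a :* p) :* (con 1 :* q) :* t)
                                    refl (α zero) _ _ _) ⟩
    Σ⊆ full ∎
    where
    full : Subset (suc n) → Carrier
    full C = ∏∈ C α * ∏∈ (∁ C) β * fromℤ (det (outs C v acc) ℤ.* det (outs C v acc))
    fs = tabulate (λ i → factor (α (suc i)) (β (suc i)) (v (suc i)))
    term : List (Vect _) → Subset n → Carrier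
    term bs C = ∏∈ C (α ∘ suc) * ∏∈ (∁ C) (β ∘ suc) *
                fromℤ (det (outs C (v ∘ suc) bs) ℤ.* det (outs C (v ∘ suc) bs))
    act-⋀ : ∀ a → act a (⋀ acc) ≡ ⋀ (cons? a acc)
    act-⋀ nothing  = ≡.refl
    act-⋀ (just a) = ≡.refl

-- The matrix-tree theorem relative to a realisation of the graph in a lattice.

module Trees where

  open import Data.Fin.Subset using (Subset; _∈_; _∉_; ∁; ∣_∣; _∪_; ⁅_⁆)
  open import Data.Integer.Base as ℤ using (ℤ; +_; _+_; _*_; 0ℤ; 1ℤ; -1ℤ)
  open import Data.Integer.Tactic.RingSolver using (solve-∀)
  open import Data.List.Membership.Propositional using () renaming (_∈_ to _∈ₗ_)
  open import Data.Nat.Base using (_<_)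
  open import Data.Product using (∃; _×_; _,_; proj₂)
  open import Relation.Binary.PropositionalEquality
    using (_≡_; _≢_; refl; cong; cong₂; sym; trans; subst; module ≡-Reasoning)
  open ≡-Reasoning
  open ExteriorAlgebra
  open Triangular
  open Complements
  open Graph

  private
    variable
      n : ℕ

  _⊖_ : Vect n → Vect n → Vect n
  (a ⊖ b) i = a i + -1ℤ * b i

  span-⊖ : ∀ {as : List (Vect n)} {a b} → Span as a → Span as b → Span as (a ⊖ b)
  span-⊖ p q = span-+ p (span-* -1ℤ q)

  chain : ∀ {as : List (Vect n)} a b c → Span as (a ⊖ b) → Span as (b ⊖ c) → Span as (a ⊖ c)
  chain a b c p q = span-cong (λ i → lemma (a i) (b i) (c i)) (span-+ p q)
    where
    lemma : ∀ a b c → (a + -1ℤ * b) + (b + -1ℤ * c) ≡ a + -1ℤ * c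
    lemma = solve-∀

  ⊖-self : ∀ {as : List (Vect n)} a → Span as (a ⊖ a)
  ⊖-self a = span-cong (λ i → lemma (a i)) span-0
    where
    lemma : ∀ a → 0ℤ ≡ a + -1ℤ * a
    lemma = solve-∀

  span-flip : ∀ {as : List (Vect n)} a b → Span as (a ⊖ b) → Span as (b ⊖ a)
  span-flip a b p = span-cong (λ i → lemma (a i) (b i)) (span-* -1ℤ p)
    where
    lemma : ∀ a b → -1ℤ * (a + -1ℤ * b) ≡ b + -1ℤ * a
    lemma = solve-∀

  ⟨⟩-⊖ : ∀ (f a b : Vect n) → ⟨ f , a ⊖ b ⟩ ≡ ⟨ f , a ⟩ + -1ℤ * ⟨ f , b ⟩
  ⟨⟩-⊖ {zero}  f a b = refl
  ⟨⟩-⊖ {suc n} f a b = trans (cong (λ z → f zero * (a zero + -1ℤ * b zero) + z) (⟨⟩-⊖ (f ∘ suc) (a ∘ suc) (b ∘ suc)))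
    (lemma (f zero) (a zero) (b zero) _ _)
    where
    lemma : ∀ f a b x y → f * (a + -1ℤ * b) + (x + -1ℤ * y) ≡ (f * a + x) + -1ℤ * (f * b + y)
    lemma = solve-∀

  unit² : ∀ {i j} → i * j ≡ 1ℤ → j * j ≡ 1ℤ
  unit² {i} {j} ij≡1 = square j
    (ℕₚ.m*n≡1⇒n≡1 ℤ.∣ i ∣ ℤ.∣ j ∣ (trans (sym (ℤₚ.abs-* i j)) (cong ℤ.∣_∣ ij≡1)))
    where
    square : ∀ j → ℤ.∣ j ∣ ≡ 1 → j * j ≡ 1ℤ
    square (+ .1)     refl = refl
    square ℤ.-[1+ 0 ] refl = refl

  det²-unique : {as bs : List (Vect n)} → All (Span as) bs → All (Span bs) as →
                length as ≡ length bs → det bs ≢ 0ℤ → det as * det as ≡ det bs * det bs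
  det²-unique {as = as} {bs} as⊇ bs⊇ len det≢0
    with det-span as⊇ (sym len) | det-span bs⊇ len
  ... | c , B≡cA | c′ , A≡c′B = begin
    det as * det as                       ≡⟨ cong₂ _*_ A≡c′B A≡c′B ⟩
    (c′ * det bs) * (c′ * det bs)         ≡⟨ rearrange c′ (det bs) ⟩
    (c′ * c′) * (det bs * det bs)         ≡⟨ cong (_* (det bs * det bs)) (unit² {c} {c′} cc′≡1) ⟩
    1ℤ * (det bs * det bs)                ≡⟨ ℤₚ.*-identityˡ _ ⟩
    det bs * det bs                       ∎
    where
    rearrange : ∀ c d → (c * d) * (c * d) ≡ (c * c) * (d * d)
    rearrange = solve-∀
    cc′≡1 : c * c′ ≡ 1ℤ
    cc′≡1 = ℤₚ.*-cancelʳ-≡ (c * c′) 1ℤ (det bs) ⦃ ℤ.≢-nonZero det≢0 ⦄ (begin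
      c * c′ * det bs     ≡⟨ ℤₚ.*-assoc c c′ (det bs) ⟩
      c * (c′ * det bs)   ≡⟨ cong (c *_) A≡c′B ⟨
      c * det as          ≡⟨ B≡cA ⟨
      det bs              ≡⟨ ℤₚ.*-identityˡ (det bs) ⟨
      1ℤ * det bs         ∎)

  private
    first : ∀ n → ℕ.NonZero n → Fin n
    first (suc n) _ = zero

    first-least : ∀ n (nz : ℕ.NonZero n) (v : Fin n) → ¬ (v Fin.< first n nz)
    first-least (suc n) nz v = λ ()

  origin : (G : Graph) → Fin (#V G)
  origin G = first (#V G) (nonEmpty G)

  -- This is what makes the rows `δ v ⊖ δ o` lower triangular.
  origin-least : ∀ G v → ¬ (v Fin.< origin G)
  origin-least G = first-least (#V G) (nonEmpty G)

  -- The extra vectors complete the edge vectors of a spanning tree to N vectors, and basis spans the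
  -- same lattice as the extra vectors together with all differences φ u ⊖ φ v.
  record Realisation (G : Graph) (N : ℕ) : Set where
    field
      φ      : Fin (#V G) → Vect N
      extra  : List (Vect N)
      basis  : List (Vect N)
      length-basis : length basis ≡ N
      length-extra : length extra ℕ.+ #V G ≡ suc N
      det-basis≢0  : det basis ≢ 0ℤ
      basis-spanned : ∀ {as} → (∀ {a} → a ∈ₗ extra → a ∈ₗ as) → (∀ u v → Span as (φ u ⊖ φ v)) →
                      All (Span as) basis
      extra-spanned : All (Span basis) extra
      φ-spanned     : ∀ u v → Span basis (φ u ⊖ φ v)
      -- A multiple of any potential on the vertices is, up to a constant, a
      -- linear functional vanishing on the extra vectors.
      functional : (g : Fin (#V G) → ℤ) → ∃ λ f → ∃ λ k → ∃ λ b →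
                   k ≢ 0ℤ × (∀ v → ⟨ f , φ v ⟩ ≡ k * g v + b) × All (λ x → ⟨ f , x ⟩ ≡ 0ℤ) extra

  module MatrixTree {G : Graph} {N : ℕ} (realisation : Realisation G N) where
    open Realisation realisation

    tail : Fin (#E G) → Fin (#V G)
    tail e = root G (half G e)

    head : Fin (#E G) → Fin (#V G)
    head e = root G (ι G (half G e))

    edgeVector : Fin (#E G) → Vect N
    edgeVector e = φ (tail e) ⊖ φ (head e)

    cotree : Subset (#E G) → List (Vect N)
    cotree C = outs C (just ∘ edgeVector) extra

    half-ends : ∀ h → let e = edge G h in
      (root G h ≡ tail e × root G (ι G h) ≡ head e) ⊎
      (root G h ≡ head e × root G (ι G h) ≡ tail e)
    half-ends h with edge-orb G h (half G (edge G h)) (sym (edge-half G (edge G h)))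
    ... | inj₁ h≡  = inj₁ (cong (root G) h≡ , cong (root G ∘ ι G) h≡)
    ... | inj₂ h≡ι = inj₂ (cong (root G) h≡ι , cong (root G) (trans (cong (ι G) h≡ι) (ι-invol G _)))

    private
      step : ∀ {as} h → Span as (edgeVector (edge G h)) → Span as (φ (root G h) ⊖ φ (root G (ι G h)))
      step {as} h p with half-ends h
      ... | inj₁ (r , r′) = subst (Span as) (sym (cong₂ (λ u v → φ u ⊖ φ v) r r′)) p
      ... | inj₂ (r , r′) = subst (Span as) (sym (cong₂ (λ u v → φ u ⊖ φ v) r r′)) (span-flip (φ (tail (edge G h))) (φ (head (edge G h))) p)

      unstep : ∀ {as} h → Span as (φ (root G (ι G h)) ⊖ φ (root G h)) → Span as (edgeVector (edge G h))
      unstep {as} h p with half-ends h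
      ... | inj₁ (r , r′) = subst (Span as) (cong₂ (λ u v → φ u ⊖ φ v) r r′) (span-flip (φ (root G (ι G h))) (φ (root G h)) p)
      ... | inj₂ (r , r′) = subst (Span as) (cong₂ (λ u v → φ u ⊖ φ v) r′ r) p

      walk-span : ∀ {C as} → (∀ {e} → e ∉ C → Span as (edgeVector e)) →
                  ∀ hs {u v} → IsWalk (G ∖ C) u hs v → Span as (φ u ⊖ φ v)
      walk-span gen []       {u} refl = ⊖-self (φ u)
      walk-span gen (h ∷ hs) {v = v} (refl , h∈ , w) = chain (φ (root G h)) (φ (root G (ι G h))) (φ v) (step h (gen (x∈∁p⇒x∉p h∈))) (walk-span gen hs w)

      gens : ∀ C {e} → e ∉ C → Span (cotree C) (edgeVector e)
      gens C e∉ = span-∈ (∈-outs C e∉ refl)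

      length-cotree : ∀ C → length (cotree C) ℕ.+ ∣ C ∣ ≡ #E G ℕ.+ length extra
      length-cotree C = trans (length-outs C (just ∘ edgeVector) extra (λ _ → refl))
                              (cong (ℕ._+ length extra) (sizes-just edgeVector))

      connected⇒spans : ∀ C → Connected (G ∖ C) → ∀ u v → Span (cotree C) (φ u ⊖ φ v)
      connected⇒spans C (_ , joined) u v with joined u v ∈⊤ ∈⊤
      ... | hs , w = walk-span (gens C) hs w

    det²-connected : ∀ C → Connected (G ∖ C) → length (cotree C) ≡ N →
                     det (cotree C) * det (cotree C) ≡ det basis * det basis
    det²-connected C conn len = det²-unique
      (basis-spanned (acc⊆outs C) (connected⇒spans C conn))
      (All-outs C extra-spanned (λ { _ refl → φ-spanned _ _ }))
      (trans len (sym length-basis)) det-basis≢0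

    -- The vector of an edge on a cycle is spanned by the vectors of the remaining edges, so that
    -- fewer than N vectors would span basis.
    connected⇒acyclic : ∀ C → Connected (G ∖ C) → length (cotree C) ≡ N → Acyclic (G ∖ C)
    connected⇒acyclic C conn len v []       (≢[] , _) = contradiction refl ≢[]
    connected⇒acyclic C conn len v (h ∷ hs) (_ , (refl , h∈ , w) , _ , (e∉ ∷ _)) =
      det-basis≢0 (det-span-short {as = cotree C′}
        (basis-spanned (acc⊆outs C′) λ u v → let (ks , w′) = proj₂ conn u v ∈⊤ ∈⊤ in walk-span gen ks w′)
        (subst (length (cotree C′) <_) (trans len (sym length-basis)) shorter))
      where
      e = edge G h
      C′ = C ∪ ⁅ e ⁆
      avoid : ∀ hs {u v} → All (e ≢_) (List.map (edge G) hs) → IsWalk (G ∖ C) u hs v → IsWalk (G ∖ C′) u hs v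
      avoid []       _          w              = w
      avoid (k ∷ ks) (e≢ ∷ e≢s) (r , k∈ , w) = r , x∉p⇒x∈∁p (λ k∈C′ → case (x∈p∪q⁻ C ⁅ e ⁆ k∈C′)) , avoid ks e≢s w
        where
        case : edge G k ∈ C ⊎ edge G k ∈ ⁅ e ⁆ → _
        case (inj₁ k∈C) = x∈∁p⇒x∉p k∈ k∈C
        case (inj₂ k∈e) = e≢ (sym (x∈⁅y⁆⇒x≡y e k∈e))
      closing : Span (cotree C′) (edgeVector e)
      closing = unstep h (walk-span (gens C′) hs (avoid hs e∉ w))
      gen : ∀ {e′} → e′ ∉ C → Span (cotree C′) (edgeVector e′)
      gen {e′} e′∉ with e′ Finₚ.≟ e
      ... | yes refl = closing
      ... | no e′≢   = gens C′ (λ e′∈ → case (x∈p∪q⁻ C ⁅ e ⁆ e′∈))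
        where
        case : e′ ∈ C ⊎ e′ ∈ ⁅ e ⁆ → _
        case (inj₁ e′∈C) = e′∉ e′∈C
        case (inj₂ e′∈e) = e′≢ (x∈⁅y⁆⇒x≡y e e′∈e)
      shorter : length (cotree C′) < length (cotree C)
      shorter = ℕₚ.+-cancelʳ-< ∣ C ∣ _ _ (subst (length (cotree C′) ℕ.+ ∣ C ∣ <_)
        (trans (length-cotree C′) (sym (length-cotree C)))
        (ℕₚ.+-monoʳ-< (length (cotree C′))
          (p⊂q⇒∣p∣<∣q∣ (p⊆p∪q ⁅ e ⁆ , e , x∈p∪q⁺ (inj₂ (x∈⁅x⁆ e)) , x∈∁p⇒x∉p h∈))))

    -- For vertices u and v in different components, the indicator function of the component of u is
    -- constant along the kept edges. The corresponding functional kills `cotree C` but has the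
    -- value k ≠ 0 on `φ u ⊖ φ v`.
    det-disconnected : ∀ C → ¬ Connected (G ∖ C) → det (cotree C) ≡ 0ℤ
    det-disconnected C ¬conn = conclude
      where
      module _ (u v : Fin (#V G)) (¬joined : ¬ Joined (G ∖ C) u v) where
        g : Fin (#V G) → ℤ
        g x with joined? (G ∖ C) u x
        ... | yes _ = 1ℤ
        ... | no  _ = 0ℤ
        snoc : ∀ hs {u x y} → IsWalk (G ∖ C) u hs x → ∀ h → root G h ≡ x → edge G h ∈ ∁ C →
               root G (ι G h) ≡ y → IsWalk (G ∖ C) u (hs List.++ h ∷ []) y
        snoc []       refl         h r e∈ r′ = r , e∈ , r′
        snoc (k ∷ ks) (r₀ , e , w) h r e∈ r′ = r₀ , e , snoc ks w h r e∈ r′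
        g-edge : ∀ e → e ∉ C → g (tail e) ≡ g (head e)
        g-edge e e∉ with joined? (G ∖ C) u (tail e) | joined? (G ∖ C) u (head e)
        ... | yes _ | yes _ = refl
        ... | no  _ | no  _ = refl
        ... | yes (hs , w) | no ¬j = contradiction
          (_ , snoc hs w (half G e) refl (subst (_∈ ∁ C) (sym (edge-half G e)) (x∉p⇒x∈∁p e∉)) refl) ¬j
        ... | no ¬j | yes (hs , w) = contradiction
          (_ , snoc hs w (ι G (half G e)) refl
                 (subst (_∈ ∁ C) (sym (trans (edge-ι G (half G e)) (edge-half G e))) (x∉p⇒x∈∁p e∉))
                 (cong (root G) (ι-invol G (half G e)))) ¬j
        gu≡1 : g u ≡ 1ℤ
        gu≡1 with joined? (G ∖ C) u u
        ... | yes _ = refl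
        ... | no ¬j = contradiction ([] , refl) ¬j
        gv≡0 : g v ≡ 0ℤ
        gv≡0 with joined? (G ∖ C) u v
        ... | yes j = contradiction j ¬joined
        ... | no _  = refl
        separated : det (cotree C) ≡ 0ℤ
        separated with functional g
        ... | f , k , b , k≢0 , fφ , fx = ℤₚ.*-cancelˡ-≡ k _ _ ⦃ ℤ.≢-nonZero k≢0 ⦄ (begin
          k * det (cotree C)                      ≡⟨ cong (_* det (cotree C)) fuv ⟨
          ⟨ f , φ u ⊖ φ v ⟩ * det (cotree C)      ≡⟨ det-annihilated f (φ u ⊖ φ v) {cotree C} killed ⟩
          0ℤ                                      ≡⟨ ℤₚ.*-zeroʳ k ⟨
          k * 0ℤ                                  ∎)
          where
          difference : ∀ x y → ⟨ f , φ x ⊖ φ y ⟩ ≡ k * (g x + -1ℤ * g y)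
          difference x y = trans (⟨⟩-⊖ f (φ x) (φ y)) (trans (cong₂ (λ s t → s + -1ℤ * t) (fφ x) (fφ y))
                                                           (lemma k (g x) (g y) b))
            where
            lemma : ∀ k x y b → (k * x + b) + -1ℤ * (k * y + b) ≡ k * (x + -1ℤ * y)
            lemma = solve-∀
          fuv : ⟨ f , φ u ⊖ φ v ⟩ ≡ k
          fuv = trans (difference u v) (trans (cong₂ (λ s t → k * (s + -1ℤ * t)) gu≡1 gv≡0) (ℤₚ.*-identityʳ k))
          killed : All (λ a → ⟨ f , a ⟩ ≡ 0ℤ) (cotree C)
          killed = All-outs C fx λ { {e} e∉ refl → trans (difference (tail e) (head e))
            (trans (cong (λ s → k * (s + -1ℤ * g (head e))) (g-edge e e∉)) (lemma k (g (head e)))) }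
            where
            lemma : ∀ k x → k * (x + -1ℤ * x) ≡ 0ℤ
            lemma = solve-∀
      conclude : det (cotree C) ≡ 0ℤ
      conclude with Finₚ.all? (λ u → Finₚ.all? λ v → joined? (G ∖ C) u v)
      ... | yes all = contradiction ((origin G , ∈⊤) , λ u v _ _ → all u v) ¬conn
      ... | no ¬all with Finₚ.¬∀⟶∃¬ _ _ (λ u → Finₚ.all? λ v → joined? (G ∖ C) u v) ¬all
      ...   | u , ¬all′ with Finₚ.¬∀⟶∃¬ _ _ (joined? (G ∖ C) u) ¬all′
      ...     | v , ¬joined = separated u v ¬joined

    IsCotree : Subset (#E G) → Set
    IsCotree C = (+ ∣ C ∣ ≡ genus G) × IsTree (G ∖ C)

    private
      genus⇒length : ∀ C → + ∣ C ∣ ≡ genus G → length (cotree C) ≡ N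
      genus⇒length C eq = ℕₚ.suc-injective (ℤₚ.+-injective (begin
        1ℤ + + length (cotree C)
          ≡⟨ lemma₁ (+ length (cotree C)) (+ ∣ C ∣) ⟩
        + length (cotree C) + + ∣ C ∣ + (1ℤ + -1ℤ * + ∣ C ∣)
          ≡⟨ cong₂ (λ s t → s + (1ℤ + -1ℤ * t)) (cong +_ (length-cotree C)) eq ⟩
        (+ #E G + + length extra) + (1ℤ + -1ℤ * genus G)
          ≡⟨ lemma₂ (+ #E G) (+ length extra) (+ #V G) ⟩
        + length extra + + #V G
          ≡⟨ cong +_ length-extra ⟩
        + suc N ∎))
        where
        lemma₁ : ∀ a c → 1ℤ + a ≡ a + c + (1ℤ + -1ℤ * c)
        lemma₁ = solve-∀
        lemma₂ : ∀ e x v → (e + x) + (1ℤ + -1ℤ * (e ℤ.- v + 1ℤ)) ≡ x + v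
        lemma₂ = solve-∀

      length⇒genus : ∀ C → length (cotree C) ≡ N → + ∣ C ∣ ≡ genus G
      length⇒genus C len = begin
        + ∣ C ∣
          ≡⟨ lemma₁ (+ N) (+ ∣ C ∣) ⟩
        (+ N + + ∣ C ∣) + 1ℤ + -1ℤ * (1ℤ + + N)
          ≡⟨ cong₂ (λ s t → s + 1ℤ + -1ℤ * t)
               (cong +_ (trans (cong (ℕ._+ ∣ C ∣) (sym len)) (length-cotree C))) (cong +_ (sym length-extra)) ⟩
        (+ #E G + + length extra) + 1ℤ + -1ℤ * (+ length extra + + #V G)
          ≡⟨ lemma₂ (+ #E G) (+ length extra) (+ #V G) ⟩
        genus G ∎
        where
        lemma₁ : ∀ a c → c ≡ (a + c) + 1ℤ + -1ℤ * (1ℤ + a)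
        lemma₁ = solve-∀
        lemma₂ : ∀ e x v → (e + x) + 1ℤ + -1ℤ * (x + v) ≡ e ℤ.- v + 1ℤ
        lemma₂ = solve-∀

    det²-cotree : ∀ C → IsCotree C → det (cotree C) * det (cotree C) ≡ det basis * det basis
    det²-cotree C (eq , (conn , _)) = det²-connected C conn (genus⇒length C eq)

    -- Acyclicity needs no case of its own: with the right number of vectors it follows from
    -- connectedness, so only the length or the connectedness can fail.
    det-¬cotree : ∀ C → ¬ IsCotree C → det (cotree C) ≡ 0ℤ
    det-¬cotree C ¬cotree with length (cotree C) ℕₚ.≟ N | connected? (G ∖ C)
    ... | no len≢ | _       = det-length (cotree C) len≢
    ... | yes len | no ¬conn = det-disconnected C ¬conn
    ... | yes len | yes conn =
      contradiction (length⇒genus C len , conn , connected⇒acyclic C conn len) ¬cotree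

    size-cotree : ∀ C → IsCotree C → suc ∣ ∁ C ∣ ≡ #V G
    size-cotree C (eq , _) = ℕₚ.+-cancelˡ-≡ (length extra) _ _ (begin
      length extra ℕ.+ suc ∣ ∁ C ∣    ≡⟨ ℕₚ.+-suc (length extra) ∣ ∁ C ∣ ⟩
      suc (length extra ℕ.+ ∣ ∁ C ∣)  ≡⟨ cong suc (ℕₚ.+-cancelʳ-≡ ∣ C ∣ _ _ (begin
          length extra ℕ.+ ∣ ∁ C ∣ ℕ.+ ∣ C ∣     ≡⟨ ℕₚ.+-assoc (length extra) ∣ ∁ C ∣ ∣ C ∣ ⟩
          length extra ℕ.+ (∣ ∁ C ∣ ℕ.+ ∣ C ∣)   ≡⟨ cong (length extra ℕ.+_) (∣∁p∣+∣p∣≡n C) ⟩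
          length extra ℕ.+ #E G                  ≡⟨ ℕₚ.+-comm (length extra) (#E G) ⟩
          #E G ℕ.+ length extra                  ≡⟨ length-cotree C ⟨
          length (cotree C) ℕ.+ ∣ C ∣            ≡⟨ cong (ℕ._+ ∣ C ∣) (genus⇒length C eq) ⟩
          N ℕ.+ ∣ C ∣                            ∎)) ⟩
      suc N                           ≡⟨ length-extra ⟨
      length extra ℕ.+ #V G           ∎)
      where
      open import Data.Fin.Subset.Properties using (∣∁p∣≡n∸∣p∣; ∣p∣≤n)
      ∣∁p∣+∣p∣≡n : ∀ {m} (p : Subset m) → ∣ ∁ p ∣ ℕ.+ ∣ p ∣ ≡ m
      ∣∁p∣+∣p∣≡n p = trans (cong (ℕ._+ ∣ p ∣) (∣∁p∣≡n∸∣p∣ p)) (ℕₚ.m∸n+n≡m (∣p∣≤n p))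

-- Fibres of total degree two, and walks up to joinedness.

module Fibres where

  open import Data.Fin.Subset using (_∈_)
  open import Data.List.Membership.Propositional using () renaming (_∈_ to _∈ₗ_)
  open import Data.List.Membership.Propositional.Properties using (∈-allFin; ∈-concatMap⁺)
  open import Data.List.Membership.Propositional.Properties.WithK using (unique∧set⇒bag)
  open import Data.List.Relation.Binary.BagAndSetEquality using (∼bag⇒↭)
  open import Data.List.Relation.Binary.Permutation.Propositional using (_↭_)
  open import Data.List.Relation.Unary.Any as Any using (Any; here; there)
  open import Data.List.Relation.Unary.Unique.Propositional using (Unique)
  open import Data.Nat.Base using (_<_)
  open import Data.Product using (∃; _×_; _,_)
  open import Relation.Binary.PropositionalEquality using (_≡_; _≢_; refl; cong; sym; trans; subst)

  private
    variable
      p : Level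
      m n : ℕ

  -- The only ways for positive degrees to add up to 2: the dilated and the undilated case of a
  -- vertex or a half-edge.
  data Fibre {m} (P : Pred (Fin m) p) (f : Fin m → ℕ) : Set p where
    single : ∀ x → P x → f x ≡ 2 → (∀ {y} → P y → y ≡ x) → Fibre P f
    double : ∀ x y → x ≢ y → P x → P y → f x ≡ 1 → f y ≡ 1 → (∀ {z} → P z → z ≡ x ⊎ z ≡ y) → Fibre P f

  private
    Σℕ≡0⇒¬ : {P : Pred (Fin n) p} (P? : Decidable P) (f : Fin n → ℕ) → (∀ i → 0 < f i) →
             Σℕ P? f ≡ 0 → ∀ {i} → ¬ P i
    Σℕ≡0⇒¬ P? f f>0 eq {zero} pi with P? zero
    ... | yes _ = ℕₚ.<⇒≢ (f>0 zero) (sym (ℕₚ.m+n≡0⇒m≡0 (f zero) eq))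
    ... | no ¬p = ¬p pi
    Σℕ≡0⇒¬ P? f f>0 eq {suc i} pi with P? zero
    ... | yes _ = Σℕ≡0⇒¬ (P? ∘ suc) (f ∘ suc) (f>0 ∘ suc) (ℕₚ.m+n≡0⇒n≡0 (f zero) eq) pi
    ... | no _  = Σℕ≡0⇒¬ (P? ∘ suc) (f ∘ suc) (f>0 ∘ suc) eq pi

    Σℕ≡1⇒unique : {P : Pred (Fin n) p} (P? : Decidable P) (f : Fin n → ℕ) → (∀ i → 0 < f i) →
                  Σℕ P? f ≡ 1 → ∃ λ x → P x × f x ≡ 1 × (∀ {y} → P y → y ≡ x)
    Σℕ≡1⇒unique {n = suc n} P? f f>0 eq with P? zero
    ... | no ¬p₀ with Σℕ≡1⇒unique (P? ∘ suc) (f ∘ suc) (f>0 ∘ suc) eq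
    ...   | x , px , fx , only = suc x , px , fx , λ { {zero} p → contradiction p ¬p₀ ; {suc y} p → cong suc (only p) }
    Σℕ≡1⇒unique {n = suc n} P? f f>0 eq | yes p₀ with f zero in f₀ | f>0 zero
    ... | suc zero | _ = zero , p₀ , f₀ , λ
      { {zero} _ → refl
      ; {suc y} p → contradiction p (Σℕ≡0⇒¬ (P? ∘ suc) (f ∘ suc) (f>0 ∘ suc) (ℕₚ.suc-injective eq)) }

  fibre : {P : Pred (Fin n) p} (P? : Decidable P) (f : Fin n → ℕ) → (∀ i → 0 < f i) →
          Σℕ P? f ≡ 2 → Fibre P f
  fibre {n = suc n} P? f f>0 eq with P? zero
  ... | no ¬p₀ with fibre (P? ∘ suc) (f ∘ suc) (f>0 ∘ suc) eq
  ...   | single x px fx only = single (suc x) px fx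
          λ { {zero} p → contradiction p ¬p₀ ; {suc y} p → cong suc (only p) }
  ...   | double x y x≢y px py fx fy only = double (suc x) (suc y) (x≢y ∘ Finₚ.suc-injective) px py fx fy
          λ { {zero} p → contradiction p ¬p₀ ; {suc z} p → Sum.map (cong suc) (cong suc) (only p) }
  fibre {n = suc n} P? f f>0 eq | yes p₀ with f zero in f₀ | f>0 zero
  ... | suc (suc zero) | _ = single zero p₀ f₀ λ
    { {zero} _ → refl
    ; {suc y} p → contradiction p (Σℕ≡0⇒¬ (P? ∘ suc) (f ∘ suc) (f>0 ∘ suc)
                                    (ℕₚ.suc-injective (ℕₚ.suc-injective eq))) }
  ... | suc zero | _ with Σℕ≡1⇒unique (P? ∘ suc) (f ∘ suc) (f>0 ∘ suc) (ℕₚ.suc-injective eq)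
  ...   | x , px , fx , only = double zero (suc x) (λ ()) p₀ px f₀ fx
          λ { {zero} _ → inj₁ refl ; {suc z} p → inj₂ (cong suc (only p)) }

  elements : {P : Pred (Fin n) p} {f : Fin n → ℕ} → Fibre P f → List (Fin n)
  elements (single x _ _ _)         = x ∷ []
  elements (double x y _ _ _ _ _ _) = x ∷ y ∷ []

  elements-unique : {P : Pred (Fin n) p} {f : Fin n → ℕ} (F : Fibre P f) → Unique (elements F)
  elements-unique (single x _ _ _)           = [] ∷ []
  elements-unique (double x y x≢y _ _ _ _ _) = (x≢y ∷ []) ∷ [] ∷ []

  ∈-elements⁺ : {P : Pred (Fin n) p} {f : Fin n → ℕ} (F : Fibre P f) {z : Fin n} → P z → z ∈ₗ elements F
  ∈-elements⁺ (single x _ _ only) pz = here (only pz)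
  ∈-elements⁺ (double x y _ _ _ _ _ only) pz with only pz
  ... | inj₁ z≡x = here z≡x
  ... | inj₂ z≡y = there (here z≡y)

  ∈-elements⁻ : {P : Pred (Fin n) p} {f : Fin n → ℕ} (F : Fibre P f) {z : Fin n} → z ∈ₗ elements F → P z
  ∈-elements⁻ (single x px _ _)         (here refl)         = px
  ∈-elements⁻ (double x y _ px py _ _ _) (here refl)         = px
  ∈-elements⁻ (double x y _ px py _ _ _) (there (here refl)) = py

  -- Regroups a product over the cover by the fibres of the projection. Both lists are free of
  -- repetitions and have the same members.
  allFin-↭ : (π : Fin m → Fin n) (L : Fin n → List (Fin m)) → (∀ i → Unique (L i)) →
             (∀ {i x} → x ∈ₗ L i → π x ≡ i) → (∀ x → x ∈ₗ L (π x)) →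
             allFin m ↭ concatMap L (allFin n)
  allFin-↭ {m} {n} π L unique sound complete = ∼bag⇒↭ (unique∧set⇒bag (Uniqueₚ.allFin⁺ m)
    (Uniqueₚ.concat⁺ (Allₚ.map⁺ (All.tabulate λ {i} _ → unique i))
      (AllPairsₚ.map⁺ {f = L} (AllPairs.map (λ i≢j {_} (x∈ , x∈′) → i≢j (trans (sym (sound x∈)) (sound x∈′))) (Uniqueₚ.allFin⁺ n))))
    λ {x} → mk⇔ (λ _ → ∈-concatMap⁺ L (Any.map (λ { refl → complete x }) (∈-allFin (π x)))) (λ _ → ∈-allFin x))

  module _ {G : Graph} {S : Subgraph G} where
    open Graph G
    open Subgraph S using (edges)

    walk-++ : ∀ {u v w} hs {ks} → IsWalk S u hs v → IsWalk S v ks w → IsWalk S u (hs List.++ ks) w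
    walk-++ []       refl         q = q
    walk-++ (h ∷ hs) (r , e∈ , p) q = r , e∈ , walk-++ hs p q

    joined-refl : ∀ {u} → Joined S u u
    joined-refl = [] , refl

    joined-trans : ∀ {u v w} → Joined S u v → Joined S v w → Joined S u w
    joined-trans (hs , p) (ks , q) = hs List.++ ks , walk-++ hs p q

    joined-edge : ∀ h → edge h ∈ edges → Joined S (root h) (root (ι h))
    joined-edge h e∈ = h ∷ [] , refl , e∈ , refl

    joined-sym : ∀ {u v} → Joined S u v → Joined S v u
    joined-sym (hs , p) = go hs p
      where
      go : ∀ hs {u v} → IsWalk S u hs v → Joined S v u
      go []       refl            = joined-refl
      go (h ∷ hs) (refl , e∈ , p) = joined-trans (go hs p)
        (ι h ∷ [] , refl , subst (_∈ edges) (sym (edge-ι h)) e∈ , cong root (ι-invol h))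

  joined-mono : {G : Graph} {S T : Subgraph G} →
                (∀ {e} → e ∈ Subgraph.edges S → e ∈ Subgraph.edges T) →
                ∀ {u v} → Joined S u v → Joined T u v
  joined-mono {G} {S} {T} S⊆T (hs , p) = hs , go hs p
    where
    go : ∀ hs {u v} → IsWalk S u hs v → IsWalk T u hs v
    go []       p            = p
    go (h ∷ hs) (r , e∈ , p) = r , S⊆T e∈ , go hs p

-- Counting components by their least vertices.

module Counting where

  open import Data.Fin.Subset using (_∈_; ∣_∣)
  open import Data.Integer.Base using (ℤ; +_; _*_; 1ℤ)
  open import Data.Integer.Tactic.RingSolver using (solve-∀)
  open import Data.Product using (∃; _×_; _,_; proj₁; proj₂)
  open import Relation.Binary.PropositionalEquality using (_≡_; refl; cong; sym; trans; subst)
  open Triangular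
  open Trees
  open Fibres

  private
    variable
      p q r : Level
      m n : ℕ

  count : {P : Pred (Fin n) p} → Decidable P → ℕ
  count P? = ∣ ⟦ P? ⟧ ∣

  -- The injection is defined only where `P` holds. In the induction the value at index 0 is removed
  -- from `Q`, which injectivity permits and which lowers the count.
  count-≤ : {P : Pred (Fin m) p} {Q : Pred (Fin n) q} (P? : Decidable P) (Q? : Decidable Q)
            (f : ∀ {i} → P i → Fin n) → (∀ {i} (pi : P i) → Q (f pi)) →
            (∀ {i j} (pi : P i) (pj : P j) → f pi ≡ f pj → i ≡ j) → count P? ℕ.≤ count Q?
  count-≤ {m = zero}  P? Q? f f∈ inj = z≤n
  count-≤ {m = suc m} P? Q? f f∈ inj with P? zero
  ... | no _   = count-≤ (P? ∘ suc) Q? f f∈ (λ pi pj → Finₚ.suc-injective ∘ inj pi pj)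
  ... | yes p₀ = ℕₚ.≤-trans
    (s≤s (count-≤ (P? ∘ suc) Q′? f (λ pi → f∈ pi , λ eq → contradiction (inj pi p₀ eq) λ ())
           (λ pi pj → Finₚ.suc-injective ∘ inj pi pj)))
    (p⊂q⇒∣p∣<∣q∣ ((λ i∈ → ∈⟦⟧⁺ Q? (proj₁ (∈⟦⟧⁻ Q′? i∈))) , f p₀ , ∈⟦⟧⁺ Q? (f∈ p₀) ,
                   λ f∈′ → proj₂ (∈⟦⟧⁻ Q′? f∈′) refl))
    where
    Q′? = λ j → Q? j ×-dec ¬? (j Finₚ.≟ f p₀)

  count-split : {P : Pred (Fin n) p} {Q : Pred (Fin n) q} {R : Pred (Fin n) r}
                (P? : Decidable P) (Q? : Decidable Q) (R? : Decidable R) →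
                (∀ {i} → P i → Q i ⊎ R i) → (∀ {i} → Q i → P i) → (∀ {i} → R i → P i) →
                (∀ {i} → Q i → ¬ R i) → count P? ≡ count Q? ℕ.+ count R?
  count-split {n = zero}  P? Q? R? P⇒ Q⇒ R⇒ disj = refl
  count-split {n = suc n} P? Q? R? P⇒ Q⇒ R⇒ disj
    with P? zero | Q? zero | R? zero | count-split (P? ∘ suc) (Q? ∘ suc) (R? ∘ suc) P⇒ Q⇒ R⇒ disj
  ... | yes _ | yes q₀ | yes r₀ | _  = contradiction r₀ (disj q₀)
  ... | yes _ | yes _  | no _   | eq = cong suc eq
  ... | yes _ | no _   | yes _  | eq = trans (cong suc eq) (sym (ℕₚ.+-suc _ _))
  ... | yes p | no ¬q  | no ¬r  | _  = contradiction (P⇒ p) λ { (inj₁ q) → ¬q q ; (inj₂ r) → ¬r r }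
  ... | no ¬p | yes q  | _      | _  = contradiction (Q⇒ q) ¬p
  ... | no ¬p | no _   | yes r  | _  = contradiction (R⇒ r) ¬p
  ... | no _  | no _   | no _   | eq = eq

  ∏-doubling² : {P : Pred (Fin n) p} (P? : Decidable P) {f : Fin n → ℤ} →
                (∀ i → f i ≡ (if does (P? i) then + 2 else 1ℤ)) → ∏ f * ∏ f ≡ + (4 ℕ.^ count P?)
  ∏-doubling² {n = zero}  P? f≗ = refl
  ∏-doubling² {n = suc n} P? {f} f≗ = trans (square (f zero) (∏ (f ∘ suc)))
    (trans (cong (f zero * f zero *_) (∏-doubling² (P? ∘ suc) (f≗ ∘ suc))) (head (f≗ zero)))
    where
    square : ∀ a b → (a * b) * (a * b) ≡ (a * a) * (b * b)
    square = solve-∀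
    head : f zero ≡ (if does (P? zero) then + 2 else 1ℤ) →
           f zero * f zero * + (4 ℕ.^ count (P? ∘ suc)) ≡ + (4 ℕ.^ count P?)
    head eq with P? zero
    ... | yes _ rewrite eq = sym (ℤₚ.pos-* 4 (4 ℕ.^ count (P? ∘ suc)))
    ... | no _  rewrite eq = ℤₚ.*-identityˡ _

  least : {P : Pred (Fin n) p} (P? : Decidable P) → ∃ P → ∃ λ i → P i × (∀ {j} → P j → i Fin.≤ j)
  least {n = suc n} P? (i , pi) with P? zero
  ... | yes p₀ = zero , p₀ , λ _ → z≤n
  ... | no ¬p₀ with i
  ...   | zero  = contradiction pi ¬p₀
  ...   | suc i with least (P? ∘ suc) (i , pi)
  ...     | k , pk , minimal = suc k , pk , λ { {zero} p₀ → contradiction p₀ ¬p₀ ; {suc j} pj → s≤s (minimal pj) }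

  module _ {G : Graph} (S : Subgraph G) where
    open Graph G
    open Subgraph S

    private
      leastJoined : ∀ v → ∃ λ u → Joined S v u × (∀ {w} → Joined S v w → u Fin.≤ w)
      leastJoined v = least (joined? S v) (v , joined-refl)

    -- The least choice has two uses: it singles out the vertices counted by `#components`, and it
    -- makes the vectors `δ v ⊖ δ (rep v)` lower triangular.
    rep : Fin #V → Fin #V
    rep v = proj₁ (leastJoined v)

    joined-rep : ∀ v → Joined S v (rep v)
    joined-rep v = proj₁ (proj₂ (leastJoined v))

    rep-≤ : ∀ {v u} → Joined S v u → rep v Fin.≤ u
    rep-≤ {v} = proj₂ (proj₂ (leastJoined v))

    rep-cong : ∀ {u v} → Joined S u v → rep u ≡ rep v
    rep-cong {u} {v} j = Finₚ.≤-antisym (rep-≤ (joined-trans j (joined-rep v)))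
                                        (rep-≤ (joined-trans (joined-sym j) (joined-rep u)))

    joined-verts : ∀ {u v} → u ∈ verts → Joined S u v → v ∈ verts
    joined-verts u∈ (hs , w) = go hs u∈ w
      where
      go : ∀ hs {u v} → u ∈ verts → IsWalk S u hs v → v ∈ verts
      go []       u∈ refl            = u∈
      go (h ∷ hs) u∈ (refl , h∈ , w) = go hs (closed (ι h) (subst (_∈ edges) (sym (edge-ι h)) h∈)) w

    IsRep : Fin #V → Set
    IsRep v = v ∈ verts × (∀ u → u ∈ verts → Joined S u v → v Fin.≤ u)

    isRep-rep : ∀ {v} → v ∈ verts → IsRep (rep v)
    isRep-rep {v} v∈ = joined-verts v∈ (joined-rep v) , λ u _ j → rep-≤ (joined-trans (joined-rep v) (joined-sym j))

    isRep⇒rep : ∀ {v} → IsRep v → rep v ≡ v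
    isRep⇒rep {v} (v∈ , minimal) =
      Finₚ.≤-antisym (rep-≤ joined-refl) (minimal (rep v) (joined-verts v∈ (joined-rep v)) (joined-sym (joined-rep v)))

    private
      -- Spelled as in the definition of `#components`, so that `count isRep?` unfolds to the number
      -- of components.
      isRep? : Decidable IsRep
      isRep? v = (v ∈? verts) ×-dec Finₚ.all? λ u → (u ∈? verts) →-dec (joined? S u v →-dec (v Finₚ.≤? u))
        where open import Relation.Nullary.Decidable using (_→-dec_)

    #components-split : {Q : Pred (Fin #V) q} {R : Pred (Fin #V) r} (Q? : Decidable Q) (R? : Decidable R) →
      (∀ {i} → IsRep i → Q i ⊎ R i) → (∀ {i} → Q i → IsRep i) → (∀ {i} → R i → IsRep i) →
      (∀ {i} → Q i → ¬ R i) → #components S ≡ count Q? ℕ.+ count R?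
    #components-split Q? R? = count-split isRep? Q? R?

    count-≤-#components : {P : Pred (Fin m) p} (P? : Decidable P) (f : ∀ {i} → P i → Fin #V) →
      (∀ {i} (pi : P i) → IsRep (f pi)) → (∀ {i j} (pi : P i) (pj : P j) → f pi ≡ f pj → i ≡ j) →
      count P? ℕ.≤ #components S
    count-≤-#components P? = count-≤ P? isRep?

    #components-≤-count : {P : Pred (Fin m) p} (P? : Decidable P) (f : ∀ {i} → IsRep i → Fin m) →
      (∀ {i} (pi : IsRep i) → P (f pi)) → (∀ {i j} (pi : IsRep i) (pj : IsRep j) → f pi ≡ f pj → i ≡ j) →
      #components S ℕ.≤ count P?
    #components-≤-count P? = count-≤ isRep? P?

    #components>0 : ∀ {v} → v ∈ verts → 0 ℕ.< #components S
    #components>0 {v} v∈ = ℕₚ.≤-<-trans z≤n (x∈p⇒∣p-x∣<∣p∣ (∈⟦⟧⁺ isRep? (isRep-rep v∈)))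

-- Double covers: signs of the sheets, antisymmetric edge vectors and path lifting.

module Covers {G̃ G : Graph} (D : DoubleCover G̃ G) where

  open import Data.Fin.Subset using (Subset; _∈_; _∉_; ∁)
  open import Data.Integer.Base using (ℤ; +_; _+_; _*_; 0ℤ; 1ℤ; -1ℤ)
  open import Data.Integer.Tactic.RingSolver using (solve-∀)
  open import Data.List.Membership.Propositional using () renaming (_∈_ to _∈ₗ_)
  open import Data.List.Membership.Propositional.Properties using (∈-map⁺; ∈-map⁻)
  open import Data.List.Relation.Binary.Permutation.Propositional using (_↭_)
  open import Data.List.Relation.Unary.Unique.Propositional using (Unique)
  open import Data.Nat.Base using (_<_)
  open import Data.Product using (∃; _×_; _,_; proj₁; proj₂)
  open import Relation.Binary.PropositionalEquality
    using (_≡_; _≢_; refl; cong; cong₂; sym; trans; subst; module ≡-Reasoning)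
  open ExteriorAlgebra
  open Triangular
  open Trees
  open Fibres
  open Units
  open Graph
  open DoubleCover D

  private
    variable
      p : Level
      n : ℕ

  first second : {P : Pred (Fin n) p} {f : Fin n → ℕ} → Fibre P f → Fin n
  first (single x _ _ _)          = x
  first (double x y _ _ _ _ _ _)  = x
  second (single x _ _ _)         = x
  second (double x y _ _ _ _ _ _) = y

  -- The order in which a fibre is listed serves as the choice of a sheet. The value 0 on a
  -- singleton makes the sign odd under the deck involution everywhere.
  sign : {P : Pred (Fin n) p} {f : Fin n → ℕ} → Fibre P f → Fin n → ℤ
  sign (single _ _ _ _)         z = 0ℤ
  sign (double x _ _ _ _ _ _ _) z with z Finₚ.≟ x
  ... | yes _ = 1ℤ
  ... | no  _ = -1ℤ

  first-∈ : {P : Pred (Fin n) p} {f : Fin n → ℕ} (F : Fibre P f) → P (first F)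
  first-∈ (single _ px _ _)         = px
  first-∈ (double _ _ _ px _ _ _ _) = px

  second-∈ : {P : Pred (Fin n) p} {f : Fin n → ℕ} (F : Fibre P f) → P (second F)
  second-∈ (single _ px _ _)         = px
  second-∈ (double _ _ _ _ py _ _ _) = py

  pair-complete : {P : Pred (Fin n) p} {f : Fin n → ℕ} → Fibre P f →
                  ∀ {x y z} → x ≢ y → P x → P y → P z → z ≡ x ⊎ z ≡ y
  pair-complete (single _ _ _ only) x≢y px py pz = contradiction (trans (only px) (sym (only py))) x≢y
  pair-complete (double _ _ _ _ _ _ _ only) x≢y px py pz with only px | only py | only pz
  ... | inj₁ refl | inj₁ refl | _         = contradiction refl x≢y
  ... | inj₂ refl | inj₂ refl | _         = contradiction refl x≢y
  ... | inj₁ refl | inj₂ refl | inj₁ refl = inj₁ refl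
  ... | inj₁ refl | inj₂ refl | inj₂ refl = inj₂ refl
  ... | inj₂ refl | inj₁ refl | inj₁ refl = inj₂ refl
  ... | inj₂ refl | inj₁ refl | inj₂ refl = inj₁ refl

  fibreV : ∀ v → Fibre (λ ṽ → πV ṽ ≡ v) dV
  fibreV v = fibre (λ ṽ → πV ṽ Finₚ.≟ v) dV dV-pos (degree-V v)

  fibreH : ∀ h → Fibre (λ h̃ → πH h̃ ≡ h) (dE ∘ edge G̃)
  fibreH h = fibre (λ h̃ → πH h̃ Finₚ.≟ h) (dE ∘ edge G̃) (dE-pos ∘ edge G̃) (degree-H h)

  lift colift : Fin (#V G) → Fin (#V G̃)
  lift v   = first (fibreV v)
  colift v = second (fibreV v)

  sgn : Fin (#V G̃) → ℤ
  sgn ṽ = sign (fibreV (πV ṽ)) ṽ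

  π-lift : ∀ v → πV (lift v) ≡ v
  π-lift v = first-∈ (fibreV v)

  π-colift : ∀ v → πV (colift v) ≡ v
  π-colift v = second-∈ (fibreV v)

  sgn-over : ∀ {ṽ v} → πV ṽ ≡ v → sgn ṽ ≡ sign (fibreV v) ṽ
  sgn-over refl = refl

  sgn-dilated : ∀ {ṽ} → DilatedV (πV ṽ) → sgn ṽ ≡ 0ℤ
  sgn-dilated {ṽ} (x , px , only) with fibreV (πV ṽ)
  ... | single _ _ _ _             = refl
  ... | double _ _ x≢y px py _ _ _ = contradiction (trans (sym (only px)) (only py)) x≢y

  sgn-lift : ∀ {v} → ¬ DilatedV v → sgn (lift v) ≡ 1ℤ
  sgn-lift {v} ¬dil = trans (sgn-over (π-lift v)) (go (fibreV v))
    where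
    go : (F : Fibre (λ ṽ → πV ṽ ≡ v) dV) → sign F (first F) ≡ 1ℤ
    go (single x px _ only) = contradiction (x , px , λ py → sym (only py)) ¬dil
    go (double x _ _ _ _ _ _ _) with x Finₚ.≟ x
    ... | yes _  = refl
    ... | no x≢x = contradiction refl x≢x

  sgn-colift : ∀ {v} → ¬ DilatedV v → sgn (colift v) ≡ -1ℤ
  sgn-colift {v} ¬dil = trans (sgn-over (π-colift v)) (go (fibreV v))
    where
    go : (F : Fibre (λ ṽ → πV ṽ ≡ v) dV) → sign F (second F) ≡ -1ℤ
    go (single x px _ only) = contradiction (x , px , λ py → sym (only py)) ¬dil
    go (double x y x≢y _ _ _ _ _) with y Finₚ.≟ x
    ... | yes y≡x = contradiction (sym y≡x) x≢y
    ... | no _    = refl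

  over : ∀ {ṽ v} → πV ṽ ≡ v → ṽ ≡ lift v ⊎ ṽ ≡ colift v
  over {ṽ} {v} eq with fibreV v
  ... | single _ _ _ only         = inj₁ (only eq)
  ... | double _ _ _ _ _ _ _ only = only eq

  sgn-cases : ∀ ṽ → (DilatedV (πV ṽ) × sgn ṽ ≡ 0ℤ) ⊎
                    (¬ DilatedV (πV ṽ) × (sgn ṽ ≡ 1ℤ ⊎ sgn ṽ ≡ -1ℤ))
  sgn-cases ṽ with dilatedV? (πV ṽ)
  ... | yes dil = inj₁ (dil , sgn-dilated dil)
  ... | no ¬dil with over {ṽ} refl
  ...   | inj₁ eq = inj₂ (¬dil , inj₁ (trans (cong sgn eq) (sgn-lift ¬dil)))
  ...   | inj₂ eq = inj₂ (¬dil , inj₂ (trans (cong sgn eq) (sgn-colift ¬dil)))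

  sgn-conjugate : ∀ {x y} → πV x ≡ πV y → x ≢ y → sgn y ≡ -1ℤ * sgn x
  sgn-conjugate {x} {y} eq x≢y = trans (sgn-over (sym eq)) (go (fibreV (πV x)))
    where
    go : (F : Fibre (λ ṽ → πV ṽ ≡ πV x) dV) → sign F y ≡ -1ℤ * sign F x
    go (single _ _ _ only) = refl
    go (double a b a≢b _ _ _ _ only) with y Finₚ.≟ a | x Finₚ.≟ a
    ... | yes refl | yes refl = contradiction refl x≢y
    ... | yes refl | no _     = refl
    ... | no _     | yes refl = refl
    ... | no y≢a   | no x≢a with only refl | only (sym eq)
    ...   | inj₁ x≡a | _        = contradiction x≡a x≢a
    ...   | inj₂ _   | inj₁ y≡a = contradiction y≡a y≢a
    ...   | inj₂ x≡b | inj₂ y≡b = contradiction (trans x≡b (sym y≡b)) x≢y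

  -- One step of path lifting: the local degree is positive, so the harmonic sum that equals it
  -- cannot be empty.
  halfEdgeAt : ∀ ṽ h → root G h ≡ πV ṽ → ∃ λ k → root G̃ k ≡ ṽ × πH k ≡ h
  halfEdgeAt ṽ h eq = Σℕ>0⇒∃ (λ k → (root G̃ k Finₚ.≟ ṽ) ×-dec (πH k Finₚ.≟ h)) (dE ∘ edge G̃)
    (subst (0 <_) (harmonic ṽ h eq) (dV-pos ṽ))
    where open import Relation.Nullary.Decidable using (_×-dec_)

  -- If the two roots differ, they are conjugate. If they coincide, then every vertex above the root
  -- of `h` carries one of these two half-edges, so this fibre is a single vertex and both signs are
  -- 0.
  sgn-roots : ∀ {h k k′} → k ≢ k′ → πH k ≡ h → πH k′ ≡ h → sgn (root G̃ k′) ≡ -1ℤ * sgn (root G̃ k)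
  sgn-roots {h} {k} {k′} k≢k′ πk πk′ with root G̃ k Finₚ.≟ root G̃ k′
  ... | no r≢r′ = sgn-conjugate (trans (π-root k) (trans (cong (root G) (trans πk (sym πk′))) (sym (π-root k′)))) r≢r′
  ... | yes r≡r′ with fibreV (root G h) in eq
  ...   | single _ _ _ _ = trans (vanish k′ πk′) (cong (-1ℤ *_) (sym (vanish k πk)))
    where
    vanish : ∀ k → πH k ≡ h → sgn (root G̃ k) ≡ 0ℤ
    vanish k πk = trans (sgn-over (trans (π-root k) (cong (root G) πk))) (cong (λ F → sign F (root G̃ k)) eq)
  ...   | double x y x≢y px py _ _ _ = contradiction (trans (unique px) (sym (unique py))) x≢y
    where
    unique : ∀ {z} → πV z ≡ root G h → z ≡ root G̃ k
    unique {z} pz with halfEdgeAt z h (sym pz)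
    ... | j , rj , πj with pair-complete (fibreH h) k≢k′ πk πk′ πj
    ...   | inj₁ refl = sym rj
    ...   | inj₂ refl = trans (sym rj) (sym r≡r′)

  -- The antisymmetric coordinates of a vertex of Γ̃.
  ψ : Fin (#V G̃) → Vect (#V G)
  ψ ṽ i = sgn ṽ * δ (πV ṽ) i

  -- Edges over e are represented by the half-edges over half G e.
  fibreE : ∀ e → Fibre (λ h̃ → πH h̃ ≡ half G e) (dE ∘ edge G̃)
  fibreE e = fibreH (half G e)

  edges-over : Fin (#E G) → List (Fin (#E G̃))
  edges-over e = List.map (edge G̃) (elements (fibreE e))

  over-edge : ∀ ẽ → ∃ λ k → πH k ≡ half G (πE ẽ) × edge G̃ k ≡ ẽ
  over-edge ẽ with edge-orb G (half G (πE ẽ)) (πH (half G̃ ẽ)) (edge-half G (πE ẽ))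
  ... | inj₁ eq = half G̃ ẽ , sym eq , edge-half G̃ ẽ
  ... | inj₂ eq = ι G̃ (half G̃ ẽ) , trans (π-ι (half G̃ ẽ)) (sym eq) ,
                  trans (edge-ι G̃ (half G̃ ẽ)) (edge-half G̃ ẽ)

  πE-over : ∀ {e k} → πH k ≡ half G e → πE (edge G̃ k) ≡ e
  πE-over {e} {k} eq = trans (πE-edge k) (trans (cong (edge G) eq) (edge-half G e))

  -- Otherwise k would be `ι G̃ k′`, and `h` would be fixed by the involution of the base.
  edge-injective : ∀ {h k k′} → πH k ≡ h → πH k′ ≡ h → edge G̃ k ≡ edge G̃ k′ → k ≡ k′
  edge-injective {h} {k} {k′} πk πk′ eq with edge-orb G̃ k k′ eq
  ... | inj₁ k≡k′ = k≡k′
  ... | inj₂ k≡ιk′ = contradiction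
    (trans (cong (ι G) (sym πk′)) (trans (sym (π-ι k′)) (trans (cong πH (sym k≡ιk′)) πk))) (ι-free G h)

  edges-↭ : allFin (#E G̃) ↭ concatMap edges-over (allFin (#E G))
  edges-↭ = allFin-↭ πE edges-over unique sound complete
    where
    unique : ∀ e → Unique (edges-over e)
    unique e with fibreE e
    ... | single _ _ _ _             = [] ∷ []
    ... | double x y x≢y px py _ _ _ = ((λ eq → x≢y (edge-injective px py eq)) ∷ []) ∷ [] ∷ []
    sound : ∀ {e ẽ} → ẽ ∈ₗ edges-over e → πE ẽ ≡ e
    sound {e} ẽ∈ with ∈-map⁻ (edge G̃) ẽ∈
    ... | k , k∈ , refl = πE-over (∈-elements⁻ (fibreE e) k∈)
    complete : ∀ ẽ → ẽ ∈ₗ edges-over (πE ẽ)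
    complete ẽ with over-edge ẽ
    ... | k , πk , eq = subst (_∈ₗ edges-over (πE ẽ)) eq (∈-map⁺ (edge G̃) (∈-elements⁺ (fibreE (πE ẽ)) πk))

  vertices-↭ : allFin (#V G̃) ↭ concatMap (elements ∘ fibreV) (allFin (#V G))
  vertices-↭ = allFin-↭ πV (elements ∘ fibreV) (elements-unique ∘ fibreV)
    (λ {v} → ∈-elements⁻ (fibreV v)) (λ ṽ → ∈-elements⁺ (fibreV (πV ṽ)) refl)

  -- The other lift of the edge would give the negative (`ψ-conjugate`). Over a dilated edge both
  -- ends are dilated and have sign 0, so no antisymmetric vector exists there.
  antiVector : Fin (#E G) → Maybe (Vect (#V G))
  antiVector e with fibreE e
  ... | single _ _ _ _         = nothing
  ... | double k _ _ _ _ _ _ _ = just (ψ (root G̃ k) ⊖ ψ (root G̃ (ι G̃ k)))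

  antiVector-dilated : ∀ {e} → DilatedE e → antiVector e ≡ nothing
  antiVector-dilated {e} (ẽ , _ , only) with fibreE e
  ... | single _ _ _ _             = refl
  ... | double x y x≢y px py _ _ _ = contradiction
    (edge-injective px py (trans (sym (only (πE-over px))) (only (πE-over py)))) x≢y

  singleton⇒dilated : ∀ {e k} → πH k ≡ half G e → (∀ {j} → πH j ≡ half G e → j ≡ k) → DilatedE e
  singleton⇒dilated {e} {k} πk only = edge G̃ k , πE-over πk , above
    where
    above : ∀ {ẽ} → πE ẽ ≡ e → edge G̃ k ≡ ẽ
    above {ẽ} refl with over-edge ẽ
    ... | j , πj , eq = trans (cong (edge G̃) (sym (only πj))) eq

  antiVector-undilated : ∀ {e} → ¬ DilatedE e → ∃ λ t → antiVector e ≡ just t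
  antiVector-undilated {e} ¬dil with fibreE e
  ... | double _ _ _ _ _ _ _ _ = _ , refl
  ... | single x px _ only     = contradiction (singleton⇒dilated px only) ¬dil

  dilated-ends : ∀ k → DilatedE (edge G (πH k)) → sgn (root G̃ k) ≡ 0ℤ × sgn (root G̃ (ι G̃ k)) ≡ 0ℤ
  dilated-ends k dil = end k dil , end (ι G̃ k)
    (subst DilatedE (sym (trans (cong (edge G) (π-ι k)) (edge-ι G (πH k)))) dil)
    where
    end : ∀ k → DilatedE (edge G (πH k)) → sgn (root G̃ k) ≡ 0ℤ
    end k dil = sgn-dilated (subst DilatedV (sym (π-root k))
      (∈⟦⟧⁻ dilatedV? (Subgraph.closed dilation (πH k) (∈⟦⟧⁺ dilatedE? dil))))

  ψ-conjugate : ∀ {h k k′} → k ≢ k′ → πH k ≡ h → πH k′ ≡ h → ∀ i →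
    (ψ (root G̃ k′) ⊖ ψ (root G̃ (ι G̃ k′))) i ≡ -1ℤ * (ψ (root G̃ k) ⊖ ψ (root G̃ (ι G̃ k))) i
  ψ-conjugate {h} {k} {k′} k≢k′ πk πk′ i = trans
    (cong₂ (λ a b → a + -1ℤ * b)
      (cong₂ (λ s v → s * δ v i) (sgn-roots k≢k′ πk πk′) (same k k′ πk πk′))
      (cong₂ (λ s v → s * δ v i) (sgn-roots ιk≢ιk′ (πι k πk) (πι k′ πk′)) (same (ι G̃ k) (ι G̃ k′) (πι k πk) (πι k′ πk′))))
    (lemma (sgn (root G̃ k)) (sgn (root G̃ (ι G̃ k))) (δ (πV (root G̃ k)) i) (δ (πV (root G̃ (ι G̃ k))) i))
    where
    lemma : ∀ s t x y → -1ℤ * s * x + -1ℤ * (-1ℤ * t * y) ≡ -1ℤ * (s * x + -1ℤ * (t * y))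
    lemma = solve-∀
    πι : ∀ k → πH k ≡ h → πH (ι G̃ k) ≡ ι G h
    πι k πk = trans (π-ι k) (cong (ι G) πk)
    ιk≢ιk′ : ι G̃ k ≢ ι G̃ k′
    ιk≢ιk′ eq = k≢k′ (trans (sym (ι-invol G̃ k)) (trans (cong (ι G̃) eq) (ι-invol G̃ k′)))
    same : ∀ k k′ {h} → πH k ≡ h → πH k′ ≡ h → πV (root G̃ k′) ≡ πV (root G̃ k)
    same k k′ πk πk′ = trans (π-root k′) (trans (cong (root G) (trans πk′ (sym πk))) (sym (π-root k)))

  private
    ψ-step-aligned : ∀ {e} k {t} → πH k ≡ half G e → antiVector e ≡ just t →
      ∃ λ ε → (ε ≡ 1ℤ ⊎ ε ≡ -1ℤ) × (∀ i → (ψ (root G̃ k) ⊖ ψ (root G̃ (ι G̃ k))) i ≡ ε * t i)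
    ψ-step-aligned {e} k πk eq with fibreE e
    ψ-step-aligned {e} k πk refl | double x y x≢y px py _ _ only with only πk
    ... | inj₁ refl = 1ℤ , inj₁ refl , λ i → sym (ℤₚ.*-identityˡ _)
    ... | inj₂ refl = -1ℤ , inj₂ refl , ψ-conjugate x≢y px py

  -- An arbitrary half-edge can lie on the other sheet or over the opposite half of its edge; either
  -- change costs a sign.
  ψ-step : ∀ k {t} → antiVector (edge G (πH k)) ≡ just t →
           ∃ λ ε → (ε ≡ 1ℤ ⊎ ε ≡ -1ℤ) × (∀ i → (ψ (root G̃ k) ⊖ ψ (root G̃ (ι G̃ k))) i ≡ ε * t i)
  ψ-step k {t} eq with edge-orb G (πH k) (half G (edge G (πH k))) (sym (edge-half G (edge G (πH k))))
  ... | inj₁ πk≡ = ψ-step-aligned k πk≡ eq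
  ... | inj₂ πk≡ι with ψ-step-aligned (ι G̃ k) {t}
                       (trans (π-ι k) (trans (cong (ι G) πk≡ι) (ι-invol G _))) eq
  ...   | ε , ε≡ , step = -1ℤ * ε , flip ε≡ , λ i → begin
    (ψ (root G̃ k) ⊖ ψ (root G̃ (ι G̃ k))) i
      ≡⟨ lemma (ψ (root G̃ k) i) (ψ (root G̃ (ι G̃ k)) i) ⟩
    -1ℤ * (ψ (root G̃ (ι G̃ k)) ⊖ ψ (root G̃ k)) i
      ≡⟨ cong (λ j → -1ℤ * (ψ (root G̃ (ι G̃ k)) ⊖ ψ (root G̃ j)) i) (ι-invol G̃ k) ⟨
    -1ℤ * (ψ (root G̃ (ι G̃ k)) ⊖ ψ (root G̃ (ι G̃ (ι G̃ k)))) i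
      ≡⟨ cong (-1ℤ *_) (step i) ⟩
    -1ℤ * (ε * t i)
      ≡⟨ ℤₚ.*-assoc -1ℤ ε (t i) ⟨
    -1ℤ * ε * t i ∎
    where
    open ≡-Reasoning
    flip : ∀ {ε} → ε ≡ 1ℤ ⊎ ε ≡ -1ℤ → -1ℤ * ε ≡ 1ℤ ⊎ -1ℤ * ε ≡ -1ℤ
    flip (inj₁ refl) = inj₂ refl
    flip (inj₂ refl) = inj₁ refl
    lemma : ∀ x y → x + -1ℤ * y ≡ -1ℤ * (y + -1ℤ * x)
    lemma = solve-∀

  module _ (F : Subset (#E G)) where

    G̃∖F : Subgraph G̃
    G̃∖F = preimage (G ∖ F)

    upstairs : ∀ k → edge G (πH k) ∉ F → edge G̃ k ∈ Subgraph.edges G̃∖F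
    upstairs k e∉ = ∈⟦⟧⁺ (λ ẽ → πE ẽ ∈? Subgraph.edges (G ∖ F))
      (subst (_∈ ∁ F) (sym (πE-edge k)) (x∉p⇒x∈∁p e∉))

    downstairs : ∀ k → edge G̃ k ∈ Subgraph.edges G̃∖F → edge G (πH k) ∈ ∁ F
    downstairs k k∈ = subst (_∈ ∁ F) (πE-edge k) (∈⟦⟧⁻ (λ ẽ → πE ẽ ∈? Subgraph.edges (G ∖ F)) k∈)

    joined-lift : ∀ {ũ v} → Joined (G ∖ F) (πV ũ) v → ∃ λ ṽ → πV ṽ ≡ v × Joined G̃∖F ũ ṽ
    joined-lift (hs , w) = go hs refl w
      where
      go : ∀ hs {ũ u v} → πV ũ ≡ u → IsWalk (G ∖ F) u hs v → ∃ λ ṽ → πV ṽ ≡ v × Joined G̃∖F ũ ṽ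
      go []       πũ refl          = _ , πũ , joined-refl
      go (h ∷ hs) πũ (r , h∈ , w) with halfEdgeAt _ h (trans r (sym πũ))
      ... | k , refl , refl with go hs (trans (π-root (ι G̃ k)) (cong (root G) (π-ι k))) w
      ...   | ṽ , πṽ , j = ṽ , πṽ , joined-trans (joined-edge k (upstairs k (x∈∁p⇒x∉p h∈))) j

    joined-project : ∀ {ũ ṽ} → Joined G̃∖F ũ ṽ → Joined (G ∖ F) (πV ũ) (πV ṽ)
    joined-project (ks , w) = go ks w
      where
      go : ∀ ks {ũ ṽ} → IsWalk G̃∖F ũ ks ṽ → Joined (G ∖ F) (πV ũ) (πV ṽ)
      go []       refl            = joined-refl
      go (k ∷ ks) (refl , k∈ , w) = joined-trans
        (πH k ∷ [] , sym (π-root k) , downstairs k k∈ ,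
          trans (cong (root G) (sym (π-ι k))) (sym (π-root (ι G̃ k))))
        (go ks w)

    -- A global substitute for connected preimages of all components: a walk below lifts from any
    -- starting vertex, so only the end points within one fibre remain to be joined.
    FibresJoined : Set
    FibresJoined = ∀ ũ ṽ → πV ũ ≡ πV ṽ → Joined G̃∖F ũ ṽ

    ComponentsConnected : Set
    ComponentsConnected = ∀ v → Connected (preimage (component (G ∖ F) v))

    private
      module _ (v : Fin (#V G)) where
        K = component (G ∖ F) v
        inK? = λ ṽ → πV ṽ ∈? Subgraph.verts K
        edgeK? = λ ẽ → πE ẽ ∈? Subgraph.edges K

        ∈K : ∀ {ṽ} → Joined (G ∖ F) v (πV ṽ) → ṽ ∈ Subgraph.verts (preimage K)
        ∈K j = ∈⟦⟧⁺ inK? (∈⟦⟧⁺ (inVerts? (G ∖ F) v) (∈⊤ , j))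

        K⊆ : ∀ {ẽ} → ẽ ∈ Subgraph.edges (preimage K) → ẽ ∈ Subgraph.edges G̃∖F
        K⊆ ẽ∈ = ∈⟦⟧⁺ (λ ẽ → πE ẽ ∈? Subgraph.edges (G ∖ F))
          (proj₁ (∈⟦⟧⁻ (inEdges? (G ∖ F) v) (∈⟦⟧⁻ edgeK? ẽ∈)))

        -- `inEdges?` tests an edge at its designated half-edge, which may be opposite to `h`.
        half-joined : ∀ h → edge G h ∈ ∁ F → Joined (G ∖ F) v (root G h) →
                      Joined (G ∖ F) v (root G (half G (edge G h)))
        half-joined h h∈ j with edge-orb G (half G (edge G h)) h (edge-half G (edge G h))
        ... | inj₁ eq = subst (Joined (G ∖ F) v ∘ root G) (sym eq) j
        ... | inj₂ eq = subst (Joined (G ∖ F) v ∘ root G) (sym eq) (joined-trans j (joined-edge h h∈))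

        confine : ∀ ks {ũ ṽ} → Joined (G ∖ F) v (πV ũ) → IsWalk G̃∖F ũ ks ṽ → IsWalk (preimage K) ũ ks ṽ
        confine []       j w               = w
        confine (k ∷ ks) j (refl , k∈ , w) = refl ,
          ∈⟦⟧⁺ edgeK? (subst (_∈ Subgraph.edges K) (sym (πE-edge k))
            (∈⟦⟧⁺ (inEdges? (G ∖ F) v) (h∈ , half-joined (πH k) h∈ jr))) ,
          confine ks (joined-trans jr
            (πH k ∷ [] , refl , h∈ , trans (cong (root G) (sym (π-ι k))) (sym (π-root (ι G̃ k))))) w
          where
          h∈ = downstairs k k∈
          jr = subst (Joined (G ∖ F) v) (π-root k) j

    connected⇒joined : ComponentsConnected → ∀ {ũ ṽ} → Joined (G ∖ F) (πV ũ) (πV ṽ) → Joined G̃∖F ũ ṽ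
    connected⇒joined conn {ũ} {ṽ} j = joined-mono (K⊆ (πV ũ))
      (proj₂ (conn (πV ũ)) ũ ṽ (∈K (πV ũ) joined-refl) (∈K (πV ũ) j))

    fibresJoined⇒connected : FibresJoined → ComponentsConnected
    fibresJoined⇒connected fib v = (lift v , ∈K v (subst (Joined (G ∖ F) v) (sym (π-lift v)) joined-refl)) ,
      λ ũ ṽ ũ∈ ṽ∈ →
        let jũ = proj₂ (∈⟦⟧⁻ (inVerts? (G ∖ F) v) (∈⟦⟧⁻ (inK? v) ũ∈))
            jṽ = proj₂ (∈⟦⟧⁻ (inVerts? (G ∖ F) v) (∈⟦⟧⁻ (inK? v) ṽ∈))
            (w̃ , πw̃ , j) = joined-lift (joined-trans (joined-sym jũ) jṽ)
            (ks , w) = joined-trans j (fib w̃ ṽ πw̃)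
        in ks , confine v ks jũ w

  antiVector-just : ∀ {e t} → antiVector e ≡ just t →
                    ∃ λ k → edge G (πH k) ≡ e × t ≡ ψ (root G̃ k) ⊖ ψ (root G̃ (ι G̃ k))
  antiVector-just {e} eq with fibreE e
  antiVector-just {e} refl | double k _ _ πk _ _ _ _ = k , trans (cong (edge G) πk) (edge-half G e) , refl

  ψ-lift : ∀ {v} → ¬ DilatedV v → ∀ i → ψ (lift v) i ≡ δ v i
  ψ-lift {v} ¬dil i = trans (cong₂ (λ s u → s * δ u i) (sgn-lift ¬dil) (π-lift v)) (ℤₚ.*-identityˡ (δ v i))

  ψ-colift : ∀ {v} → ¬ DilatedV v → ∀ i → ψ (colift v) i ≡ -1ℤ * δ v i
  ψ-colift {v} ¬dil i = cong₂ (λ s u → s * δ u i) (sgn-colift ¬dil) (π-colift v)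

  ψ-zero : ∀ {ṽ} → sgn ṽ ≡ 0ℤ → ∀ i → ψ ṽ i ≡ 0ℤ
  ψ-zero {ṽ} eq i = cong (_* δ (πV ṽ) i) eq

  lift≡colift : ∀ {v} → DilatedV v → lift v ≡ colift v
  lift≡colift {v} (x , _ , only) = trans (sym (only (π-lift v))) (only (π-colift v))

-- The antisymmetric determinant of an edge set.

module Ogods {G̃ G : Graph} (D : DoubleCover G̃ G) where

  open import Data.Fin.Subset using (Subset; _∉_; ∁)
  open import Data.Integer.Base as ℤ using (ℤ; +_; _+_; _*_; 0ℤ; 1ℤ; -1ℤ)
  open import Data.Integer.Tactic.RingSolver using (solve-∀)
  open import Data.List.Membership.Propositional using () renaming (_∈_ to _∈ₗ_)
  open import Data.List.Membership.Propositional.Properties using (∈-tabulate⁺)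
  open import Data.Product using (∃; _×_; _,_; proj₁; proj₂)
  open import Relation.Binary.PropositionalEquality
    using (_≡_; _≢_; refl; cong; cong₂; sym; trans; subst; module ≡-Reasoning)
  open ≡-Reasoning
  open ExteriorAlgebra
  open Triangular
  open Complements
  open Trees
  open Fibres
  open Counting
  open Units
  open Covers D
  open Graph
  open DoubleCover D

  -- No antisymmetric edge vector has a component at a dilated vertex, since `ψ` vanishes there;
  -- these units fill the gaps. The complement is taken because `outs` lists what lies outside its
  -- set.
  dilatedUnits : List (Vect (#V G))
  dilatedUnits = outs (∁ ⟦ dilatedV? ⟧) (just ∘ δ) []

  ∈-dilatedUnits : ∀ {v} → DilatedV v → δ v ∈ₗ dilatedUnits
  ∈-dilatedUnits dil = ∈-outs (∁ ⟦ dilatedV? ⟧) (λ v∈ → x∈∁p⇒x∉p v∈ (∈⟦⟧⁺ dilatedV? dil)) refl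

  All-dilatedUnits : ∀ {p} {P : Pred (Vect (#V G)) p} → (∀ {v} → DilatedV v → P (δ v)) → All P dilatedUnits
  All-dilatedUnits {P = P} p = All-outs (∁ ⟦ dilatedV? ⟧) [] unit
    where
    unit : ∀ {v x} → v ∉ ∁ ⟦ dilatedV? ⟧ → just (δ v) ≡ just x → P x
    unit {v} v∉ refl with dilatedV? v
    ... | yes dil = p dil
    ... | no ¬dil = contradiction (x∉p⇒x∈∁p (¬dil ∘ ∈⟦⟧⁻ dilatedV?)) v∉

  antiTree : Subset (#E G) → List (Vect (#V G))
  antiTree F = outs F antiVector dilatedUnits

  module _ (F : Subset (#E G)) where

    private
      ρ = rep (G ∖ F)

    -- A lift of `v` joined to a lift of a dilated vertex, where `ψ` is zero, puts `δ v` itself into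
    -- the span. In an ungrounded component all signs are ±1, so differences of `ψ` have even
    -- coordinate sum; this is the source of index 2.
    Grounded : Pred (Fin (#V G)) _
    Grounded v = ∃ λ w → DilatedV w × Joined (G ∖ F) v w

    grounded? : Decidable Grounded
    grounded? v = Finₚ.any? λ w → dilatedV? w ×-dec joined? (G ∖ F) v w

    private
      grounded-joined : ∀ {u v} → Joined (G ∖ F) u v → Grounded v → Grounded u
      grounded-joined j (w , dil , j′) = w , dil , joined-trans j j′

      dilated⇒grounded : ∀ {v} → DilatedV v → Grounded v
      dilated⇒grounded dil = _ , dil , joined-refl

      ρ-idem : ∀ v → ρ (ρ v) ≡ ρ v
      ρ-idem v = sym (rep-cong (G ∖ F) (joined-rep (G ∖ F) v))

    FreeRep : Pred (Fin (#V G)) _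
    FreeRep v = ¬ Grounded v × v ≡ ρ v

    freeRep? : Decidable FreeRep
    freeRep? v = ¬? (grounded? v) ×-dec (v Finₚ.≟ ρ v)

    private
      -- A lower triangular basis of the lattice spanned by antiTree F when F is an ogod.
      basisVector : Fin (#V G) → Vect (#V G)
      basisVector v with grounded? v | v Finₚ.≟ ρ v
      ... | yes _ | _     = δ v
      ... | no _  | yes _ = λ i → + 2 * δ v i
      ... | no _  | no _  = δ v ⊖ δ (ρ v)

      basis = tabulate basisVector

      basis-lower : LowerTriangular basisVector
      basis-lower {v} {j} v<j with grounded? v | v Finₚ.≟ ρ v
      ... | yes _ | _     = δ-distinct (Finₚ.<⇒≢ v<j)
      ... | no _  | yes _ = cong (+ 2 *_) (δ-distinct (Finₚ.<⇒≢ v<j))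
      -- `ρ v` is the least vertex joined to v, hence ρ v ≤ v < j.
      ... | no _  | no _  = cong₂ (λ a b → a + -1ℤ * b) (δ-distinct (Finₚ.<⇒≢ v<j))
        (δ-distinct (Finₚ.<⇒≢ (ℕₚ.≤-<-trans (rep-≤ (G ∖ F) joined-refl) v<j)))

      basis-diagonal : ∀ v → basisVector v v ≡ (if does (freeRep? v) then + 2 else 1ℤ)
      basis-diagonal v with grounded? v | v Finₚ.≟ ρ v
      ... | yes _ | _      = δ-same v
      ... | no _  | yes _  = cong (+ 2 *_) (δ-same v)
      ... | no _  | no v≢ρ = cong₂ (λ a b → a + -1ℤ * b) (δ-same v) (δ-distinct (v≢ρ ∘ sym))

      det-basis² : det basis * det basis ≡ + (4 ℕ.^ count freeRep?)
      det-basis² = trans (cong₂ _*_ (det-lower basisVector basis-lower) (det-lower basisVector basis-lower))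
                         (∏-doubling² freeRep? basis-diagonal)

      det-basis≢0 : det basis ≢ 0ℤ
      det-basis≢0 eq = ℕₚ.<⇒≢ (ℕₚ.m^n>0 4 (count freeRep?))
        (ℤₚ.+-injective (trans (sym (cong₂ _*_ eq eq)) det-basis²))

      span-grounded : ∀ {v} → Grounded v → Span basis (δ v)
      span-grounded {v} gr = subst (Span basis) eq (span-∈ (∈-tabulate⁺ v))
        where
        eq : basisVector v ≡ δ v
        eq with grounded? v | v Finₚ.≟ ρ v
        ... | yes _  | _ = refl
        ... | no ¬gr | _ = contradiction gr ¬gr

      span-free : ∀ {v} → ¬ Grounded v → Span basis (δ v ⊖ δ (ρ v))
      span-free {v} ¬gr with v Finₚ.≟ ρ v in eqρ
      ... | yes v≡ρ = span-cong (λ i → cong (λ u → δ v i + -1ℤ * δ u i) v≡ρ) (⊖-self (δ v))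
      ... | no v≢ρ  = subst (Span basis) eq (span-∈ (∈-tabulate⁺ v))
        where
        eq : basisVector v ≡ δ v ⊖ δ (ρ v)
        eq with grounded? v | v Finₚ.≟ ρ v
        ... | yes gr | _       = contradiction gr ¬gr
        ... | no _   | yes v≡ρ = contradiction v≡ρ v≢ρ
        ... | no _   | no _    = refl

      span-root : ∀ {v} → ¬ Grounded v → Span basis (λ i → + 2 * δ (ρ v) i)
      span-root {v} ¬gr = subst (Span basis) eq (span-∈ (∈-tabulate⁺ (ρ v)))
        where
        eq : basisVector (ρ v) ≡ (λ i → + 2 * δ (ρ v) i)
        eq with grounded? (ρ v) | ρ v Finₚ.≟ ρ (ρ v)
        ... | yes gr | _      = contradiction (grounded-joined (joined-rep (G ∖ F) v) gr) ¬gr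
        ... | no _   | yes _  = refl
        ... | no _   | no ≢ρρ = contradiction (sym (ρ-idem v)) ≢ρρ

      sgn-difference : ∀ x y → ¬ Grounded (πV x) → ¬ Grounded (πV y) → ∃ λ c → sgn x + -1ℤ * sgn y ≡ c * + 2
      sgn-difference x y ¬gx ¬gy with sgn-cases x | sgn-cases y
      ... | inj₁ (dil , _) | _              = contradiction (dilated⇒grounded dil) ¬gx
      ... | inj₂ _         | inj₁ (dil , _) = contradiction (dilated⇒grounded dil) ¬gy
      ... | inj₂ (_ , inj₁ sx) | inj₂ (_ , inj₁ sy) = 0ℤ  , cong₂ (λ a b → a + -1ℤ * b) sx sy
      ... | inj₂ (_ , inj₁ sx) | inj₂ (_ , inj₂ sy) = 1ℤ  , cong₂ (λ a b → a + -1ℤ * b) sx sy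
      ... | inj₂ (_ , inj₂ sx) | inj₂ (_ , inj₁ sy) = -1ℤ , cong₂ (λ a b → a + -1ℤ * b) sx sy
      ... | inj₂ (_ , inj₂ sx) | inj₂ (_ , inj₂ sy) = 0ℤ  , cong₂ (λ a b → a + -1ℤ * b) sx sy

      span-ψ-basis : ∀ x y → Joined (G ∖ F) (πV x) (πV y) → Span basis (ψ x ⊖ ψ y)
      span-ψ-basis x y j with grounded? (πV x)
      ... | yes gx = span-⊖ (span-* (sgn x) (span-grounded gx))
                            (span-* (sgn y) (span-grounded (grounded-joined (joined-sym j) gx)))
      ... | no ¬gx with sgn-difference x y ¬gx (¬gx ∘ grounded-joined j)
      -- Both unit vectors are moved to the common representative. What is left over is
      -- `sgn x − sgn y` times its unit vector, an even multiple.
      ...   | c , eq = span-cong pointwise (span-+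
                (span-⊖ (span-* (sgn x) (span-free ¬gx)) (span-* (sgn y) (span-free (¬gx ∘ grounded-joined j))))
                (span-* c (span-root ¬gx)))
        where
        lemma₁ : ∀ s t c a b r → (s * (a + -1ℤ * r) + -1ℤ * (t * (b + -1ℤ * r))) + c * (+ 2 * r) ≡
                                 (s * a + -1ℤ * (t * b)) + (c * + 2 + -1ℤ * (s + -1ℤ * t)) * r
        lemma₁ = solve-∀
        lemma₂ : ∀ a k r → a + (k + -1ℤ * k) * r ≡ a
        lemma₂ = solve-∀
        pointwise : ∀ i →
          (sgn x * (δ (πV x) ⊖ δ (ρ (πV x))) i + -1ℤ * (sgn y * (δ (πV y) ⊖ δ (ρ (πV y))) i)) +
            c * (+ 2 * δ (ρ (πV x)) i) ≡ (ψ x ⊖ ψ y) i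
        pointwise i = begin
          (sgn x * (δ (πV x) ⊖ δ (ρ (πV x))) i + -1ℤ * (sgn y * (δ (πV y) ⊖ δ (ρ (πV y))) i)) +
            c * (+ 2 * δ (ρ (πV x)) i)
            ≡⟨ cong (λ r → (sgn x * (δ (πV x) ⊖ δ (ρ (πV x))) i + -1ℤ * (sgn y * (δ (πV y) ⊖ δ r) i)) +
                  c * (+ 2 * δ (ρ (πV x)) i)) (rep-cong (G ∖ F) j) ⟨
          (sgn x * (δ (πV x) ⊖ δ (ρ (πV x))) i + -1ℤ * (sgn y * (δ (πV y) ⊖ δ (ρ (πV x))) i)) +
            c * (+ 2 * δ (ρ (πV x)) i)
            ≡⟨ lemma₁ (sgn x) (sgn y) c (δ (πV x) i) (δ (πV y) i) (δ (ρ (πV x)) i) ⟩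
          (ψ x ⊖ ψ y) i + (c * + 2 + -1ℤ * (sgn x + -1ℤ * sgn y)) * δ (ρ (πV x)) i
            ≡⟨ cong (λ k → (ψ x ⊖ ψ y) i + (c * + 2 + -1ℤ * k) * δ (ρ (πV x)) i) eq ⟩
          (ψ x ⊖ ψ y) i + (c * + 2 + -1ℤ * (c * + 2)) * δ (ρ (πV x)) i
            ≡⟨ lemma₂ ((ψ x ⊖ ψ y) i) (c * + 2) (δ (ρ (πV x)) i) ⟩
          (ψ x ⊖ ψ y) i ∎

      antiTree⊆basis : All (Span basis) (antiTree F)
      antiTree⊆basis = All-outs F (All-dilatedUnits (span-grounded ∘ dilated⇒grounded)) edgeSpan
        where
        edgeSpan : ∀ {e t} → e ∉ F → antiVector e ≡ just t → Span basis t
        edgeSpan e∉ eq with antiVector-just eq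
        ... | k , refl , refl = span-ψ-basis (root G̃ k) (root G̃ (ι G̃ k))
          (joined-project F (joined-edge k (upstairs F k e∉)))

      span-ψ-antiTree : ∀ {ũ ṽ} → Joined (G̃∖F F) ũ ṽ → Span (antiTree F) (ψ ũ ⊖ ψ ṽ)
      span-ψ-antiTree (ks , w) = go ks w
        where
        step : ∀ k → edge G (πH k) ∉ F → Span (antiTree F) (ψ (root G̃ k) ⊖ ψ (root G̃ (ι G̃ k)))
        step k e∉ with dilatedE? (edge G (πH k))
        ... | yes dil = span-cong (λ i → sym (cong₂ (λ a b → a + -1ℤ * b)
                          (ψ-zero (proj₁ (dilated-ends k dil)) i) (ψ-zero (proj₂ (dilated-ends k dil)) i))) span-0
        ... | no ¬dil with antiVector-undilated ¬dil
        ...   | t , eq with ψ-step k eq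
        ...     | ε , _ , k≗ = span-cong (sym ∘ k≗) (span-* ε (span-∈ (∈-outs F e∉ eq)))
        go : ∀ ks {ũ ṽ} → IsWalk (G̃∖F F) ũ ks ṽ → Span (antiTree F) (ψ ũ ⊖ ψ ṽ)
        go []       {ũ} refl = ⊖-self (ψ ũ)
        go (k ∷ ks) {ṽ = ṽ} (refl , k∈ , w) = chain (ψ (root G̃ k)) (ψ (root G̃ (ι G̃ k))) (ψ ṽ)
          (step k (x∈∁p⇒x∉p (downstairs F k k∈))) (go ks w)

      -- Apart from the units of dilated vertices, each basis vector is a difference of `ψ` at two
      -- vertices joined upstairs: a lift and a lift of a dilated vertex, the two lifts of a
      -- representative, or a lift of v and a lift of its representative.
      basis⊆antiTree : ComponentsConnected F → All (Span (antiTree F)) basis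
      basis⊆antiTree conn = Allₚ.tabulate⁺ spanned
        where
        joinedLifts : ∀ {x y u v} → πV x ≡ u → πV y ≡ v → Joined (G ∖ F) u v → Joined (G̃∖F F) x y
        joinedLifts refl refl = connected⇒joined F conn
        spanned : ∀ v → Span (antiTree F) (basisVector v)
        spanned v with grounded? v | v Finₚ.≟ ρ v
        ... | yes (w , dilw , j) | _ with dilatedV? v
        ...   | yes dil = span-∈ (acc⊆outs F (∈-dilatedUnits dil))
        ...   | no ¬dil = span-cong
                  (λ i → trans (cong₂ (λ a b → a + -1ℤ * b) (ψ-lift ¬dil i)
                                 (ψ-zero (sgn-dilated (subst DilatedV (sym (π-lift w)) dilw)) i))
                               (ℤₚ.+-identityʳ (δ v i)))
                  (span-ψ-antiTree (joinedLifts (π-lift v) (π-lift w) j))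
        spanned v | no ¬gr | yes _ = span-cong
          (λ i → trans (cong₂ (λ a b → a + -1ℤ * b) (ψ-lift (¬gr ∘ dilated⇒grounded) i)
                                                    (ψ-colift (¬gr ∘ dilated⇒grounded) i))
                       (lemma (δ v i)))
          (span-ψ-antiTree (joinedLifts (π-lift v) (π-colift v) joined-refl))
          where
          lemma : ∀ a → a + -1ℤ * (-1ℤ * a) ≡ + 2 * a
          lemma = solve-∀
        spanned v | no ¬gr | no _ = span-cong
          (λ i → cong₂ (λ a b → a + -1ℤ * b) (ψ-lift (¬gr ∘ dilated⇒grounded) i)
            (ψ-lift (¬gr ∘ grounded-joined (joined-rep (G ∖ F) v) ∘ dilated⇒grounded) i))
          (span-ψ-antiTree (joinedLifts (π-lift v) (π-lift (ρ v)) (joined-rep (G ∖ F) v)))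

    det²-antiTree : ComponentsConnected F → length (antiTree F) ≡ #V G →
                    det (antiTree F) * det (antiTree F) ≡ + (4 ℕ.^ count freeRep?)
    det²-antiTree conn len = trans
      (det²-unique (basis⊆antiTree conn) antiTree⊆basis
        (trans len (sym (Listₚ.length-tabulate basisVector))) det-basis≢0)
      det-basis²

    det-antiTree≢0 : ComponentsConnected F → length (antiTree F) ≡ #V G → det (antiTree F) ≢ 0ℤ
    det-antiTree≢0 conn len eq = ℕₚ.<⇒≢ (ℕₚ.m^n>0 4 (count freeRep?))
      (ℤₚ.+-injective (trans (sym (cong₂ _*_ eq eq)) (det²-antiTree conn len)))

    -- If two lifts ũ, ṽ of one vertex are not joined, the antisymmetrised
    -- indicator function of the component of ũ annihilates antiTree F.
    det-antiTree-disconnected : ¬ ComponentsConnected F → det (antiTree F) ≡ 0ℤ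
    det-antiTree-disconnected ¬conn
      with Finₚ.all? (λ ũ → Finₚ.all? λ ṽ → (πV ũ Finₚ.≟ πV ṽ) →-dec joined? (G̃∖F F) ũ ṽ)
    ... | yes fib = contradiction (fibresJoined⇒connected F fib) ¬conn
    ... | no ¬fib with Finₚ.¬∀⟶∃¬ _ _ (λ ũ → Finₚ.all? λ ṽ → (πV ũ Finₚ.≟ πV ṽ) →-dec joined? (G̃∖F F) ũ ṽ) ¬fib
    ...   | ũ , ¬fibũ with Finₚ.¬∀⟶∃¬ _ _ (λ ṽ → (πV ũ Finₚ.≟ πV ṽ) →-dec joined? (G̃∖F F) ũ ṽ) ¬fibũ
    ...     | ṽ , ¬impl with πV ũ Finₚ.≟ πV ṽ
    ...       | no π≢  = contradiction (λ π≡ → contradiction π≡ π≢) ¬impl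
    ...       | yes π≡ = conclude
      where
      ¬joined : ¬ Joined (G̃∖F F) ũ ṽ
      ¬joined j = ¬impl (λ _ → j)
      g : Fin (#V G̃) → ℤ
      g x with joined? (G̃∖F F) ũ x
      ... | yes _ = 1ℤ
      ... | no _  = 0ℤ
      g-joined : ∀ {x y} → Joined (G̃∖F F) x y → g x ≡ g y
      g-joined {x} {y} j with joined? (G̃∖F F) ũ x | joined? (G̃∖F F) ũ y
      ... | yes _  | yes _  = refl
      ... | no _   | no _   = refl
      ... | yes jx | no ¬jy = contradiction (joined-trans jx j) ¬jy
      ... | no ¬jx | yes jy = contradiction (joined-trans jy (joined-sym j)) ¬jx
      g-ũ : g ũ ≡ 1ℤ
      g-ũ with joined? (G̃∖F F) ũ ũ
      ... | yes _ = refl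
      ... | no ¬j = contradiction joined-refl ¬j
      g-ṽ : g ṽ ≡ 0ℤ
      g-ṽ with joined? (G̃∖F F) ũ ṽ
      ... | yes j = contradiction j ¬joined
      ... | no _  = refl
      f : Vect (#V G)
      f v = g (lift v) + -1ℤ * g (colift v)
      f-dilated : ∀ {v} → DilatedV v → f v ≡ 0ℤ
      f-dilated {v} dil = trans (cong (λ x → g x + -1ℤ * g (colift v)) (lift≡colift dil)) (lemma (g (colift v)))
        where
        lemma : ∀ a → a + -1ℤ * a ≡ 0ℤ
        lemma = solve-∀
      lemma₋ : ∀ a b → -1ℤ * (a + -1ℤ * b) ≡ b + -1ℤ * a
      lemma₋ = solve-∀
      -- `f` is measured from the chosen lift; the sign transfers it to the lift that carries `k`.
      -- Over a dilated root both sides are 0.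
      f-over : ∀ {h k k′} → k ≢ k′ → πH k ≡ h → πH k′ ≡ h →
               sgn (root G̃ k) * f (root G h) ≡ g (root G̃ k) + -1ℤ * g (root G̃ k′)
      f-over {h} {k} {k′} k≢k′ πk πk′ = go (above k πk) (above k′ πk′) (sgn-roots k≢k′ πk πk′)
        where
        above : ∀ k → πH k ≡ h → πV (root G̃ k) ≡ root G h
        above k πk = trans (π-root k) (cong (root G) πk)
        go : ∀ {x y v} → πV x ≡ v → πV y ≡ v → sgn y ≡ -1ℤ * sgn x → sgn x * f v ≡ g x + -1ℤ * g y
        go {x} {y} {v} πx πy sy with dilatedV? v
        ... | yes dil = trans (cong (sgn x *_) (f-dilated dil)) (trans (ℤₚ.*-zeroʳ (sgn x))
                (trans (lemma (g x)) (cong (λ z → g x + -1ℤ * g z) x≡y)))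
          where
          x≡y : x ≡ y
          x≡y = trans (sym (proj₂ (proj₂ dil) πx)) (proj₂ (proj₂ dil) πy)
          lemma : ∀ a → 0ℤ ≡ a + -1ℤ * a
          lemma = solve-∀
        ... | no ¬dil with over πx | over πy
        ...   | inj₁ refl | inj₂ refl = trans (cong (_* f v) (sgn-lift ¬dil)) (ℤₚ.*-identityˡ (f v))
        ...   | inj₂ refl | inj₁ refl = trans (cong (_* f v) (sgn-colift ¬dil)) (lemma₋ (g (lift v)) (g (colift v)))
        ...   | inj₁ refl | inj₁ refl = contradiction (trans (sym (sgn-lift ¬dil)) (trans sy (cong (-1ℤ *_) (sgn-lift ¬dil)))) λ ()
        ...   | inj₂ refl | inj₂ refl = contradiction (trans (sym (sgn-colift ¬dil)) (trans sy (cong (-1ℤ *_) (sgn-colift ¬dil)))) λ ()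
      ⟨f,ψ⟩ : ∀ x → ⟨ f , ψ x ⟩ ≡ sgn x * f (πV x)
      ⟨f,ψ⟩ x = trans (⟨⟩-* f (sgn x) (δ (πV x))) (cong (sgn x *_) (⟨⟩-δ f (πV x)))
      ⟨f,edge⟩ : ∀ {h k k′} → k ≢ k′ → πH k ≡ h → πH k′ ≡ h → edge G h ∉ F →
                 ⟨ f , ψ (root G̃ k) ⊖ ψ (root G̃ (ι G̃ k)) ⟩ ≡ 0ℤ
      ⟨f,edge⟩ {h} {k} {k′} k≢k′ πk πk′ e∉ = begin
        ⟨ f , ψ x ⊖ ψ y ⟩
          ≡⟨ ⟨⟩-⊖ f (ψ x) (ψ y) ⟩
        ⟨ f , ψ x ⟩ + -1ℤ * ⟨ f , ψ y ⟩
          ≡⟨ cong₂ (λ a b → a + -1ℤ * b)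
               (trans (⟨f,ψ⟩ x) (trans (cong (λ v → sgn x * f v) (trans (π-root k) (cong (root G) πk))) (f-over k≢k′ πk πk′)))
               (trans (⟨f,ψ⟩ y) (trans (cong (λ v → sgn y * f v) (trans (π-root (ι G̃ k)) (cong (root G) (πι k πk))))
                                       (f-over ιk≢ιk′ (πι k πk) (πι k′ πk′)))) ⟩
        (g x + -1ℤ * g x′) + -1ℤ * (g y + -1ℤ * g y′)
          ≡⟨ cong₂ (λ a b → (a + -1ℤ * b) + -1ℤ * (g y + -1ℤ * g y′)) (g-edge k πk) (g-edge k′ πk′) ⟩
        (g y + -1ℤ * g y′) + -1ℤ * (g y + -1ℤ * g y′)
          ≡⟨ lemma (g y + -1ℤ * g y′) ⟩
        0ℤ ∎
        where
        x = root G̃ k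
        y = root G̃ (ι G̃ k)
        x′ = root G̃ k′
        y′ = root G̃ (ι G̃ k′)
        πι : ∀ k → πH k ≡ h → πH (ι G̃ k) ≡ ι G h
        πι k πk = trans (π-ι k) (cong (ι G) πk)
        ιk≢ιk′ : ι G̃ k ≢ ι G̃ k′
        ιk≢ιk′ eq = k≢k′ (trans (sym (ι-invol G̃ k)) (trans (cong (ι G̃) eq) (ι-invol G̃ k′)))
        g-edge : ∀ k → πH k ≡ h → g (root G̃ k) ≡ g (root G̃ (ι G̃ k))
        g-edge k πk = g-joined (joined-edge k (upstairs F k (subst (λ h → edge G h ∉ F) (sym πk) e∉)))
        lemma : ∀ a → a + -1ℤ * a ≡ 0ℤ
        lemma = solve-∀
      annihilated : All (λ a → ⟨ f , a ⟩ ≡ 0ℤ) (antiTree F)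
      annihilated = All-outs F (All-dilatedUnits (λ {v} dil → trans (⟨⟩-δ f v) (f-dilated dil))) edges
        where
        edges : ∀ {e t} → e ∉ F → antiVector e ≡ just t → ⟨ f , t ⟩ ≡ 0ℤ
        edges {e} e∉ eq with fibreE e
        edges {e} e∉ refl | double k k′ k≢k′ πk πk′ _ _ _ =
          ⟨f,edge⟩ k≢k′ πk πk′ (subst (_∉ F) (sym (edge-half G e)) e∉)
      f≢0 : f (πV ũ) ≢ 0ℤ
      f≢0 fũ≡0 with over {ũ} refl | over (sym π≡)
      ... | inj₁ ũ≡ | inj₂ ṽ≡ = contradiction
        (trans (sym (cong₂ (λ a b → a + -1ℤ * b) (trans (cong g (sym ũ≡)) g-ũ) (trans (cong g (sym ṽ≡)) g-ṽ))) fũ≡0) λ ()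
      ... | inj₂ ũ≡ | inj₁ ṽ≡ = contradiction
        (trans (sym (cong₂ (λ a b → a + -1ℤ * b) (trans (cong g (sym ṽ≡)) g-ṽ) (trans (cong g (sym ũ≡)) g-ũ))) fũ≡0) λ ()
      ... | inj₁ ũ≡ | inj₁ ṽ≡ = ¬joined (subst (Joined (G̃∖F F) ũ) (trans ũ≡ (sym ṽ≡)) joined-refl)
      ... | inj₂ ũ≡ | inj₂ ṽ≡ = ¬joined (subst (Joined (G̃∖F F) ũ) (trans ũ≡ (sym ṽ≡)) joined-refl)
      conclude : det (antiTree F) ≡ 0ℤ
      conclude = ℤₚ.*-cancelˡ-≡ (f (πV ũ)) _ _ ⦃ ℤ.≢-nonZero f≢0 ⦄ (begin
        f (πV ũ) * det (antiTree F)              ≡⟨ cong (_* det (antiTree F)) (⟨⟩-δ f (πV ũ)) ⟨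
        ⟨ f , δ (πV ũ) ⟩ * det (antiTree F)      ≡⟨ det-annihilated f (δ (πV ũ)) {antiTree F} annihilated ⟩
        0ℤ                                       ≡⟨ ℤₚ.*-zeroʳ (f (πV ũ)) ⟨
        f (πV ũ) * 0ℤ                            ∎)

-- Components of the dilation subgraph inside the complement of an ogod.

module Rank {G̃ G : Graph} (D : DoubleCover G̃ G) where

  open import Data.Fin.Subset using (Subset; _∈_; _∉_; ∁; ⊤; ∣_∣)
  open import Data.Integer.Base as ℤ using (ℤ; +_; _+_; _*_; 0ℤ; 1ℤ; -1ℤ)
  open import Data.Integer.Tactic.RingSolver using (solve-∀)
  open import Data.List.Membership.Propositional using () renaming (_∈_ to _∈ₗ_)
  open import Data.List.Membership.Propositional.Properties using (∈-map⁺)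
  open import Data.List.Relation.Unary.Any using (here; there)
  open import Data.Product using (_×_; _,_; proj₁; proj₂)
  open import Relation.Binary.PropositionalEquality
    using (_≡_; _≢_; refl; cong; cong₂; sym; trans; subst; module ≡-Reasoning)
  open ≡-Reasoning
  open ExteriorAlgebra
  open Triangular
  open Complements
  open Trees
  open Fibres
  open Counting
  open Units
  open Covers D
  open Ogods D
  open Graph
  open DoubleCover D

  infixr 5 _◂_

  _◂_ : ∀ {n} → ℤ → Vect n → Vect (suc n)
  (c ◂ a) zero    = c
  (c ◂ a) (suc i) = a i

  -- If w₁ and w₂ lay in different components of the dilation subgraph, then
  -- recording the indicator g of the component of w₁ (modulo 2) in an additional
  -- coordinate would produce a lattice of index 2 containing all of ℤ ⊕ 0.
  module _ (F : Subset (#E G)) (conn : ComponentsConnected F) (len : length (antiTree F) ≡ #V G) where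

    private
      module _ {w₁ w₂ : Fin (#V G)} (dil₁ : DilatedV w₁) (dil₂ : DilatedV w₂)
               (joined : Joined (G ∖ F) w₁ w₂) (¬joined : ¬ Joined dilation w₁ w₂) where

        g : Fin (#V G) → ℤ
        g v with joined? dilation w₁ v
        ... | yes _ = 1ℤ
        ... | no _  = 0ℤ

        g-w₁ : g w₁ ≡ 1ℤ
        g-w₁ with joined? dilation w₁ w₁
        ... | yes _ = refl
        ... | no ¬j = contradiction joined-refl ¬j

        g-w₂ : g w₂ ≡ 0ℤ
        g-w₂ with joined? dilation w₁ w₂
        ... | yes j = contradiction j ¬joined
        ... | no _  = refl

        g-joined : ∀ {u v} → Joined dilation u v → g u ≡ g v
        g-joined {u} {v} j with joined? dilation w₁ u | joined? dilation w₁ v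
        ... | yes _  | yes _  = refl
        ... | no _   | no _   = refl
        ... | yes ju | no ¬jv = contradiction (joined-trans ju j) ¬jv
        ... | no ¬ju | yes jv = contradiction (joined-trans jv (joined-sym j)) ¬ju

        -- A sum instead of the difference that a walk would produce: it is independent of
        -- orientation and sheet, and it agrees with the difference modulo 2. The generator
        -- `+ 2 ◂ 0⃗` absorbs the discrepancy.
        ends : Fin (#E G) → ℤ
        ends e = g (root G (half G e)) + g (root G (ι G (half G e)))

        ends-edge : ∀ h → ends (edge G h) ≡ g (root G h) + g (root G (ι G h))
        ends-edge h with edge-orb G (half G (edge G h)) h (edge-half G (edge G h))
        ... | inj₁ eq = cong (λ h → g (root G h) + g (root G (ι G h))) eq
        ... | inj₂ eq = trans (cong (λ h → g (root G h) + g (root G (ι G h))) eq)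
          (trans (cong (λ h′ → g (root G (ι G h)) + g (root G h′)) (ι-invol G h))
                 (ℤₚ.+-comm (g (root G (ι G h))) (g (root G h))))

        vectors : List (Vect (suc (#V G)))
        vectors = outs F (λ e → Maybe.map (ends e ◂_) (antiVector e)) (List.map (0ℤ ◂_) dilatedUnits)

        extended : List (Vect (suc (#V G)))
        extended = (+ 2 ◂ 0⃗) ∷ vectors

        tails : List.map (_∘ suc) vectors ≡ antiTree F
        tails = trans (map-outs (_∘ suc) F _ _) (trans
          (outs-cong F (λ e → erase (antiVector e)))
          (cong (outs F antiVector) (trans (sym (Listₚ.map-∘ dilatedUnits)) (Listₚ.map-id dilatedUnits))))
          where
          erase : ∀ {c} m → Maybe.map (_∘ suc) (Maybe.map (c ◂_) m) ≡ m
          erase nothing  = refl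
          erase (just a) = refl

        det-extended : det extended ≡ + 2 * det (antiTree F)
        det-extended = trans (det-peel (+ 2 ◂ 0⃗) vectors (λ _ → refl)) (cong (λ as → + 2 * det as) tails)

        χ : Fin (#V G̃) → Vect (suc (#V G))
        χ x = g (πV x) ◂ ψ x

        span-step : ∀ k → edge G (πH k) ∉ F → Span extended (χ (root G̃ k) ⊖ χ (root G̃ (ι G̃ k)))
        span-step k e∉ with dilatedE? (edge G (πH k))
        ... | yes dil = span-cong pointwise span-0
          where
          x = root G̃ k
          y = root G̃ (ι G̃ k)
          gx≡gy : g (πV x) ≡ g (πV y)
          gx≡gy = trans (cong g (π-root k)) (trans
            (g-joined (joined-edge (πH k) (∈⟦⟧⁺ dilatedE? dil)))
            (cong g (sym (trans (π-root (ι G̃ k)) (cong (root G) (π-ι k))))))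
          lemma : ∀ a → 0ℤ ≡ a + -1ℤ * a
          lemma = solve-∀
          pointwise : ∀ i → 0ℤ ≡ (χ x ⊖ χ y) i
          pointwise zero    = trans (lemma (g (πV x))) (cong (λ a → g (πV x) + -1ℤ * a) gx≡gy)
          pointwise (suc i) = sym (cong₂ (λ a b → a + -1ℤ * b)
            (ψ-zero (proj₁ (dilated-ends k dil)) i) (ψ-zero (proj₂ (dilated-ends k dil)) i))
        ... | no ¬dil with antiVector-undilated ¬dil
        ...   | t , eq with ψ-step k eq
        ...     | ε , ε≡ , k≗ = correct ε≡
          where
          x = root G̃ k
          y = root G̃ (ι G̃ k)
          e = edge G (πH k)
          gx+gy : ends e ≡ g (πV x) + g (πV y)
          gx+gy = trans (ends-edge (πH k)) (sym (cong₂ (λ u v → g u + g v)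
            (π-root k) (trans (π-root (ι G̃ k)) (cong (root G) (π-ι k)))))
          generator : Span extended (ends e ◂ t)
          generator = span-∈ (there (∈-outs F e∉ (cong (Maybe.map (ends e ◂_)) eq)))
          two : Span extended (+ 2 ◂ 0⃗)
          two = span-∈ (here refl)
          lemma₁ : ∀ a b → 1ℤ * (a + b) + -1ℤ * b * + 2 ≡ a + -1ℤ * b
          lemma₁ = solve-∀
          lemma₂ : ∀ a b → -1ℤ * (a + b) + a * + 2 ≡ a + -1ℤ * b
          lemma₂ = solve-∀
          correct : ε ≡ 1ℤ ⊎ ε ≡ -1ℤ → Span extended (χ x ⊖ χ y)
          correct (inj₁ refl) = span-cong pointwise (span-+ (span-* ε generator) (span-* (-1ℤ * g (πV y)) two))
            where
            pointwise : ∀ i → ε * (ends e ◂ t) i + -1ℤ * g (πV y) * (+ 2 ◂ 0⃗) i ≡ (χ x ⊖ χ y) i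
            pointwise zero    = trans (cong (λ s → 1ℤ * s + -1ℤ * g (πV y) * + 2) gx+gy) (lemma₁ (g (πV x)) (g (πV y)))
            pointwise (suc i) = trans (cong (λ z → ε * t i + z) (ℤₚ.*-zeroʳ (-1ℤ * g (πV y))))
                                      (trans (ℤₚ.+-identityʳ (ε * t i)) (sym (k≗ i)))
          correct (inj₂ refl) = span-cong pointwise (span-+ (span-* ε generator) (span-* (g (πV x)) two))
            where
            pointwise : ∀ i → ε * (ends e ◂ t) i + g (πV x) * (+ 2 ◂ 0⃗) i ≡ (χ x ⊖ χ y) i
            pointwise zero    = trans (cong (λ s → -1ℤ * s + g (πV x) * + 2) gx+gy) (lemma₂ (g (πV x)) (g (πV y)))
            pointwise (suc i) = trans (cong (λ z → ε * t i + z) (ℤₚ.*-zeroʳ (g (πV x))))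
                                      (trans (ℤₚ.+-identityʳ (ε * t i)) (sym (k≗ i)))

        span-walk : ∀ ks {x y} → IsWalk (G̃∖F F) x ks y → Span extended (χ x ⊖ χ y)
        span-walk []       {x} refl = ⊖-self (χ x)
        span-walk (k ∷ ks) {y = y} (refl , k∈ , w) = chain (χ (root G̃ k)) (χ (root G̃ (ι G̃ k))) (χ y)
          (span-step k (x∈∁p⇒x∉p (downstairs F k k∈))) (span-walk ks w)

        -- The lifts of w₁ and w₂ are joined upstairs, and `ψ` vanishes at both, so only the values
        -- 1 and 0 of `g` remain.
        one : Span extended (1ℤ ◂ 0⃗)
        one = span-cong pointwise (span-walk (proj₁ upper) (proj₂ upper))
          where
          upper = connected⇒joined F conn {lift w₁} {lift w₂}
            (subst (λ u → Joined (G ∖ F) u (πV (lift w₂))) (sym (π-lift w₁))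
              (subst (Joined (G ∖ F) w₁) (sym (π-lift w₂)) joined))
          vanish : ∀ {w} → DilatedV w → ∀ i → ψ (lift w) i ≡ 0ℤ
          vanish {w} dil = ψ-zero (sgn-dilated (subst DilatedV (sym (π-lift w)) dil))
          pointwise : ∀ i → (χ (lift w₁) ⊖ χ (lift w₂)) i ≡ (1ℤ ◂ 0⃗) i
          pointwise zero    = cong₂ (λ a b → a + -1ℤ * b) (trans (cong g (π-lift w₁)) g-w₁) (trans (cong g (π-lift w₂)) g-w₂)
          pointwise (suc i) = cong₂ (λ a b → a + -1ℤ * b) (vanish dil₁ i) (vanish dil₂ i)

        target : List (Vect (suc (#V G)))
        target = (1ℤ ◂ 0⃗) ∷ List.map (0ℤ ◂_) (antiTree F)

        det-target : det target ≡ det (antiTree F)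
        det-target = trans (det-peel (1ℤ ◂ 0⃗) (List.map (0ℤ ◂_) (antiTree F)) (λ _ → refl))
          (trans (ℤₚ.*-identityˡ _) (cong det (trans (sym (Listₚ.map-∘ (antiTree F))) (Listₚ.map-id (antiTree F)))))

        target-spanned : All (Span extended) target
        target-spanned = one ∷ Allₚ.map⁺ (All-outs F
          (All-dilatedUnits (λ dil → span-∈ (there (acc⊆outs F (∈-map⁺ (0ℤ ◂_) (∈-dilatedUnits dil))))))
          edgeSpan)
          where
          edgeSpan : ∀ {e t} → e ∉ F → antiVector e ≡ just t → Span extended (0ℤ ◂ t)
          edgeSpan {e} {t} e∉ eq = span-cong pointwise
            (span-+ (span-∈ (there (∈-outs F e∉ (cong (Maybe.map (ends e ◂_)) eq)))) (span-* (-1ℤ * ends e) one))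
            where
            lemma : ∀ a → a + -1ℤ * a * 1ℤ ≡ 0ℤ
            lemma = solve-∀
            pointwise : ∀ i → (ends e ◂ t) i + -1ℤ * ends e * (1ℤ ◂ 0⃗) i ≡ (0ℤ ◂ t) i
            pointwise zero    = lemma (ends e)
            pointwise (suc i) = trans (cong (λ z → t i + z) (ℤₚ.*-zeroʳ (-1ℤ * ends e))) (ℤₚ.+-identityʳ (t i))

        length-target : length target ≡ length extended
        length-target = cong suc (trans (Listₚ.length-map (0ℤ ◂_) (antiTree F))
          (trans (cong length (sym tails)) (Listₚ.length-map (_∘ suc) vectors)))

        absurd : ∀ {c} → c * + 2 ≢ 1ℤ
        absurd {c} eq with () ← ℕₚ.m*n≡1⇒n≡1 ℤ.∣ c ∣ 2 (trans (sym (ℤₚ.abs-* c (+ 2))) (cong ℤ.∣_∣ eq))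

        d = det (antiTree F)

        twice : ∀ {c} → det target ≡ c * det extended → c * + 2 ≡ 1ℤ
        twice {c} eq = ℤₚ.*-cancelʳ-≡ (c * + 2) 1ℤ d ⦃ ℤ.≢-nonZero (det-antiTree≢0 F conn len) ⦄ (begin
          c * + 2 * d      ≡⟨ ℤₚ.*-assoc c (+ 2) d ⟩
          c * (+ 2 * d)    ≡⟨ cong (c *_) det-extended ⟨
          c * det extended ≡⟨ eq ⟨
          det target       ≡⟨ det-target ⟩
          d                ≡⟨ ℤₚ.*-identityˡ d ⟨
          1ℤ * d           ∎)

        -- With d non-zero, `target` has determinant d and `extended` has 2d, although the former is
        -- spanned by the latter.
        not-separated : ⊥
        not-separated = let (c , eq) = det-span {as = extended} target-spanned length-target in absurd {c} (twice {c} eq)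

    joined-dilation : ∀ {w₁ w₂} → DilatedV w₁ → DilatedV w₂ → Joined (G ∖ F) w₁ w₂ → Joined dilation w₁ w₂
    joined-dilation {w₁} {w₂} dil₁ dil₂ j with joined? dilation w₁ w₂
    ... | yes j′ = j′
    ... | no ¬j  = ⊥-elim (not-separated dil₁ dil₂ j ¬j)

    -- Grounded components match dilation components. Sending a grounded component to a dilation
    -- component in it is injective because dilation edges avoid `F`; the reverse assignment is
    -- injective by `joined-dilation`.
    rank-split : (∀ e → e ∈ F → ¬ DilatedE e) → rank F ≡ count (freeRep? F) ℕ.+ d-dil
    rank-split undil = trans
      (#components-split (G ∖ F) (freeRep? F) groundedRep? classify free⇒rep proj₁ (λ (¬gr , _) (_ , gr) → ¬gr gr))
      (cong (count (freeRep? F) ℕ.+_) (ℕₚ.≤-antisym below above))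
      where
      isRep? : Decidable (IsRep (G ∖ F))
      isRep? v = (v ∈? ⊤) ×-dec Finₚ.all? λ u → (u ∈? ⊤) →-dec (joined? (G ∖ F) u v →-dec (v Finₚ.≤? u))
      groundedRep? : Decidable (λ v → IsRep (G ∖ F) v × Grounded F v)
      groundedRep? v = isRep? v ×-dec grounded? F v
      free⇒rep : ∀ {v} → FreeRep F v → IsRep (G ∖ F) v
      free⇒rep {v} (_ , v≡) = subst (IsRep (G ∖ F)) (sym v≡) (isRep-rep (G ∖ F) ∈⊤)
      classify : ∀ {v} → IsRep (G ∖ F) v → FreeRep F v ⊎ (IsRep (G ∖ F) v × Grounded F v)
      classify {v} r with grounded? F v
      ... | yes gr = inj₂ (r , gr)
      ... | no ¬gr = inj₁ (¬gr , sym (isRep⇒rep (G ∖ F) r))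
      dilation⊆ : ∀ {e} → e ∈ Subgraph.edges dilation → e ∈ ∁ F
      dilation⊆ e∈ = x∉p⇒x∈∁p (λ e∈F → undil _ e∈F (∈⟦⟧⁻ dilatedE? e∈))
      dilated : ∀ {w} → IsRep dilation w → DilatedV w
      dilated (w∈ , _) = ∈⟦⟧⁻ dilatedV? w∈
      below : count groundedRep? ℕ.≤ d-dil
      below = count-≤-#components dilation groundedRep? (λ (_ , w , _) → rep dilation w)
        (λ (_ , w , dil , _) → isRep-rep dilation (∈⟦⟧⁺ dilatedV? dil))
        (λ { (r₁ , w₁ , dil₁ , j₁) (r₂ , w₂ , dil₂ , j₂) eq → trans (sym (isRep⇒rep (G ∖ F) r₁))
             (trans (rep-cong (G ∖ F) (joined-trans j₁ (joined-trans
               (joined-mono dilation⊆ (joined-trans (joined-rep dilation w₁)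
                 (subst (λ u → Joined dilation u w₂) (sym eq) (joined-sym (joined-rep dilation w₂)))))
               (joined-sym j₂)))) (isRep⇒rep (G ∖ F) r₂)) })
      above : d-dil ℕ.≤ count groundedRep?
      above = #components-≤-count dilation groundedRep? (λ {w} _ → rep (G ∖ F) w)
        (λ {w} r → isRep-rep (G ∖ F) ∈⊤ , w , dilated r , joined-sym (joined-rep (G ∖ F) w))
        (λ {w₁} {w₂} r₁ r₂ eq → trans (sym (isRep⇒rep dilation r₁)) (trans
          (rep-cong dilation (joined-dilation (dilated r₁) (dilated r₂)
            (joined-trans (joined-rep (G ∖ F) w₁)
              (subst (λ u → Joined (G ∖ F) u w₂) (sym eq) (joined-sym (joined-rep (G ∖ F) w₂))))))
          (isRep⇒rep dilation r₂)))

-- Lattice realisations of the base and of the cover.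

module Realisations where

  open import Data.Fin.Subset using (Subset; _∈_; ∁; ∣_∣)
  open import Data.Integer.Base as ℤ using (ℤ; +_; _+_; _*_; 0ℤ; 1ℤ; -1ℤ)
  open import Data.Integer.Tactic.RingSolver using (solve-∀)
  open import Data.List.Membership.Propositional using () renaming (_∈_ to _∈ₗ_)
  open import Data.List.Membership.Propositional.Properties
    using (∈-tabulate⁺; ∈-map⁺; ∈-++⁺ˡ; ∈-++⁺ʳ)
  open import Data.List.Relation.Binary.Permutation.Propositional
    using (_↭_; ↭-trans; ↭-sym; ↭-reflexive)
  open Permₚ using (↭-length)
  open import Data.List.Relation.Unary.Any using (here)
  open import Data.Product using (∃; _×_; _,_; proj₂)
  open import Relation.Binary.PropositionalEquality
    using (_≡_; _≢_; _≗_; refl; cong; cong₂; sym; trans; subst; module ≡-Reasoning)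
  open ≡-Reasoning
  open ExteriorAlgebra
  open Triangular
  open Complements
  open Trees
  open Fibres
  open Counting
  open Units
  open Graph

  private
    variable
      a p : Level
      A : Set a
      m n : ℕ

  -- The rows δ_v − δ_o, with δ_o itself in place of the zero row.
  module _ (G : Graph) where
    private o = origin G

    row : Fin (#V G) → Vect (#V G)
    row v with v Finₚ.≟ o
    ... | yes _ = δ v
    ... | no _  = δ v ⊖ δ o

    row-lower : LowerTriangular row
    row-lower {v} {j} v<j with v Finₚ.≟ o
    ... | yes _  = δ-distinct (Finₚ.<⇒≢ v<j)
    ... | no v≢o = cong₂ (λ a b → a + -1ℤ * b) (δ-distinct (Finₚ.<⇒≢ v<j))
                     (δ-distinct {v = o} λ { refl → origin-least G v v<j })

    row-diagonal : ∀ v → row v v ≡ 1ℤ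
    row-diagonal v with v Finₚ.≟ o
    ... | yes _  = δ-same v
    ... | no v≢o = cong₂ (λ a b → a + -1ℤ * b) (δ-same v) (δ-distinct (v≢o ∘ sym))

    ∏-ones : ∀ {n} {f : Fin n → ℤ} → (∀ i → f i ≡ 1ℤ) → ∏ f ≡ 1ℤ
    ∏-ones {zero}  f≗1 = refl
    ∏-ones {suc n} f≗1 = cong₂ _*_ (f≗1 zero) (∏-ones (f≗1 ∘ suc))

    det-row : det (tabulate row) ≡ 1ℤ
    det-row = trans (det-lower row row-lower) (∏-ones row-diagonal)

    row-origin : row o ≡ δ o
    row-origin with o Finₚ.≟ o
    ... | yes _  = refl
    ... | no o≢o = contradiction refl o≢o

    standard : Realisation G (#V G)
    standard = record
      { φ = δ
      ; extra = δ o ∷ []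
      ; basis = tabulate row
      ; length-basis = Listₚ.length-tabulate row
      ; length-extra = refl
      ; det-basis≢0 = λ eq → contradiction (trans (sym det-row) eq) λ ()
      ; basis-spanned = λ extra⊆ spans → Allₚ.tabulate⁺ (spanned extra⊆ spans)
      ; extra-spanned = subst (Span (tabulate row)) row-origin (span-∈ (∈-tabulate⁺ o)) ∷ []
      ; φ-spanned = λ u v → chain (δ u) (δ o) (δ v) (difference u) (span-flip (δ v) (δ o) (difference v))
      ; functional = λ g → (λ i → g i + -1ℤ * g o) , 1ℤ , -1ℤ * g o , (λ ()) ,
          (λ v → trans (⟨⟩-δ _ v) (lemma₁ (g v) (g o))) , trans (⟨⟩-δ _ o) (lemma₂ (g o)) ∷ []
      }
      where
      lemma₁ : ∀ a b → a + -1ℤ * b ≡ 1ℤ * a + -1ℤ * b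
      lemma₁ = solve-∀
      lemma₂ : ∀ a → a + -1ℤ * a ≡ 0ℤ
      lemma₂ = solve-∀
      spanned : ∀ {as} → (∀ {a} → a ∈ₗ δ o ∷ [] → a ∈ₗ as) → (∀ u v → Span as (δ u ⊖ δ v)) → ∀ v → Span as (row v)
      spanned extra⊆ spans v with v Finₚ.≟ o
      ... | yes refl = span-∈ (extra⊆ (here refl))
      ... | no _     = spans v o
      difference : ∀ v → Span (tabulate row) (δ v ⊖ δ o)
      difference v with v Finₚ.≟ o in eq
      ... | yes refl = ⊖-self (δ o)
      ... | no v≢o   = subst (Span (tabulate row)) row≡ (span-∈ (∈-tabulate⁺ v))
        where
        row≡ : row v ≡ δ v ⊖ δ o
        row≡ with v Finₚ.≟ o
        ... | yes v≡o = contradiction v≡o v≢o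
        ... | no _    = refl

    det²-standard : det (tabulate row) * det (tabulate row) ≡ 1ℤ
    det²-standard = cong₂ _*_ det-row det-row

  sizes-count : {P : Pred (Fin n) p} (P? : Decidable P) (v : Fin n → Maybe A) →
                (∀ {i} → P i → size (v i) ≡ 1) → (∀ {i} → ¬ P i → size (v i) ≡ 0) → sizes v ≡ count P?
  sizes-count {n = zero}  P? v P⇒1 ¬P⇒0 = refl
  sizes-count {n = suc n} P? v P⇒1 ¬P⇒0 with P? zero | sizes-count (P? ∘ suc) (v ∘ suc) P⇒1 ¬P⇒0
  ... | yes p₀ | eq = cong₂ ℕ._+_ (P⇒1 p₀) eq
  ... | no ¬p₀ | eq = cong₂ ℕ._+_ (¬P⇒0 ¬p₀) eq

  count-¬ : {P : Pred (Fin n) p} (P? : Decidable P) → count P? ℕ.+ count (¬? ∘ P?) ≡ n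
  count-¬ {n = zero}  P? = refl
  count-¬ {n = suc n} P? with P? zero | count-¬ (P? ∘ suc)
  ... | yes _ | eq = cong suc eq
  ... | no _  | eq = trans (ℕₚ.+-suc _ _) (cong suc eq)

  length-concatMap : ∀ {b} {B : Set b} (L : A → List B) (f : Fin n → A) {c} {C : Set c} (v : Fin n → Maybe C) →
                     (∀ i → length (L (f i)) ≡ suc (size (v i))) →
                     length (concatMap L (tabulate f)) ≡ n ℕ.+ sizes v
  length-concatMap {n = zero}  L f v eq = refl
  length-concatMap {n = suc n} L f v eq = trans (Listₚ.length-++ (L (f zero)))
    (trans (cong₂ ℕ._+_ (eq zero) (length-concatMap L (f ∘ suc) (v ∘ suc) (eq ∘ suc)))
           (cong suc (rearrange (size (v zero)) n (sizes (v ∘ suc)))))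
    where
    rearrange : ∀ a b c → a ℕ.+ (b ℕ.+ c) ≡ b ℕ.+ (a ℕ.+ c)
    rearrange = ℕSolver.solve-∀

  module _ {G̃ G : Graph} (D : DoubleCover G̃ G) where
    open DoubleCover D
    open Covers D
    open Ogods D
    open Rank D

    undilatedV? : Decidable (λ v → ¬ DilatedV v)
    undilatedV? = ¬? ∘ dilatedV?

    u : ℕ
    u = count undilatedV?

    n-dil+u : n-dil ℕ.+ u ≡ #V G
    n-dil+u = count-¬ dilatedV?

    private
      twin : Fin (#V G) → Maybe (Fin (#V G̃))
      twin v with fibreV v
      ... | single _ _ _ _         = nothing
      ... | double _ y _ _ _ _ _ _ = just y

      sizes-twin : sizes twin ≡ u
      sizes-twin = sizes-count undilatedV? twin yes⇒1 no⇒0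
        where
        yes⇒1 : ∀ {v} → ¬ DilatedV v → size (twin v) ≡ 1
        yes⇒1 {v} ¬dil with fibreV v
        ... | single x px _ only     = contradiction (x , px , sym ∘ only) ¬dil
        ... | double _ _ _ _ _ _ _ _ = refl
        no⇒0 : ∀ {v} → ¬ ¬ DilatedV v → size (twin v) ≡ 0
        no⇒0 {v} ¬¬dil with fibreV v
        ... | single _ _ _ _             = refl
        ... | double x y x≢y px py _ _ _ = contradiction
                (λ (z , pz , only) → x≢y (trans (sym (only px)) (only py))) ¬¬dil

    #V-cover : #V G̃ ≡ #V G ℕ.+ u
    #V-cover = trans (sym (Listₚ.length-tabulate id)) (trans (↭-length vertices-↭)
      (trans (length-concatMap (elements ∘ fibreV) id twin count-fibre) (cong (#V G ℕ.+_) sizes-twin)))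
      where
      count-fibre : ∀ v → length (elements (fibreV v)) ≡ suc (size (twin v))
      count-fibre v with fibreV v
      ... | single _ _ _ _         = refl
      ... | double _ _ _ _ _ _ _ _ = refl

    #E-cover : #E G̃ ≡ #E G ℕ.+ sizes antiVector
    #E-cover = trans (sym (Listₚ.length-tabulate id)) (trans (↭-length edges-↭)
      (length-concatMap edges-over id antiVector count-fibre))
      where
      count-fibre : ∀ e → length (edges-over e) ≡ suc (size (antiVector e))
      count-fibre e with fibreE e
      ... | single _ _ _ _         = refl
      ... | double _ _ _ _ _ _ _ _ = refl

    length-dilatedUnits : length dilatedUnits ≡ n-dil
    length-dilatedUnits = ℕₚ.+-cancelʳ-≡ ∣ ∁ ⟦ dilatedV? ⟧ ∣ _ _ (begin
      length dilatedUnits ℕ.+ ∣ ∁ ⟦ dilatedV? ⟧ ∣   ≡⟨ length-outs (∁ ⟦ dilatedV? ⟧) (just ∘ δ) [] (λ _ → refl) ⟩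
      sizes {n = #V G} (just ∘ δ) ℕ.+ 0             ≡⟨ trans (ℕₚ.+-identityʳ _) (sizes-just δ) ⟩
      #V G                                          ≡⟨ ℕₚ.m+[n∸m]≡n (∣p∣≤n ⟦ dilatedV? ⟧) ⟨
      n-dil ℕ.+ (#V G ℕ.∸ n-dil)                    ≡⟨ cong (n-dil ℕ.+_) (∣∁p∣≡n∸∣p∣ ⟦ dilatedV? ⟧) ⟨
      n-dil ℕ.+ ∣ ∁ ⟦ dilatedV? ⟧ ∣                 ∎)

    module _ (F : Subset (#E G)) (undil : ∀ e → e ∈ F → ¬ DilatedE e) where

      length-antiTree : length (antiTree F) ℕ.+ ∣ F ∣ ≡ sizes antiVector ℕ.+ n-dil
      length-antiTree = trans
        (length-outs F antiVector dilatedUnits (λ {e} e∈ → cong size (proj₂ (antiVector-undilated (undil e e∈)))))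
        (cong (sizes antiVector ℕ.+_) length-dilatedUnits)

      private
        genus-difference : genus G̃ ℤ.- genus G ≡ + sizes antiVector ℤ.- + u
        genus-difference = trans
          (cong₂ (λ e v → (+ e ℤ.- + v + 1ℤ) ℤ.- genus G) #E-cover #V-cover)
          (lemma (+ #E G) (+ sizes antiVector) (+ #V G) (+ u))
          where
          lemma : ∀ e s v u → ((e + s) ℤ.- (v + u) + 1ℤ) ℤ.- (e ℤ.- v + 1ℤ) ≡ s ℤ.- u
          lemma = solve-∀

        as-integers : + length (antiTree F) + + ∣ F ∣ ≡ + sizes antiVector + + n-dil
        as-integers = cong +_ length-antiTree

        V-integers : + n-dil + + u ≡ + #V G
        V-integers = cong +_ n-dil+u

      -- The genus difference is the number of undilated edges minus the number of undilated
      -- vertices, so the cardinality of an ogod is precisely what makes its determinant square.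
      genus⇒length : + ∣ F ∣ ≡ genus G̃ ℤ.- genus G → length (antiTree F) ≡ #V G
      genus⇒length eq = ℤₚ.+-injective (begin
        + length (antiTree F)
          ≡⟨ lemma₁ (+ length (antiTree F)) (+ ∣ F ∣) ⟩
        (+ length (antiTree F) + + ∣ F ∣) ℤ.- + ∣ F ∣
          ≡⟨ cong₂ ℤ._-_ as-integers (trans eq genus-difference) ⟩
        (+ sizes antiVector + + n-dil) ℤ.- (+ sizes antiVector ℤ.- + u)
          ≡⟨ lemma₂ (+ sizes antiVector) (+ n-dil) (+ u) ⟩
        + n-dil + + u
          ≡⟨ V-integers ⟩
        + #V G ∎)
        where
        lemma₁ : ∀ a b → a ≡ (a + b) ℤ.- b
        lemma₁ = solve-∀
        lemma₂ : ∀ s n u → (s + n) ℤ.- (s ℤ.- u) ≡ n + u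
        lemma₂ = solve-∀

      length⇒genus : length (antiTree F) ≡ #V G → + ∣ F ∣ ≡ genus G̃ ℤ.- genus G
      length⇒genus len = begin
        + ∣ F ∣
          ≡⟨ lemma₁ (+ length (antiTree F)) (+ ∣ F ∣) ⟩
        (+ length (antiTree F) + + ∣ F ∣) ℤ.- + length (antiTree F)
          ≡⟨ cong₂ ℤ._-_ as-integers (trans (cong +_ len) (sym V-integers)) ⟩
        (+ sizes antiVector + + n-dil) ℤ.- (+ n-dil + + u)
          ≡⟨ lemma₂ (+ sizes antiVector) (+ n-dil) (+ u) ⟩
        + sizes antiVector ℤ.- + u
          ≡⟨ genus-difference ⟨
        genus G̃ ℤ.- genus G ∎
        where
        lemma₁ : ∀ a b → b ≡ (a + b) ℤ.- a
        lemma₁ = solve-∀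
        lemma₂ : ∀ s n u → (s + n) ℤ.- (n + u) ≡ s ℤ.- u
        lemma₂ = solve-∀

      det-¬ogod : ¬ IsOgod F → det (antiTree F) ≡ 0ℤ
      det-¬ogod ¬ogod with length (antiTree F) ℕₚ.≟ #V G | Finₚ.all? (λ v → connected? (preimage (component (G ∖ F) v)))
      ... | no len≢ | _        = det-length (antiTree F) len≢
      ... | yes _   | no ¬conn = det-antiTree-disconnected F ¬conn
      ... | yes len | yes conn = contradiction (length⇒genus len , undil , conn) ¬ogod

    -- Coordinates in which the deck involution is diagonal.

    private
      o = origin G
      x₀ = lift o

    symmetricUnit : Vect (#V G ℕ.+ #V G)
    symmetricUnit = 0⃗ {#V G} ⊕ δ o

    private
      Φ : Fin (#V G̃) → Vect (#V G ℕ.+ #V G)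
      Φ x = ψ x ⊕ δ (πV x)

    split-⊖ : ∀ x y i → ((ψ x ⊖ ψ y) ⊕ (δ (πV x) ⊖ δ (πV y))) i ≡ (Φ x ⊖ Φ y) i
    split-⊖ x y i = trans (sym (⊕-+ (ψ x) (λ j → -1ℤ * ψ y j) (δ (πV x)) (λ j → -1ℤ * δ (πV y) j) i))
      (cong (λ z → (ψ x ⊕ δ (πV x)) i + z) (sym (⊕-* -1ℤ (ψ y) (δ (πV y)) i)))

    private
      -- The reversal matches the accumulator of `Z-forced`.
      extra = List.map (_⊕ 0⃗) dilatedUnits ʳ++ symmetricUnit ∷ []

      -- The lifts of an undilated vertex differ by twice its antisymmetric unit; at a dilated
      -- vertex the unit itself is among the extra vectors.
      scale : Fin (#V G) → ℤ
      scale v = if does (undilatedV? v) then + 2 else 1ℤ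

      anti sym′ : Fin (#V G) → Vect (#V G)
      anti v i = scale v * δ v i
      sym′ v with v Finₚ.≟ o
      ... | yes _ = 0⃗
      ... | no _  = ψ (lift v) ⊖ ψ x₀

      antiRows = tabulate (λ v → anti v ⊕ 0⃗ {#V G})
      symRows  = tabulate (λ v → sym′ v ⊕ row G v)
      basis    = antiRows ++ symRows

      -- The antisymmetric parts `sym′` of the symmetric rows lie off the diagonal blocks and drop
      -- out; the symmetric block is unimodular.
      det-basis : det basis ≡ ∏ scale
      det-basis = trans (det-lower-block anti sym′ (row G)
          (λ {v} v<j → trans (cong (scale v *_) (δ-distinct (Finₚ.<⇒≢ v<j))) (ℤₚ.*-zeroʳ (scale v))))
        (trans (cong₂ _*_ (∏-cong λ v → trans (cong (scale v *_) (δ-same v)) (ℤₚ.*-identityʳ (scale v))) (det-row G))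
               (ℤₚ.*-identityʳ (∏ scale)))
        where
        ∏-cong : ∀ {n} {f g : Fin n → ℤ} → f ≗ g → ∏ f ≡ ∏ g
        ∏-cong {zero}  f≗g = refl
        ∏-cong {suc n} f≗g = cong₂ _*_ (f≗g zero) (∏-cong (f≗g ∘ suc))

      det²-basis : det basis * det basis ≡ + (4 ℕ.^ u)
      det²-basis = trans (cong₂ _*_ det-basis det-basis) (∏-doubling² undilatedV? (λ _ → refl))

      extra-↭ : extra ↭ List.map (_⊕ 0⃗) dilatedUnits ++ symmetricUnit ∷ []
      extra-↭ = ↭-trans (↭-reflexive (Listₚ.ʳ++-defn (List.map (_⊕ 0⃗) dilatedUnits)))
                        (Permₚ.++⁺ʳ (symmetricUnit ∷ []) (Permₚ.↭-reverse (List.map (_⊕ 0⃗) dilatedUnits)))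

      unit∈extra : ∀ {v} → DilatedV v → (δ v ⊕ 0⃗) ∈ₗ extra
      unit∈extra dil = Permₚ.∈-resp-↭ (↭-sym extra-↭) (∈-++⁺ˡ (∈-map⁺ (_⊕ 0⃗) (∈-dilatedUnits dil)))

      symmetricUnit∈extra : symmetricUnit ∈ₗ extra
      symmetricUnit∈extra = Permₚ.∈-resp-↭ (↭-sym extra-↭) (∈-++⁺ʳ (List.map (_⊕ 0⃗) dilatedUnits) (here refl))

      All-extra : ∀ {p} {P : Pred (Vect (#V G ℕ.+ #V G)) p} →
                  (∀ {v} → DilatedV v → P (δ v ⊕ 0⃗)) → P symmetricUnit → All P extra
      All-extra pd ps = Permₚ.All-resp-↭ (↭-sym extra-↭) (Allₚ.++⁺ (Allₚ.map⁺ (All-dilatedUnits pd)) (ps ∷ []))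

      length-extra : length extra ℕ.+ #V G̃ ≡ suc (#V G ℕ.+ #V G)
      length-extra = begin
        length extra ℕ.+ #V G̃
          ≡⟨ cong₂ ℕ._+_ (trans (Permₚ.↭-length extra-↭) (trans (Listₚ.length-++ (List.map (_⊕ 0⃗) dilatedUnits))
               (cong (ℕ._+ 1) (trans (Listₚ.length-map (_⊕ 0⃗) dilatedUnits) length-dilatedUnits)))) #V-cover ⟩
        (n-dil ℕ.+ 1) ℕ.+ (#V G ℕ.+ u)
          ≡⟨ lemma n-dil (#V G) u ⟩
        suc (#V G ℕ.+ (n-dil ℕ.+ u))
          ≡⟨ cong (λ k → suc (#V G ℕ.+ k)) n-dil+u ⟩
        suc (#V G ℕ.+ #V G) ∎
        where
        lemma : ∀ n v u → (n ℕ.+ 1) ℕ.+ (v ℕ.+ u) ≡ suc (v ℕ.+ (n ℕ.+ u))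
        lemma = ℕSolver.solve-∀

      scale-dilated : ∀ {v} → DilatedV v → anti v ≗ δ v
      scale-dilated {v} dil i = trans
        (cong (λ b → (if b then + 2 else 1ℤ) * δ v i) (dec-false (undilatedV? v) (λ ¬dil → ¬dil dil)))
        (ℤₚ.*-identityˡ (δ v i))

      scale-undilated : ∀ {v} → ¬ DilatedV v → anti v ≗ (λ i → + 2 * δ v i)
      scale-undilated {v} ¬dil i =
        cong (λ b → (if b then + 2 else 1ℤ) * δ v i) (dec-true (undilatedV? v) ¬dil)

      anti∈ : ∀ v → Span basis (anti v ⊕ 0⃗)
      anti∈ v = span-∈ (∈-++⁺ˡ (∈-tabulate⁺ {f = λ v → anti v ⊕ 0⃗} v))

      sym∈ : ∀ v → Span basis (sym′ v ⊕ row G v)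
      sym∈ v = span-∈ (∈-++⁺ʳ antiRows (∈-tabulate⁺ {f = λ v → sym′ v ⊕ row G v} v))

      sym-row : ∀ {v} → v ≢ o → ∀ i → (sym′ v ⊕ row G v) i ≡ (Φ (lift v) ⊖ Φ x₀) i
      sym-row {v} v≢o i with v Finₚ.≟ o
      ... | yes v≡o = contradiction v≡o v≢o
      ... | no _    = trans (⊕-cong (λ _ → refl)
        (λ j → cong₂ (λ a b → a + -1ℤ * b) (cong (λ w → δ w j) (sym (π-lift v))) (cong (λ w → δ w j) (sym (π-lift o)))) i)
        (split-⊖ (lift v) x₀ i)

      sym-row-origin : ∀ i → (sym′ o ⊕ row G o) i ≡ symmetricUnit i
      sym-row-origin i with o Finₚ.≟ o
      ... | yes _  = refl
      ... | no o≢o = contradiction refl o≢o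

      lifts-difference : ∀ {v} → ¬ DilatedV v → ∀ i → ((λ j → + 2 * δ v j) ⊕ 0⃗) i ≡ (Φ (lift v) ⊖ Φ (colift v)) i
      lifts-difference {v} ¬dil i = trans (⊕-cong pointwise₁ pointwise₂ i) (split-⊖ (lift v) (colift v) i)
        where
        lemma₁ : ∀ a → + 2 * a ≡ a + -1ℤ * (-1ℤ * a)
        lemma₁ = solve-∀
        pointwise₁ : ∀ j → + 2 * δ v j ≡ (ψ (lift v) ⊖ ψ (colift v)) j
        pointwise₁ j = trans (lemma₁ (δ v j)) (sym (cong₂ (λ a b → a + -1ℤ * b) (ψ-lift ¬dil j) (ψ-colift ¬dil j)))
        lemma₂ : ∀ a → 0ℤ ≡ a + -1ℤ * a
        lemma₂ = solve-∀
        pointwise₂ : ∀ j → 0ℤ ≡ (δ (πV (lift v)) ⊖ δ (πV (colift v))) j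
        pointwise₂ j = trans (lemma₂ (δ v j)) (sym (cong₂ (λ a b → a + -1ℤ * b)
          (cong (λ w → δ w j) (π-lift v)) (cong (λ w → δ w j) (π-colift v))))

      basis-spanned : ∀ {as} → (∀ {a} → a ∈ₗ extra → a ∈ₗ as) → (∀ x y → Span as (Φ x ⊖ Φ y)) → All (Span as) basis
      basis-spanned {as} extra⊆ spans = Allₚ.++⁺ (Allₚ.tabulate⁺ antiSpan) (Allₚ.tabulate⁺ symSpan)
        where
        antiSpan : ∀ v → Span as (anti v ⊕ 0⃗)
        antiSpan v = split-cases (dilatedV? v)
          where
          split-cases : Dec (DilatedV v) → Span as (anti v ⊕ 0⃗)
          split-cases (yes dil) = span-cong (⊕-cong (sym ∘ scale-dilated dil) (λ _ → refl)) (span-∈ (extra⊆ (unit∈extra dil)))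
          split-cases (no ¬dil) = span-cong
            (λ i → trans (sym (lifts-difference ¬dil i)) (⊕-cong (sym ∘ scale-undilated ¬dil) (λ _ → refl) i))
            (spans (lift v) (colift v))
        symSpan : ∀ v → Span as (sym′ v ⊕ row G v)
        symSpan v = [ (λ { refl → span-cong (sym ∘ sym-row-origin) (span-∈ (extra⊆ symmetricUnit∈extra)) })
                    , (λ v≢o → span-cong (sym ∘ sym-row v≢o) (spans (lift v) x₀)) ]′ (cases v)
          where
          cases : ∀ v → v ≡ o ⊎ v ≢ o
          cases v with v Finₚ.≟ o
          ... | yes v≡o = inj₁ v≡o
          ... | no v≢o  = inj₂ v≢o

      Φ-spanned : ∀ x y → Span basis (Φ x ⊖ Φ y)
      Φ-spanned x y = chain (Φ x) (Φ x₀) (Φ y) (toOrigin x) (span-flip (Φ y) (Φ x₀) (toOrigin y))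
        where
        liftToOrigin : ∀ v → Span basis (Φ (lift v) ⊖ Φ x₀)
        liftToOrigin v with v Finₚ.≟ o in eq
        ... | yes refl = ⊖-self (Φ x₀)
        ... | no v≢o   = span-cong (sym-row v≢o) (sym∈ v)
        toLift : ∀ {x v} → πV x ≡ v → Span basis (Φ (lift v) ⊖ Φ x)
        toLift {x} {v} πx with over πx
        ... | inj₁ refl = ⊖-self (Φ (lift v))
        ... | inj₂ refl with dilatedV? v
        ...   | yes dil = subst (λ z → Span basis (Φ (lift v) ⊖ Φ z)) (lift≡colift dil) (⊖-self (Φ (lift v)))
        ...   | no ¬dil = span-cong (λ i → trans (⊕-cong (scale-undilated ¬dil) (λ _ → refl) i) (lifts-difference ¬dil i)) (anti∈ v)
        toOrigin : ∀ x → Span basis (Φ x ⊖ Φ x₀)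
        toOrigin x = chain (Φ x) (Φ (lift (πV x))) (Φ x₀)
          (span-flip (Φ (lift (πV x))) (Φ x) (toLift refl)) (liftToOrigin (πV x))

      -- Splits `g` into its symmetric and antisymmetric parts. The multiplier 2 clears the
      -- denominator of the two projections, and the constant `s o` is subtracted so that the
      -- functional vanishes on `symmetricUnit`.
      functional : (g : Fin (#V G̃) → ℤ) → ∃ λ f → ∃ λ k → ∃ λ b →
                   k ≢ 0ℤ × (∀ x → ⟨ f , Φ x ⟩ ≡ k * g x + b) × All (λ z → ⟨ f , z ⟩ ≡ 0ℤ) extra
      functional g = fa ⊕ fs , + 2 , -1ℤ * s o , (λ ()) , value , All-extra (λ {v} → onUnit) onSymmetric
        where
        fa s fs : Vect (#V G)
        fa v = g (lift v) + -1ℤ * g (colift v)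
        s v  = g (lift v) + g (colift v)
        fs v = s v + -1ℤ * s o
        zero-difference : ∀ a → a + -1ℤ * a ≡ 0ℤ
        zero-difference = solve-∀
        fa-dilated : ∀ {v} → DilatedV v → fa v ≡ 0ℤ
        fa-dilated {v} dil = trans (cong (λ z → g z + -1ℤ * g (colift v)) (lift≡colift dil)) (zero-difference (g (colift v)))
        onUnit : ∀ {v} → DilatedV v → ⟨ fa ⊕ fs , δ v ⊕ 0⃗ ⟩ ≡ 0ℤ
        onUnit {v} dil = trans (⟨⊕,⊕⟩ fa (δ v) fs 0⃗) (cong₂ _+_ (trans (⟨⟩-δ fa v) (fa-dilated dil)) (⟨⟩-zero fs))
        onSymmetric : ⟨ fa ⊕ fs , symmetricUnit ⟩ ≡ 0ℤ
        onSymmetric = trans (⟨⊕,⊕⟩ fa 0⃗ fs (δ o)) (cong₂ _+_ (⟨⟩-zero fa) (trans (⟨⟩-δ fs o) (zero-difference (s o))))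
        lemma₊ : ∀ a b c → 1ℤ * (a + -1ℤ * b) + ((a + b) + c) ≡ + 2 * a + c
        lemma₊ = solve-∀
        lemma₋ : ∀ a b c → -1ℤ * (a + -1ℤ * b) + ((a + b) + c) ≡ + 2 * b + c
        lemma₋ = solve-∀
        lemma₀ : ∀ a c → 0ℤ + ((a + a) + c) ≡ + 2 * a + c
        lemma₀ = solve-∀
        over-value : ∀ {x v} → πV x ≡ v → sgn x * fa v + fs v ≡ + 2 * g x + -1ℤ * s o
        over-value {x} {v} πx with dilatedV? v | over πx
        ... | no ¬dil | inj₁ refl = trans (cong (λ t → t * fa v + fs v) (sgn-lift ¬dil)) (lemma₊ (g (lift v)) (g (colift v)) _)
        ... | no ¬dil | inj₂ refl = trans (cong (λ t → t * fa v + fs v) (sgn-colift ¬dil)) (lemma₋ (g (lift v)) (g (colift v)) _)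
        ... | yes dil | inj₁ refl = trans (cong₂ (λ a b → a + (g (lift v) + b + -1ℤ * s o))
                (trans (cong (sgn (lift v) *_) (fa-dilated dil)) (ℤₚ.*-zeroʳ (sgn (lift v)))) (cong g (sym (lift≡colift dil))))
                (lemma₀ (g (lift v)) _)
        ... | yes dil | inj₂ refl = trans (cong₂ (λ a b → a + (b + g (colift v) + -1ℤ * s o))
                (trans (cong (sgn (colift v) *_) (fa-dilated dil)) (ℤₚ.*-zeroʳ (sgn (colift v)))) (cong g (lift≡colift dil)))
                (lemma₀ (g (colift v)) _)
        value : ∀ x → ⟨ fa ⊕ fs , Φ x ⟩ ≡ + 2 * g x + -1ℤ * s o
        value x = trans (⟨⊕,⊕⟩ fa (ψ x) fs (δ (πV x)))
          (trans (cong₂ _+_ (trans (⟨⟩-* fa (sgn x) (δ (πV x))) (cong (sgn x *_) (⟨⟩-δ fa (πV x)))) (⟨⟩-δ fs (πV x)))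
                 (over-value refl))

    split : Realisation G̃ (#V G ℕ.+ #V G)
    split = record
      { φ = Φ
      ; extra = extra
      ; basis = basis
      ; length-basis = trans (Listₚ.length-++ antiRows)
          (cong₂ ℕ._+_ (Listₚ.length-tabulate (λ v → anti v ⊕ 0⃗)) (Listₚ.length-tabulate (λ v → sym′ v ⊕ row G v)))
      ; length-extra = length-extra
      ; det-basis≢0 = λ eq → ℕₚ.<⇒≢ (ℕₚ.m^n>0 4 u) (ℤₚ.+-injective (trans (sym (cong₂ _*_ eq eq)) det²-basis))
      ; basis-spanned = basis-spanned
      ; extra-spanned = All-extra
          (λ {v} dil → span-cong (⊕-cong (scale-dilated dil) (λ _ → refl)) (anti∈ v))
          (span-cong sym-row-origin (sym∈ o))
      ; φ-spanned = Φ-spanned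
      ; functional = functional
      }

    det²-split : det (Realisation.basis split) * det (Realisation.basis split) ≡ + (4 ℕ.^ u)
    det²-split = det²-basis

-- Factorisation of the generating function and the power of two.

module Factorisation {c ℓ p} (K : LengthRing c ℓ p) where

  open import Data.Fin.Subset using (Subset; _∈_; ∁; inside; outside; ∣_∣)
  open import Data.Vec.Base using ([]; _∷_)
  open import Data.Integer.Base as ℤ using (ℤ; +_; 0ℤ; 1ℤ; -1ℤ)
  open import Data.Product using (∃; _×_; _,_; proj₁; proj₂)
  open import Relation.Binary.PropositionalEquality as ≡ using (_≡_)
  open LengthRing K using (commutativeRing; Σ⊆; ∏∈; _^_; _·_; ½; ½+½≈1; 2^_)
  open CommutativeRing commutativeRing hiding (zero)
  open import Algebra.Properties.Semiring.Exp semiring using (^-homo-*)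
  open import Algebra.Properties.Semiring.Mult semiring using (×1-homo-*)
  open import Algebra.Solver.Ring.NaturalCoefficients.Default commutativeSemiring
    using (solve; _:=_; _:+_; _:*_; con)
  open import Relation.Binary.Reasoning.Setoid setoid
  open ExteriorAlgebra using (Vect; Λ; ⋀; det; _∧_; 𝟙)
  open Triangular
  open FromInteger commutativeRing
  open GeneratingFunction commutativeRing
  open Complements
  open CauchyBinet K
  open Units
  open Trees
  open Fibres
  open Counting
  open Realisations
  open Graph
  open MetricGraph

  private
    variable
      q : Level
      n N : ℕ

  ½*2 : ½ * 2# ≈ 1#
  ½*2 = trans (solve 1 (λ h → h :* (con 1 :+ con 1) := h :+ h) refl ½) ½+½≈1

  ^-inverse : ∀ k → ½ ^ k * 2# ^ k ≈ 1#
  ^-inverse zero    = *-identityˡ 1#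
  ^-inverse (suc k) = begin
    ½ * ½ ^ k * (2# * 2# ^ k)       ≈⟨ solve 4 (λ a b c d → a :* b :* (c :* d) := (a :* c) :* (b :* d)) refl ½ (½ ^ k) 2# (2# ^ k) ⟩
    ½ * 2# * (½ ^ k * 2# ^ k)       ≈⟨ *-cong ½*2 (^-inverse k) ⟩
    1# * 1#                         ≈⟨ *-identityˡ 1# ⟩
    1#                              ∎

  2^-⊖ : ∀ m n → 2^ (m ℤ.⊖ n) ≈ 2# ^ m * ½ ^ n
  2^-⊖ m       zero    = sym (*-identityʳ _)
  2^-⊖ zero    (suc n) = sym (*-identityˡ _)
  2^-⊖ (suc m) (suc n) = begin
    2^ (suc m ℤ.⊖ suc n)           ≡⟨ ≡.cong 2^_ (ℤₚ.[1+m]⊖[1+n]≡m⊖n m n) ⟩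
    2^ (m ℤ.⊖ n)                   ≈⟨ 2^-⊖ m n ⟩
    2# ^ m * ½ ^ n                 ≈⟨ *-identityˡ _ ⟨
    1# * (2# ^ m * ½ ^ n)          ≈⟨ *-congʳ ½*2 ⟨
    ½ * 2# * (2# ^ m * ½ ^ n)      ≈⟨ solve 4 (λ a b c d → a :* b :* (c :* d) := (b :* c) :* (a :* d)) refl ½ 2# (2# ^ m) (½ ^ n) ⟩
    2# * 2# ^ m * (½ * ½ ^ n)      ∎

  four : 4 · 1# ≈ 2# * 2#
  four = solve 0 (con 1 :+ (con 1 :+ (con 1 :+ (con 1 :+ con 0))) := (con 1 :+ con 1) :* (con 1 :+ con 1)) refl

  fromℤ-4^ : ∀ k → fromℤ (+ (4 ℕ.^ k)) ≈ (4 · 1#) ^ k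
  fromℤ-4^ zero    = +-identityʳ 1#
  fromℤ-4^ (suc k) = trans (×1-homo-* 4 (4 ℕ.^ k)) (*-congˡ (fromℤ-4^ k))

  4^≈2^*2^ : ∀ k → (4 · 1#) ^ k ≈ 2# ^ k * 2# ^ k
  4^≈2^*2^ zero    = sym (*-identityˡ 1#)
  4^≈2^*2^ (suc k) = trans (*-cong four (4^≈2^*2^ k))
    (solve 2 (λ a b → (a :* a) :* (b :* b) := (a :* b) :* (a :* b)) refl 2# (2# ^ k))

  ∏∈-const : ∀ (C : Subset n) r → ∏∈ C (const r) ≈ r ^ ∣ C ∣
  ∏∈-const []            r = refl
  ∏∈-const (outside ∷ C) r = trans (*-identityˡ _) (∏∈-const C r)
  ∏∈-const (inside  ∷ C) r = *-congˡ (∏∈-const C r)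

  ≈-if : ∀ {a} {A : Set a} (A? : Dec A) {x y z} → (A → x ≈ y * z) → (¬ A → x ≈ 0#) →
         x ≈ y * (if does A? then z else 0#)
  ≈-if (yes a) {y = y} x≈ _ = x≈ a
  ≈-if (no ¬a) {y = y} _ x≈ = trans (x≈ ¬a) (sym (zeroʳ y))

  module _ (Γ : MetricGraph K) (r : Realisation (graph Γ) N) where
    open Realisation r using (extra; basis)
    open MatrixTree r

    treeFactor : Carrier → Fin (#E (graph Γ)) → Factor N
    treeFactor β e = factor (len Γ e) β (just (edgeVector e))

    isCotree? : Decidable IsCotree
    isCotree? C = (+ ∣ C ∣ ℤₚ.≟ genus (graph Γ)) ×-dec isTree? (graph Γ ∖ C)

    -- A spanning tree has one edge fewer than vertices; the additional β on the left completes the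
    -- exponent to `#V`.
    Z-Jacobian : ∀ β → β * Z (tabulate (treeFactor β)) (⋀ extra) (⋀ extra) ≈
                 fromℤ (det basis ℤ.* det basis) * β ^ #V (graph Γ) * JacobianPolynomial Γ
    Z-Jacobian β = begin
      β * Z (tabulate (treeFactor β)) (⋀ extra) (⋀ extra)
        ≈⟨ *-congˡ (Z-Σ (len Γ) (const β) (just ∘ edgeVector) extra) ⟩
      β * Σ⊆ (λ C → ∏∈ C (len Γ) * ∏∈ (∁ C) (const β) * fromℤ (det (cotree C) ℤ.* det (cotree C)))
        ≈⟨ Σ⊆-* {#E (graph Γ)} β _ ⟩
      Σ⊆ (λ C → β * (∏∈ C (len Γ) * ∏∈ (∁ C) (const β) * fromℤ (det (cotree C) ℤ.* det (cotree C))))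
        ≈⟨ Σ⊆-cong term ⟩
      Σ⊆ (λ C → scale * (if does (isCotree? C) then ∏∈ C (len Γ) else 0#))
        ≈⟨ Σ⊆-* {#E (graph Γ)} scale _ ⟨
      scale * JacobianPolynomial Γ ∎
      where
      scale = fromℤ (det basis ℤ.* det basis) * β ^ #V (graph Γ)
      term : ∀ C → β * (∏∈ C (len Γ) * ∏∈ (∁ C) (const β) * fromℤ (det (cotree C) ℤ.* det (cotree C))) ≈
                   scale * (if does (isCotree? C) then ∏∈ C (len Γ) else 0#)
      term C = ≈-if (isCotree? C)
        (λ cot → begin
          β * (∏∈ C (len Γ) * ∏∈ (∁ C) (const β) * fromℤ (det (cotree C) ℤ.* det (cotree C)))
            ≈⟨ *-congˡ (*-cong (*-congˡ (∏∈-const (∁ C) β)) (reflexive (≡.cong fromℤ (det²-cotree C cot)))) ⟩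
          β * (∏∈ C (len Γ) * β ^ ∣ ∁ C ∣ * fromℤ (det basis ℤ.* det basis))
            ≈⟨ solve 4 (λ b x y z → b :* (x :* y :* z) := z :* (b :* y) :* x) refl β _ _ _ ⟩
          fromℤ (det basis ℤ.* det basis) * β ^ suc ∣ ∁ C ∣ * ∏∈ C (len Γ)
            ≡⟨ ≡.cong (λ k → fromℤ (det basis ℤ.* det basis) * β ^ k * ∏∈ C (len Γ)) (size-cotree C cot) ⟩
          scale * ∏∈ C (len Γ) ∎)
        (λ ¬cot → trans
          (*-congˡ (trans (*-congˡ (reflexive (≡.cong (λ d → fromℤ (d ℤ.* d)) (det-¬cotree C ¬cot)))) (zeroʳ _)))
          (zeroʳ β))

  module _ (Γ̃ Γ : MetricGraph K) (π : MetricDoubleCover Γ̃ Γ) where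
    open MetricDoubleCover π
    private
      G̃ = graph Γ̃
      G = graph Γ
    open Covers cover
    open Ogods cover
    open Rank cover

    -- The value 0 suppresses every set containing a dilated edge. A kept edge weighs 2, from the
    -- operator 2 t ⊗ t, if it is undilated, and 1 otherwise.
    antiWeight-in antiWeight-out : Fin (#E G) → Carrier
    antiWeight-in e  = maybe (const (len Γ e)) 0# (antiVector e)
    antiWeight-out e = 2# ^ size (antiVector e)

    antiFactor : Fin (#E G) → Factor (#V G)
    antiFactor e = factor (antiWeight-in e) (antiWeight-out e) (antiVector e)

    private
      -- `k` is the number of vectors added to `acc`; each brings one factor 2.
      ∏-out : ∀ {m} (F : Subset m) (v : Fin m → Maybe (Vect N)) acc → ∃ λ k →
              length (outs F v acc) ≡ k ℕ.+ length acc × ∏∈ (∁ F) (λ i → 2# ^ size (v i)) ≈ 2# ^ k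
      ∏-out []            v acc = 0 , ≡.refl , refl
      ∏-out (inside  ∷ F) v acc with ∏-out F (v ∘ suc) acc
      ... | k , len , eq = k , len , trans (*-identityˡ _) eq
      ∏-out (outside ∷ F) v acc with v zero
      ... | nothing with ∏-out F (v ∘ suc) acc
      ...   | k , len , eq = k , len , trans (*-identityˡ _) eq
      ∏-out (outside ∷ F) v acc | just a with ∏-out F (v ∘ suc) (a ∷ acc)
      ...   | k , len , eq = suc k , ≡.trans len (ℕₚ.+-suc k (length acc)) , *-cong (*-identityʳ 2#) eq

      undilated? : ∀ F → Dec (∀ e → e ∈ F → ¬ DilatedE e)
      undilated? F = Finₚ.all? λ e → (e ∈? F) →-dec ¬? (dilatedE? e)

      rank>0 : ∀ F → 0 ℕ.< rank F
      rank>0 F = #components>0 (G ∖ F) {origin G} ∈⊤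

      antiTerm : Subset (#E G) → Carrier
      antiTerm F = ∏∈ F antiWeight-in * ∏∈ (∁ F) antiWeight-out * fromℤ (det (antiTree F) ℤ.* det (antiTree F))

      prymTerm : Subset (#E G) → Carrier
      prymTerm F = (4 · 1#) ^ (rank F ℕ.∸ 1) * ∏∈ F (len Γ)

      -- The squared determinant is 4^(r-d), and the factor 4^d on the left avoids the subtraction.
      -- The list `antiTree F` has `#V G` members, of which `n-dil` are units, so `u` kept edges
      -- weigh 2. The 4 on the right compensates for the exponent r - 1.
      ogodTerm : ∀ F → IsOgod F → (4 · 1#) ^ d-dil * antiTerm F ≈ 2# ^ u cover * (4 · 1#) * prymTerm F
      ogodTerm F (card , undil , conn) = begin
        (4 · 1#) ^ d-dil * (∏∈ F antiWeight-in * ∏∈ (∁ F) antiWeight-out * fromℤ (det (antiTree F) ℤ.* det (antiTree F)))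
          ≈⟨ *-congˡ (*-cong (*-cong weights-in weights-out) det²) ⟩
        (4 · 1#) ^ d-dil * (∏∈ F (len Γ) * 2# ^ u cover * (4 · 1#) ^ count (freeRep? F))
          ≈⟨ solve 4 (λ a b c d → a :* (b :* c :* d) := c :* (d :* a) :* b) refl _ _ _ _ ⟩
        2# ^ u cover * ((4 · 1#) ^ count (freeRep? F) * (4 · 1#) ^ d-dil) * ∏∈ F (len Γ)
          ≈⟨ *-congʳ (*-congˡ (^-homo-* (4 · 1#) (count (freeRep? F)) d-dil)) ⟨
        2# ^ u cover * (4 · 1#) ^ (count (freeRep? F) ℕ.+ d-dil) * ∏∈ F (len Γ)
          ≡⟨ ≡.cong (λ k → 2# ^ u cover * (4 · 1#) ^ k * ∏∈ F (len Γ))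
               (≡.trans (≡.sym (rank-split F conn len≡ undil)) (≡.sym (ℕₚ.m+[n∸m]≡n (rank>0 F)))) ⟩
        2# ^ u cover * ((4 · 1#) * (4 · 1#) ^ (rank F ℕ.∸ 1)) * ∏∈ F (len Γ)
          ≈⟨ solve 4 (λ a b c d → a :* (b :* c) :* d := a :* b :* (c :* d)) refl _ (4 · 1#) _ _ ⟩
        2# ^ u cover * (4 · 1#) * ((4 · 1#) ^ (rank F ℕ.∸ 1) * ∏∈ F (len Γ)) ∎
        where
        len≡ = genus⇒length cover F undil card
        weights-in : ∏∈ F antiWeight-in ≈ ∏∈ F (len Γ)
        weights-in = ∏∈-cong F λ e e∈ → reflexive
          (≡.cong (maybe (const (len Γ e)) 0#) (proj₂ (antiVector-undilated (undil e e∈))))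
        weights-out : ∏∈ (∁ F) antiWeight-out ≈ 2# ^ u cover
        weights-out with ∏-out F antiVector dilatedUnits
        ... | k , len , eq = trans eq (reflexive (≡.cong (2# ^_) (ℕₚ.+-cancelʳ-≡ n-dil k (u cover)
          (≡.trans (≡.cong (k ℕ.+_) (≡.sym (length-dilatedUnits cover))) (≡.trans (≡.sym len)
            (≡.trans len≡ (≡.trans (≡.sym (n-dil+u cover)) (ℕₚ.+-comm n-dil (u cover)))))))))
        det² : fromℤ (det (antiTree F) ℤ.* det (antiTree F)) ≈ (4 · 1#) ^ count (freeRep? F)
        det² = trans (reflexive (≡.cong fromℤ (det²-antiTree F conn len≡))) (fromℤ-4^ (count (freeRep? F)))

      ¬ogodTerm : ∀ F → ¬ IsOgod F → antiTerm F ≈ 0#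
      ¬ogodTerm F ¬ogod with undilated? F
      ... | yes undil = trans (*-congˡ (reflexive (≡.cong (λ d → fromℤ (d ℤ.* d)) (det-¬ogod cover F undil ¬ogod)))) (zeroʳ _)
      ... | no ¬undil with Finₚ.¬∀⟶∃¬ _ _ (λ e → (e ∈? F) →-dec ¬? (dilatedE? e)) ¬undil
      ...   | e , ¬impl with e ∈? F | dilatedE? e
      ...     | no e∉  | _       = contradiction (λ e∈ → contradiction e∈ e∉) ¬impl
      ...     | yes e∈ | no ¬dil = contradiction (λ _ → ¬dil) ¬impl
      ...     | yes e∈ | yes dil = trans (*-congʳ (trans (*-congʳ (∏∈-zero e∈
                  (reflexive (≡.cong (maybe (const (len Γ e)) 0#) (antiVector-dilated dil))))) (zeroˡ _))) (zeroˡ _)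

    Z-Prym : (4 · 1#) ^ d-dil * Z (tabulate antiFactor) (⋀ dilatedUnits) (⋀ dilatedUnits) ≈
             2# ^ u cover * (4 · 1#) * PrymPolynomial π
    Z-Prym = begin
      (4 · 1#) ^ d-dil * Z (tabulate antiFactor) (⋀ dilatedUnits) (⋀ dilatedUnits)
        ≈⟨ *-congˡ (Z-Σ antiWeight-in antiWeight-out antiVector dilatedUnits) ⟩
      (4 · 1#) ^ d-dil * Σ⊆ antiTerm
        ≈⟨ Σ⊆-* _ antiTerm ⟩
      Σ⊆ (λ F → (4 · 1#) ^ d-dil * antiTerm F)
        ≈⟨ Σ⊆-cong term ⟩
      Σ⊆ (λ F → 2# ^ u cover * (4 · 1#) * (if does (isOgod? F) then prymTerm F else 0#))
        ≈⟨ Σ⊆-* {#E G} (2# ^ u cover * (4 · 1#)) _ ⟨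
      2# ^ u cover * (4 · 1#) * PrymPolynomial π ∎
      where
      term : ∀ F → (4 · 1#) ^ d-dil * antiTerm F ≈
                   2# ^ u cover * (4 · 1#) * (if does (isOgod? F) then prymTerm F else 0#)
      term F = ≈-if (isOgod? F) (ogodTerm F) (λ ¬ogod → trans (*-congˡ (¬ogodTerm F ¬ogod)) (zeroʳ _))

    private
      nV = #V G
      module T̃ = MatrixTree (split cover)
      module T = MatrixTree (standard G)
      open Realisation (split cover) using (φ; extra)

      coverFactor : Fin (#E G̃) → Factor (nV ℕ.+ nV)
      coverFactor = treeFactor Γ̃ (split cover) 1#

      baseFactor : Fin (#E G) → Factor nV
      baseFactor = treeFactor Γ (standard G) 2#

      dilationScalar : Fin (#E G) → Carrier
      dilationScalar e = maybe (const 1#) ½ (antiVector e)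

      S : Fin (#E G) → Vect (nV ℕ.+ nV)
      S e = 0⃗ ⊕ T.edgeVector e

      -- The orientation that `half G̃` gives to an edge need not lie over that of `half G`; `ε`
      -- records the comparison.
      edgeVector-lift : ∀ {e} k → πH k ≡ half G e → ∃ λ ε → ε ℤ.* ε ≡ 1ℤ × (∀ i → T̃.edgeVector (edge G̃ k) i ≡
        ε ℤ.* ((ψ (root G̃ k) ⊖ ψ (root G̃ (ι G̃ k))) ⊕ T.edgeVector e) i)
      edgeVector-lift {e} k πk = orient (T̃.half-ends k)
        where
        x = root G̃ k
        y = root G̃ (ι G̃ k)
        blocks : ∀ i → (φ x ⊖ φ y) i ≡ ((ψ x ⊖ ψ y) ⊕ T.edgeVector e) i
        blocks i = ≡.trans (≡.sym (split-⊖ cover x y i))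
          (≡.cong₂ (λ v w → ((ψ x ⊖ ψ y) ⊕ (δ v ⊖ δ w)) i)
            (≡.trans (π-root k) (≡.cong (root G) πk))
            (≡.trans (π-root (ι G̃ k)) (≡.cong (root G) (≡.trans (π-ι k) (≡.cong (ι G) πk)))))
        reverse-⊖ : ∀ a b → a ℤ.+ -1ℤ ℤ.* b ≡ -1ℤ ℤ.* (b ℤ.+ -1ℤ ℤ.* a)
        reverse-⊖ = ℤSolver.solve-∀
        orient : (x ≡ T̃.tail (edge G̃ k) × y ≡ T̃.head (edge G̃ k)) ⊎
                 (x ≡ T̃.head (edge G̃ k) × y ≡ T̃.tail (edge G̃ k)) → _
        orient (inj₁ (r , r′)) = 1ℤ , ≡.refl , λ i → ≡.trans
          (≡.cong₂ (λ x y → (φ x ⊖ φ y) i) (≡.sym r) (≡.sym r′))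
          (≡.trans (blocks i) (≡.sym (ℤₚ.*-identityˡ _)))
        orient (inj₂ (r , r′)) = -1ℤ , ≡.refl , λ i → ≡.trans
          (≡.cong₂ (λ x y → (φ x ⊖ φ y) i) (≡.sym r′) (≡.sym r))
          (≡.trans (reverse-⊖ (φ y i) (φ x i)) (≡.cong (-1ℤ ℤ.*_) (blocks i)))

      length-lift : ∀ {e} k → πH k ≡ half G e → len Γ e ≈ dE (edge G̃ k) · len Γ̃ (edge G̃ k)
      length-lift k πk = ≡.subst (λ e → len Γ e ≈ dE (edge G̃ k) · len Γ̃ (edge G̃ k)) (πE-over πk) (dilates (edge G̃ k))

      block : Fin (#E G) → List (Factor (nV ℕ.+ nV))
      block e = scalar (dilationScalar e) ∷ inʳ nV (baseFactor e) ∷ inˡ nV (antiFactor e) ∷ []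

      ≋-++ : ∀ {fs fs′ gs gs′ : List (Factor N)} → fs ≋ fs′ → gs ≋ gs′ → fs ++ gs ≋ fs′ ++ gs′
      ≋-++ {fs′ = fs′} {gs} p q = ≋-trans (≋-++ʳ gs p) (≋-++ˡ fs′ q)

      fibre-block : ∀ e → List.map coverFactor (edges-over e) ≋ block e
      fibre-block e with fibreE e
      ... | single k πk d₂ only with edgeVector-lift k πk
      ...   | ε , ε² , vec = ≋-trans
        (ε²≡1⇒≋ ε ε² refl λ i → ≡.trans (vec i) (≡.cong (ε ℤ.*_) (⊕-cong vanish (λ _ → ≡.refl) i)))
        (≋-halve ½+½≈1 doubled (S e))
        where
        dil : DilatedE (edge G (πH k))
        dil = ≡.subst DilatedE (≡.sym (≡.trans (≡.cong (edge G) πk) (edge-half G e))) (singleton⇒dilated πk only)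
        vanish : ∀ i → (ψ (root G̃ k) ⊖ ψ (root G̃ (ι G̃ k))) i ≡ 0ℤ
        vanish i = ≡.cong₂ (λ a b → a ℤ.+ -1ℤ ℤ.* b)
          (ψ-zero (proj₁ (dilated-ends k dil)) i) (ψ-zero (proj₂ (dilated-ends k dil)) i)
        doubled : len Γ̃ (edge G̃ k) + len Γ̃ (edge G̃ k) ≈ len Γ e
        doubled = sym (trans (length-lift k πk) (trans (reflexive (≡.cong (_· len Γ̃ (edge G̃ k)) d₂)) (+-congˡ (+-identityʳ _))))
      fibre-block e | double k k′ k≢k′ πk πk′ d₁ d₁′ _ with edgeVector-lift k πk | edgeVector-lift k′ πk′
      ...   | ε , ε² , vec | ε′ , ε′² , vec′ = ≋-trans
        (≋-++ (ε²≡1⇒≋ ε ε² (equal-length k πk d₁) λ i → ≡.trans (vec i) (≡.cong (ε ℤ.*_) (plus i)))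
              (ε²≡1⇒≋ ε′ ε′² (equal-length k′ πk′ d₁′) λ i → ≡.trans (vec′ i) (≡.cong (ε′ ℤ.*_) (minus i))))
        (≋-trans (≋-conjugate (len Γ e) (S e) (t ⊕ 0⃗))
        -- The weight `antiWeight-out` is `2# ^ 1`, that is `2# * 1#`, and equals `2#` only up to
        -- `≈`.
        (≋-trans (≋-scalar1 _) (≋-prep _ (≋-prep _ (weights (sym (*-identityʳ 2#)))))))
        where
        t = ψ (root G̃ k) ⊖ ψ (root G̃ (ι G̃ k))
        plus : ∀ i → (t ⊕ T.edgeVector e) i ≡ S e i ℤ.+ (t ⊕ 0⃗) i
        plus i = ≡.sym (≡.trans (⊕-+ 0⃗ t (T.edgeVector e) 0⃗ i)
          (⊕-cong (λ j → ℤₚ.+-identityˡ (t j)) (λ j → ℤₚ.+-identityʳ (T.edgeVector e j)) i))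
        minus : ∀ i → ((ψ (root G̃ k′) ⊖ ψ (root G̃ (ι G̃ k′))) ⊕ T.edgeVector e) i ≡
                      S e i ℤ.+ -1ℤ ℤ.* (t ⊕ 0⃗) i
        minus i = ≡.sym (≡.trans (≡.cong (λ z → S e i ℤ.+ z) (⊕-* -1ℤ t 0⃗ i))
          (≡.trans (⊕-+ 0⃗ (λ j → -1ℤ ℤ.* t j) (T.edgeVector e) 0⃗ i)
          (⊕-cong (λ j → ≡.trans (ℤₚ.+-identityˡ (-1ℤ ℤ.* t j)) (≡.sym (ψ-conjugate k≢k′ πk πk′ j)))
                  (λ j → ℤₚ.+-identityʳ (T.edgeVector e j)) i)))
        equal-length : ∀ k → πH k ≡ half G e → dE (edge G̃ k) ≡ 1 → len Γ̃ (edge G̃ k) ≈ len Γ e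
        equal-length k πk d₁ = sym (trans (length-lift k πk)
          (trans (reflexive (≡.cong (_· len Γ̃ (edge G̃ k)) d₁)) (+-identityʳ _)))
        weights : ∀ {α β β′} {a : Maybe (Vect N)} → β ≈ β′ → factor α β a ∷ [] ≋ factor α β′ a ∷ []
        weights β≈ = equal λ x y → +-congˡ (*-congʳ β≈)

      o = origin G
      units : List (Vect (nV ℕ.+ nV))
      units = List.map (_⊕ 0⃗) dilatedUnits
      initial : Λ (nV ℕ.+ nV)
      initial = ⋀ (symmetricUnit cover ∷ [])
      edges = allFin (#E G)
      scalars = List.map dilationScalar edges
      symmetricFactors = List.map baseFactor edges
      antiFactors = List.map antiFactor edges
      -- Reversed in advance, so that `Z-forced` restores the order of `dilatedUnits`.
      forcedUnits = List.map forced (reverse dilatedUnits)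

      -- The order is dictated by `Z-block`: symmetric factors act before antisymmetric ones, and
      -- the forced units belong to the latter.
      regroup : List.map forced units ++ tabulate coverFactor ≋
                List.map scalar scalars ++ List.map (inʳ nV) symmetricFactors ++ List.map (inˡ nV) (forcedUnits ++ antiFactors)
      regroup = ≋-trans (≋-++ˡ (List.map forced units) byBlocks) (↭⇒≋ (begin↭
        List.map forced units ++ List.map (scalar ∘ dilationScalar) edges ++ List.map (inʳ nV ∘ baseFactor) edges ++ An
          ↭⟨ Permₚ.++⁺ˡ (List.map forced units) (Perm.↭-reflexive
               (≡.cong₂ _++_ (Listₚ.map-∘ edges) (≡.cong (_++ An) (Listₚ.map-∘ edges)))) ⟩
        List.map forced units ++ Sc ++ Sy ++ An
          ↭⟨ Permₚ.shifts (List.map forced units) Sc ⟩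
        Sc ++ List.map forced units ++ Sy ++ An
          ↭⟨ Permₚ.++⁺ˡ Sc (Permₚ.shifts (List.map forced units) Sy) ⟩
        Sc ++ Sy ++ List.map forced units ++ An
          ↭⟨ Permₚ.++⁺ˡ Sc (Permₚ.++⁺ˡ Sy collect) ⟩
        Sc ++ Sy ++ List.map (inˡ nV) (forcedUnits ++ antiFactors) ∎↭))
        where
        open Perm.PermutationReasoning using (step-↭-⟩) renaming (begin_ to begin↭_; _∎ to _∎↭)
        Sc = List.map scalar scalars
        Sy = List.map (inʳ nV) symmetricFactors
        An = List.map (inˡ nV ∘ antiFactor) edges
        byBlocks : tabulate coverFactor ≋ List.map (scalar ∘ dilationScalar) edges ++ List.map (inʳ nV ∘ baseFactor) edges ++ An
        byBlocks = ≋-trans (↭⇒≋ (Perm.↭-trans (Perm.↭-reflexive (≡.sym (Listₚ.map-tabulate id coverFactor)))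
            (Perm.↭-trans (Permₚ.map⁺ coverFactor edges-↭)
              (Perm.↭-reflexive (Listₚ.map-concatMap coverFactor edges-over edges)))))
          (≋-trans (≋-concatMap edges fibre-block)
            (↭⇒≋ (concatMap-triple (scalar ∘ dilationScalar) (inʳ nV ∘ baseFactor) (inˡ nV ∘ antiFactor) edges)))
        collect : List.map forced units ++ An Perm.↭ List.map (inˡ nV) (forcedUnits ++ antiFactors)
        collect = Perm.↭-trans (Perm.↭-reflexive (≡.cong₂ _++_
            (≡.trans (≡.sym (Listₚ.map-∘ dilatedUnits)) (Listₚ.map-∘ dilatedUnits)) (Listₚ.map-∘ edges)))
          (Perm.↭-trans (Perm.↭-reflexive (≡.sym (Listₚ.map-++ (inˡ nV) (List.map forced dilatedUnits) antiFactors)))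
            (Permₚ.map⁺ (inˡ nV) (Permₚ.++⁺ʳ antiFactors (Permₚ.map⁺ forced (Perm.↭-sym (Permₚ.↭-reverse dilatedUnits))))))

      ∏-scalars : ∏ˡ scalars ≈ ½ ^ m-dil
      ∏-scalars = trans (reflexive (≡.cong ∏ˡ (Listₚ.map-tabulate id dilationScalar))) (go dilatedE? dilationScalar value)
        where
        go : ∀ {m q} {P : Pred (Fin m) q} (P? : Decidable P) (f : Fin m → Carrier) →
             (∀ i → f i ≡ (if does (P? i) then ½ else 1#)) → ∏ˡ (tabulate f) ≈ ½ ^ count P?
        go {zero}  P? f f≗ = refl
        go {suc m} P? f f≗ with does (P? zero) | f≗ zero
        ... | true  | f₀ = *-cong (reflexive f₀) (go (P? ∘ suc) (f ∘ suc) (f≗ ∘ suc))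
        ... | false | f₀ = trans (*-cong (reflexive f₀) (go (P? ∘ suc) (f ∘ suc) (f≗ ∘ suc))) (*-identityˡ _)
        value : ∀ e → dilationScalar e ≡ (if does (dilatedE? e) then ½ else 1#)
        value e = cases (dilatedE? e)
          where
          cases : (d : Dec (DilatedE e)) → dilationScalar e ≡ (if does d then ½ else 1#)
          cases (yes dil) = ≡.cong (maybe (const 1#) ½) (antiVector-dilated dil)
          cases (no ¬dil) = ≡.cong (maybe (const 1#) ½) (proj₂ (antiVector-undilated ¬dil))

    Z-factorisation : Z (tabulate coverFactor) (⋀ extra) (⋀ extra) ≈
      ½ ^ m-dil * (Z (tabulate antiFactor) (⋀ dilatedUnits) (⋀ dilatedUnits) *
                   Z (tabulate baseFactor) (⋀ (δ o ∷ [])) (⋀ (δ o ∷ [])))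
    Z-factorisation = begin
      Z (tabulate coverFactor) (⋀ extra) (⋀ extra)
        -- Turning the units into factors leaves an initial element whose antisymmetric component is
        -- `𝟙`.
        ≈⟨ Z-forced units (tabulate coverFactor) (symmetricUnit cover ∷ []) ⟨
      Z (List.map forced units ++ tabulate coverFactor) initial initial
        ≈⟨ apply regroup initial initial ⟩
      Z (List.map scalar scalars ++ pairs) initial initial
        ≈⟨ Z-scalar scalars pairs initial initial ⟩
      ∏ˡ scalars * Z pairs initial initial
        ≡⟨ ≡.cong (λ x → ∏ˡ scalars * Z pairs x x) initial≡ ⟩
      ∏ˡ scalars * Z pairs (𝟙 {nV} ⊗ ⋀ (δ o ∷ [])) (𝟙 {nV} ⊗ ⋀ (δ o ∷ []))
        ≈⟨ *-cong ∏-scalars (Z-block (forcedUnits ++ antiFactors) symmetricFactors (⋀ (δ o ∷ [])) (⋀ (δ o ∷ []))) ⟩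
      ½ ^ m-dil * (Z (forcedUnits ++ antiFactors) 𝟙 𝟙 * Z symmetricFactors (⋀ (δ o ∷ [])) (⋀ (δ o ∷ [])))
        ≈⟨ *-congˡ (*-cong (Z-forced (reverse dilatedUnits) antiFactors [])
             (reflexive (≡.cong (λ fs → Z fs (⋀ (δ o ∷ [])) (⋀ (δ o ∷ []))) (Listₚ.map-tabulate id baseFactor)))) ⟩
      ½ ^ m-dil * (Z antiFactors (⋀ (reverse dilatedUnits ʳ++ [])) (⋀ (reverse dilatedUnits ʳ++ [])) *
                   Z (tabulate baseFactor) (⋀ (δ o ∷ [])) (⋀ (δ o ∷ [])))
        ≡⟨ ≡.cong₂ (λ fs us → ½ ^ m-dil * (Z fs (⋀ us) (⋀ us) * Z (tabulate baseFactor) (⋀ (δ o ∷ [])) (⋀ (δ o ∷ []))))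
             (Listₚ.map-tabulate id antiFactor) (Listₚ.reverse-involutive dilatedUnits) ⟩
      ½ ^ m-dil * (Z (tabulate antiFactor) (⋀ dilatedUnits) (⋀ dilatedUnits) *
                   Z (tabulate baseFactor) (⋀ (δ o ∷ [])) (⋀ (δ o ∷ []))) ∎
      where
      pairs = List.map (inʳ nV) symmetricFactors ++ List.map (inˡ nV) (forcedUnits ++ antiFactors)
      initial≡ : initial ≡ 𝟙 {nV} ⊗ ⋀ (δ o ∷ [])
      initial≡ = ≡.trans (≡.cong (symmetricUnit cover ∧_) (≡.sym (𝟙⊗𝟙 nV))) (0⊕∧ nV (δ o) 𝟙)

    Kirchhoff-Prym : JacobianPolynomial Γ̃ ≈
      (2^ (+ 1 ℤ.- + m-dil ℤ.+ + n-dil ℤ.- + 2 ℤ.* + d-dil)) * PrymPolynomial π * JacobianPolynomial Γ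
    Kirchhoff-Prym = begin
      J̃
        ≈⟨ *-identityˡ J̃ ⟨
      1# * J̃
        -- The unit is written as powers of 2 times powers of ½: the former supply the multipliers
        -- in `prym`, `jacobian-base` and `jacobian-cover`, the latter undo them.
        ≈⟨ *-congʳ (trans (*-cong (trans (*-cong (^-inverse d) (^-inverse d)) (*-identityˡ 1#))
             (trans (*-cong ½*2 (trans (*-cong (^-inverse k) (^-inverse k)) (*-identityˡ 1#))) (*-identityˡ 1#))) (*-identityˡ 1#)) ⟨
      (H d * T d * (H d * T d)) * (½ * 2# * (H k * T k * (H k * T k))) * J̃
        ≈⟨ solve 7 (λ hd td h t hk tk j →
             (hd :* td :* (hd :* td)) :* (h :* t :* (hk :* tk :* (hk :* tk))) :* j :=
             (hd :* hd :* h :* (hk :* hk)) :* (td :* td :* t :* (tk :* tk :* j))) refl (H d) (T d) ½ 2# (H k) (T k) J̃ ⟩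
      (H d * H d * ½ * (H k * H k)) * (T d * T d * 2# * (T k * T k * J̃))
        ≈⟨ *-congˡ (*-congˡ jacobian-cover) ⟨
      (H d * H d * ½ * (H k * H k)) * (T d * T d * 2# * Z̃)
        ≈⟨ *-congˡ (*-congˡ Z-factorisation) ⟩
      (H d * H d * ½ * (H k * H k)) * (T d * T d * 2# * (H μ * (Za * Zs)))
        ≈⟨ *-congˡ (solve 5 (λ td t hm a s → td :* td :* t :* (hm :* (a :* s)) := hm :* ((td :* td) :* a) :* (t :* s))
             refl (T d) 2# (H μ) Za Zs) ⟩
      (H d * H d * ½ * (H k * H k)) * (H μ * (T d * T d * Za) * (2# * Zs))
        ≈⟨ *-congˡ (*-cong (*-congˡ prym) jacobian-base) ⟩
      (H d * H d * ½ * (H k * H k)) * (H μ * (T k * (2# * 2#) * P) * (T ν * T k * J))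
        ≈⟨ solve 9 (λ hd h hk hm tk t tn p j →
             (hd :* hd :* h :* (hk :* hk)) :* (hm :* (tk :* (t :* t) :* p) :* (tn :* tk :* j)) :=
             (h :* t :* (hk :* tk :* (hk :* tk))) :* ((t :* tn) :* (hm :* (hd :* hd)) :* p :* j))
             refl (H d) ½ (H k) (H μ) (T k) 2# (T ν) P J ⟩
      (½ * 2# * (H k * T k * (H k * T k))) * (2# * T ν * (H μ * (H d * H d)) * P * J)
        ≈⟨ trans (*-congʳ (trans (*-cong ½*2 (trans (*-cong (^-inverse k) (^-inverse k)) (*-identityˡ 1#))) (*-identityˡ 1#)))
                 (*-identityˡ _) ⟩
      2# * T ν * (H μ * (H d * H d)) * P * J
        ≈⟨ *-congʳ (*-congʳ (*-congˡ (trans (^-homo-* ½ μ (d ℕ.+ d)) (*-congˡ (^-homo-* ½ d d))))) ⟨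
      2# ^ suc ν * ½ ^ (μ ℕ.+ (d ℕ.+ d)) * P * J
        ≈⟨ *-congʳ (*-congʳ (2^-⊖ (suc ν) (μ ℕ.+ (d ℕ.+ d)))) ⟨
      (2^ (suc ν ℤ.⊖ (μ ℕ.+ (d ℕ.+ d)))) * P * J
        ≡⟨ ≡.cong (λ z → (2^ z) * P * J) exponent ⟩
      (2^ (+ 1 ℤ.- + μ ℤ.+ + ν ℤ.- + 2 ℤ.* + d)) * P * J ∎
      where
      μ = m-dil
      ν = n-dil
      d = d-dil
      k = u cover
      J̃ = JacobianPolynomial Γ̃
      J = JacobianPolynomial Γ
      P = PrymPolynomial π
      H T : ℕ → Carrier
      H = ½ ^_
      T = 2# ^_
      Z̃ = Z (tabulate coverFactor) (⋀ extra) (⋀ extra)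
      Za = Z (tabulate antiFactor) (⋀ dilatedUnits) (⋀ dilatedUnits)
      Zs = Z (tabulate baseFactor) (⋀ (δ o ∷ [])) (⋀ (δ o ∷ []))
      1^ : ∀ i → 1# ^ i ≈ 1#
      1^ zero    = refl
      1^ (suc i) = trans (*-identityˡ _) (1^ i)
      jacobian-cover : Z̃ ≈ T k * T k * J̃
      jacobian-cover = begin
        Z̃
          ≈⟨ *-identityˡ Z̃ ⟨
        1# * Z̃
          ≈⟨ Z-Jacobian Γ̃ (split cover) 1# ⟩
        fromℤ (det B ℤ.* det B) * 1# ^ #V G̃ * J̃
          ≈⟨ *-congʳ (trans (*-congˡ (1^ (#V G̃))) (*-identityʳ _)) ⟩
        fromℤ (det B ℤ.* det B) * J̃
          ≈⟨ *-congʳ (trans (reflexive (≡.cong fromℤ (det²-split cover))) (trans (fromℤ-4^ k) (4^≈2^*2^ k))) ⟩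
        T k * T k * J̃ ∎
        where B = Realisation.basis (split cover)
      jacobian-base : 2# * Zs ≈ T ν * T k * J
      jacobian-base = begin
        2# * Zs
          ≈⟨ Z-Jacobian Γ (standard G) 2# ⟩
        fromℤ (det B ℤ.* det B) * T (#V G) * J
          ≈⟨ *-congʳ (trans (*-congʳ (trans (reflexive (≡.cong fromℤ (det²-standard G))) (+-identityʳ 1#))) (*-identityˡ _)) ⟩
        T (#V G) * J
          ≡⟨ ≡.cong (λ i → T i * J) (n-dil+u cover) ⟨
        T (ν ℕ.+ k) * J
          ≈⟨ *-congʳ (^-homo-* 2# ν k) ⟩
        T ν * T k * J ∎
        where B = Realisation.basis (standard G)
      prym : T d * T d * Za ≈ T k * (2# * 2#) * P
      prym = begin
        T d * T d * Za              ≈⟨ *-congʳ (4^≈2^*2^ d) ⟨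
        (4 · 1#) ^ d * Za           ≈⟨ Z-Prym ⟩
        T k * (4 · 1#) * P          ≈⟨ *-congʳ (*-congˡ four) ⟩
        T k * (2# * 2#) * P         ∎
      exponent : suc ν ℤ.⊖ (μ ℕ.+ (d ℕ.+ d)) ≡ + 1 ℤ.- + μ ℤ.+ + ν ℤ.- + 2 ℤ.* + d
      exponent = ≡.trans (≡.sym (ℤₚ.m-n≡m⊖n (suc ν) (μ ℕ.+ (d ℕ.+ d)))) (lemma (+ ν) (+ μ) (+ d))
        where
        lemma : ∀ ν μ d → (1ℤ ℤ.+ ν) ℤ.- (μ ℤ.+ (d ℤ.+ d)) ≡ 1ℤ ℤ.- μ ℤ.+ ν ℤ.- + 2 ℤ.* d
        lemma = ℤSolver.solve-∀

open import Data.Integer using (+_; _+_; _-_; _*_)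
open Factorisation using (Kirchhoff-Prym)

theorem3p10 :
  ∀ {c ℓ p} (K : LengthRing c ℓ p) (Γ̃ Γ : MetricGraph K) (π : MetricDoubleCover Γ̃ Γ) →
  Connected (whole (MetricGraph.graph Γ̃)) →
  Connected (whole (MetricGraph.graph Γ)) →
  let open LengthRing K
      open MetricDoubleCover π
  in JacobianPolynomial Γ̃ ≈
       (2^ (+ 1 - + m-dil + + n-dil - + 2 * + d-dil)) *ᴿ PrymPolynomial π *ᴿ JacobianPolynomial Γ
theorem3p10 K Γ̃ Γ π _ _ = Kirchhoff-Prym K Γ̃ Γ π
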